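{- There is an algorithm which, given a graph $G$ with $m$ edges, computes the truss decomposition of $G$ (i.e. the value $\tau(e)$ for every edge $e$ of $G$) using $O(m)$ memory and running in time $O(m\,\bar\delta(G))$. Moreover, $O(m\,\bar\delta(G)) \le O(m\,\alpha(G)) \le O(m^{3/2})$, where $\alpha(G)$ is the arboricity of $G$.
   Context: All graphs are finite, simple and undirected, with no isolated vertices; $n$ and $m$ denote the numbers of vertices and edges. Running time and memory are measured in the standard unit-cost random access machine model, in which arrays and adjacency tests $(u,v)\in E$ can be accessed in $O(1)$ time. A $k$-truss is a graph with no isolated vertices in which every edge is contained in at least $k$ triangles. For $L\subseteq E$, $G(L)$ is the graph with edge set $L$ and vertex set the set of endpoints of edges of $L$. A $k$-truss-component of $G$ is a maximal edge set $L\subseteq E$ such that $G(L)$ is a connected $k$-truss. The trussness $\tau(e)$ of an edge $e$ is the largest integer $k$ such that $e$ lies in a $k$-truss-component of $G$. (The $k$-truss-components for any $k$ can be recovered from $\tau$ by depth-first search restricted to edges with $\tau(e)\ge k$; truss decomposition means computing $\tau(e)$ for all $e$.) The average degeneracy of $G$ is $\bar\delta(G)=\frac1m\sum_{e=(u,v)\in E}\min(\deg(u),\deg(v))$. The arboricity $\alpha(G)$ is the minimum number of forests into which the edge set of $G$ can be partitioned. -}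

module Defs where

open import Data.Bool using (if_then_else_)
open import Data.Fin using (Fin; zero; suc; toℕ; fromℕ; fromℕ<; inject₁)
open import Data.Fin.Properties using (any?) renaming (_≟_ to _≟ᶠ_)
open import Data.Fin.Subset using (Subset; _∈_; _⊆_)
open import Data.Fin.Subset.Properties using (_∈?_)
open import Data.Integer using (+_)
open import Data.List using (List; allFin; drop; filter; head; length; map)
open import Data.Maybe as Maybe using (Maybe; just; nothing)
open import Data.Nat using (ℕ; zero; suc; _+_; _*_; _∸_; _⊓_; _≤_; _<?_; _≟_; _≡ᵇ_; NonZero)
open import Data.Nat.ListAction using (sum)
open import Data.Product using (Σ; ∃; ∃!; _×_; _,_)
open import Data.Rational using (ℚ; _/_)
open import Data.Sum using (_⊎_)
open import Data.Vec.Functional using (Vector; updateAt)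
open import Function using (const)
open import Function.Definitions using (Injective)
open import Relation.Binary.Construct.Closure.ReflexiveTransitive using (Star)
open import Relation.Binary.PropositionalEquality using (_≡_; _≢_)
open import Relation.Nullary using (¬_; Dec; yes; no)
open import Relation.Nullary.Decidable using (_×-dec_; _⊎-dec_; dec⇒maybe)

------------------------------------------------------------------------
-- Graphs

-- Vertices are Fin n and edges are Fin m.  Each edge is stored in an arbitrary
-- one of its two orientations; edges are undirected because everything below
-- goes through Incident and Joins.
record Graph : Set where
  field
    n m     : ℕ
    src tgt : Fin m → Fin n

  Incident : Fin n → Fin m → Set
  Incident v e = src e ≡ v ⊎ tgt e ≡ v

  Joins : Fin m → Fin n → Fin n → Set
  Joins e u v = (src e ≡ u × tgt e ≡ v) ⊎ (src e ≡ v × tgt e ≡ u)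

  field
    loopless    : ∀ e → src e ≢ tgt e
    simple      : ∀ {e f u v} → Joins e u v → Joins f u v → e ≡ f
    no-isolated : ∀ v → ∃ λ e → Incident v e

  incident? : ∀ v e → Dec (Incident v e)
  incident? v e = (src e ≟ᶠ v) ⊎-dec (tgt e ≟ᶠ v)

  joins? : ∀ e u v → Dec (Joins e u v)
  joins? e u v = ((src e ≟ᶠ u) ×-dec (tgt e ≟ᶠ v)) ⊎-dec ((src e ≟ᶠ v) ×-dec (tgt e ≟ᶠ u))

  deg : Fin n → ℕ
  deg v = length (filter (incident? v) (allFin m))

  -- The average degeneracy; it is undefined for the graph without edges.
  δ̄ : .{{_ : NonZero m}} → ℚ
  δ̄ = + sum (map (λ e → deg (src e) ⊓ deg (tgt e)) (allFin m)) / m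

-- An edge set L stands for the graph G(L), whose vertices are the endpoints of
-- the edges in L.
module _ (G : Graph) where
  open Graph G

  VertexOf : Subset m → Fin n → Set
  VertexOf L v = ∃ λ e → e ∈ L × Incident v e

  Adj : Subset m → Fin n → Fin n → Set
  Adj L u v = ∃ λ e → e ∈ L × Joins e u v

  adj? : ∀ L u v → Dec (Adj L u v)
  adj? L u v = any? (λ e → (e ∈? L) ×-dec joins? e u v)

  Connected : Subset m → Set
  Connected L = ∀ {u v} → VertexOf L u → VertexOf L v → Star (Adj L) u v

  -- For e ∈ L: the triangles of G(L) containing e, counted by their apices.
  triangles : Subset m → Fin m → ℕ
  triangles L e =
    length (filter (λ w → adj? L (src e) w ×-dec adj? L (tgt e) w) (allFin n))

  -- G(L) has no isolated vertices for any L.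
  IsTruss : ℕ → Subset m → Set
  IsTruss k L = ∀ e → e ∈ L → k ≤ triangles L e

  IsConnectedTruss : ℕ → Subset m → Set
  IsConnectedTruss k L = Connected L × IsTruss k L

  IsTrussComponent : ℕ → Subset m → Set
  IsTrussComponent k L =
    IsConnectedTruss k L × (∀ L′ → IsConnectedTruss k L′ → L ⊆ L′ → L′ ⊆ L)

  InTrussComponent : ℕ → Fin m → Set
  InTrussComponent k e = ∃ λ L → IsTrussComponent k L × e ∈ L

  IsTrussness : Fin m → ℕ → Set
  IsTrussness e k = InTrussComponent k e × (∀ k′ → InTrussComponent k′ e → k′ ≤ k)

  record Cycle (L : Subset m) : Set where
    field
      extra    : ℕ
      vertex   : Fin (3 + extra) → Fin n
      distinct : Injective _≡_ _≡_ vertex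
      step     : ∀ i → Adj L (vertex (inject₁ i)) (vertex (suc i))
      close    : Adj L (vertex (fromℕ (2 + extra))) (vertex zero)

  IsForest : Subset m → Set
  IsForest L = ¬ Cycle L

  ForestPartition : ℕ → Set
  ForestPartition k = Σ (Fin k → Subset m) λ F →
    (∀ e → ∃! _≡_ λ j → e ∈ F j) × (∀ j → IsForest (F j))

  IsArboricity : ℕ → Set
  IsArboricity a = ForestPartition a × (∀ k → ForestPartition k → a ≤ k)

------------------------------------------------------------------------
-- Unit-cost random access machines

-- A program uses fixed finite numbers of registers and of arrays, both holding
-- natural numbers.  Names written x, y, z are registers and A is an array;
-- the effect of each instruction is given by `exec`.  The only arithmetic is
-- addition and truncated subtraction: unit-cost multiplication of unbounded
-- numbers would make the machine unreasonably strong.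
data Instr (regs arrays : ℕ) : Set where
  SET       : (x : Fin regs) (k : ℕ) → Instr regs arrays
  ADD SUB   : (x y z : Fin regs) → Instr regs arrays
  LOAD      : (x : Fin regs) (A : Fin arrays) (y : Fin regs) → Instr regs arrays
  STORE     : (A : Fin arrays) (y x : Fin regs) → Instr regs arrays
  JZ        : (x : Fin regs) (target : ℕ) → Instr regs arrays
  ORDER     : (x : Fin regs) → Instr regs arrays
  SIZE      : (x : Fin regs) → Instr regs arrays
  SRC TGT   : (x y : Fin regs) → Instr regs arrays
  EDGE      : (x y z : Fin regs) → Instr regs arrays

record Program : Set where
  field
    regs arrays : ℕ
    code        : List (Instr regs arrays)
    out         : Fin arrays

-- The machine running P on the input graph G, with s cells in every array.
-- The input is read-only: an edge list (ORDER, SIZE, SRC, TGT) and an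
-- adjacency table (EDGE), which occupy O(m) words themselves.
module Machine (P : Program) (G : Graph) (s : ℕ) where
  open Program P
  open Graph G

  record Config : Set where
    constructor config
    field
      pc  : ℕ
      reg : Vector ℕ regs
      mem : Fin arrays → Vector ℕ s
  open Config

  words : ℕ
  words = regs + arrays * s

  initial : Config
  initial = config 0 (const 0) (const (const 0))

  index : ∀ k → ℕ → Maybe (Fin k)
  index k i = Maybe.map (λ i<k → fromℕ< i<k) (dec⇒maybe (i <? k))

  -- The adjacency table: 0 for a non-edge, and 1 + e for the edge e.
  edgeTable : ℕ → ℕ → ℕ
  edgeTable u v with any? (λ e →
      ((toℕ (src e) ≟ u) ×-dec (toℕ (tgt e) ≟ v)) ⊎-dec
      ((toℕ (src e) ≟ v) ×-dec (toℕ (tgt e) ≟ u)))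
  ... | yes (e , _) = suc (toℕ e)
  ... | no  _       = 0

  setReg : Fin regs → ℕ → Config → Config
  setReg x k (config p r M) = config (suc p) (updateAt r x (const k)) M

  setMem : Fin arrays → Fin s → ℕ → Config → Config
  setMem A i k (config p r M) =
    config (suc p) r (updateAt M A (λ row → updateAt row i (const k)))

  -- `nothing` is a fault: an index out of bounds.
  exec : Instr regs arrays → Config → Maybe Config
  exec (SET x k)     σ = just (setReg x k σ)
  exec (ADD x y z)   σ = just (setReg x (reg σ y + reg σ z) σ)
  exec (SUB x y z)   σ = just (setReg x (reg σ y ∸ reg σ z) σ)
  exec (LOAD x A y)  σ = Maybe.map (λ i → setReg x (mem σ A i) σ) (index s (reg σ y))
  exec (STORE A y x) σ = Maybe.map (λ i → setMem A i (reg σ x) σ) (index s (reg σ y))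
  exec (JZ x target) σ =
    just (config (if reg σ x ≡ᵇ 0 then target else suc (pc σ)) (reg σ) (mem σ))
  exec (ORDER x)     σ = just (setReg x n σ)
  exec (SIZE x)      σ = just (setReg x m σ)
  exec (SRC x y)     σ = Maybe.map (λ e → setReg x (toℕ (src e)) σ) (index m (reg σ y))
  exec (TGT x y)     σ = Maybe.map (λ e → setReg x (toℕ (tgt e)) σ) (index m (reg σ y))
  exec (EDGE x y z)  σ = just (setReg x (edgeTable (reg σ y) (reg σ z)) σ)

  fetch : Config → Maybe (Instr regs arrays)
  fetch σ = head (drop (pc σ) code)

  -- σ ⇓[ t ] σ′: from σ the machine halts in σ′ after exactly t instructions.
  -- It halts when pc leaves the code; a fault is not halting.
  data _⇓[_]_ (σ : Config) : ℕ → Config → Set where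
    halt : fetch σ ≡ nothing → σ ⇓[ 0 ] σ
    step : ∀ {i σ′ σ″ t} → fetch σ ≡ just i → exec i σ ≡ just σ′ →
           σ′ ⇓[ t ] σ″ → σ ⇓[ suc t ] σ″

  output : Config → Fin m → Maybe ℕ
  output σ e = Maybe.map (mem σ out) (index s (toℕ e))

  OutputsTrussness : Config → Set
  OutputsTrussness σ = ∀ e → ∃ λ k → output σ e ≡ just k × IsTrussness G e k

ℕ→ℚ : ℕ → ℚ
ℕ→ℚ k = + k / 1

{-# OPTIONS --safe #-}
-- The trussness is computed by peeling.  First every edge e = uv gets its number of
-- triangles, by a walk over the edges at the end of smaller degree with adjacency tests
-- for the other end; this costs O(min(deg u, deg v)).  At level k the edges with k
-- triangles left are removed, an edge whose count drops to k is removed at the same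
-- level, and the count of an edge stops at its trussness.  Removing e costs
-- O(min(deg u, deg v)) again.  No bucket queue is needed to find the edges with count k:
-- all remaining edges can be scanned at every level, since e remains for at most
-- 1 + min(deg u, deg v) levels.
--
-- For the arboricity: the edges of a forest can be assigned injectively to end points,
-- so the minima of the degrees add up to at most 2m for every forest of a partition.
-- Conversely, if edges are oriented towards larger degree then the outdegree is at most
-- √(2m), and numbering the out-edges of every vertex gives a partition into forests.
module Submission where

open import Defs
open import Data.Bool using (Bool; true; false; if_then_else_; T)
open import Data.Empty using (⊥; ⊥-elim)
open import Data.Fin using (Fin; zero; suc; toℕ; fromℕ; fromℕ<; inject₁; inject≤; #_)
open import Data.Fin.Properties using (any?; all?; toℕ-injective; toℕ<n; toℕ-fromℕ<; toℕ-inject₁; toℕ-inject≤) renaming (_≟_ to _≟ᶠ_)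
open import Data.Fin.Relation.Unary.Top using (‵fromℕ; ‵inj₁) renaming (view to topView)
open import Data.Fin.Subset using (Subset; ⊤; _∈_; _∉_; _⊆_; ∁; ∣_∣)
open import Data.Fin.Subset.Properties using (_∈?_; ∈⊤; p⊂q⇒∣p∣<∣q∣; p⊂q⇒∁p⊃∁q)
import Data.Integer as ℤ
import Data.Integer.Properties as ℤ
open import Data.List using (List; []; _∷_; [_]; _++_; allFin; cartesianProduct; concatMap; drop; filter; head; length; lookup; map; tabulate)
open import Data.List.Membership.DecPropositional using () renaming (_∈?_ to decMember)
open import Data.List.Membership.Propositional using () renaming (_∈_ to _∈ˡ_; _∉_ to _∉ˡ_)
open import Data.List.Membership.Propositional.Properties using (∈-∃++; ∈-++⁺ˡ; ∈-++⁺ʳ; ∈-++⁻; ∈-map⁺; ∈-map⁻; ∈-filter⁺; ∈-filter⁻; ∈-allFin; ∈-cartesianProduct⁺; ∈-lookup)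
open import Data.List.Properties using (++-assoc; ++-identityʳ; length-++; length-filter; length-map; length-tabulate; filter-accept; filter-reject; map-cong)
open import Data.List.Relation.Unary.All as All using (All; []; _∷_)
open import Data.List.Relation.Unary.AllPairs using ([]; _∷_)
open import Data.List.Relation.Unary.Any as Any using (here; there)
open import Data.List.Relation.Unary.Any.Properties using (lookup-index)
open import Data.List.Relation.Unary.Unique.Propositional using (Unique)
open import Data.List.Relation.Unary.Unique.Propositional.Properties using (allFin⁺; filter⁺; Unique[x∷xs]⇒x∉xs) renaming (map⁺ to Unique-map⁺; ++⁺ to Unique-++⁺; drop⁺ to Unique-drop⁺)
open import Data.Maybe as Maybe using (just; nothing)
open import Data.Nat as ℕ using (ℕ; zero; suc; _+_; _*_; _∸_; _⊓_; _^_; _≤_; _<_; _≡ᵇ_; _≤?_; _<?_; z≤n; s≤s; z<s; NonZero) renaming (_≟_ to _≟ℕ_)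
open import Data.Nat.ListAction using (sum)
open import Data.Nat.Properties
open import Data.Nat.Tactic.RingSolver using (solve-∀)
open import Data.Product using (∃; _×_; _,_; proj₁; proj₂)
open import Data.Rational as ℚ using (ℚ)
import Data.Rational.Properties as ℚ
open import Data.Rational.Unnormalised as ℚᵘ using (mkℚᵘ; *≡*; *≤*)
import Data.Rational.Unnormalised.Properties as ℚᵘ
open import Data.Sum using (_⊎_; inj₁; inj₂)
open import Data.Unit using () renaming (⊤ to Unit)
import Data.Vec as Vec
open import Data.Vec.Functional using (Vector; updateAt)
open import Data.Vec.Functional.Properties using (updateAt-updates; updateAt-minimal)
open import Data.Vec.Properties using (lookup∘tabulate; []=⇒lookup; lookup⇒[]=)
open import Function using (_∘_; const; id; case_of_)
open import Relation.Binary.Construct.Closure.ReflexiveTransitive using (Star; ε; _◅_; _◅◅_)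
open import Relation.Binary.Definitions using (tri<; tri≈; tri>)
open import Relation.Binary.PropositionalEquality using (_≡_; _≢_; refl; sym; trans; cong; cong₂; subst; subst₂; module ≡-Reasoning)
open import Relation.Nullary using (¬_; Dec; yes; no; does)
open import Relation.Nullary.Decidable using (_×-dec_; _⊎-dec_; _→-dec_; ¬?; dec-true; dec-false)

-- Sets and lists

-- The array `SUPP` is counter and output at once, and this shapes the invariants. While an edge e
-- is removed at level k, the stored counts are out of date: an edge in a triangle with e that the
-- walk has not reached yet still counts that triangle. `Pending` names these edges, and `Level`
-- claims exactness only for counts above k, because a count that has come down to k is final and
-- must stop following the graph. The set of remaining edges exists only in the proof. Trussness is
-- defined by connected trusses, but peeling never looks at connectivity. It yields, for every e,
-- some truss around e and a bound on all trusses around e; one closure argument supplies the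
-- components at the end. Time is amortised. Each edge owns a budget for its removal and another for
-- its future scans, and the fixed cost of a level is charged to the last edge scanned there.
-- Degrees of end points are positive, so m is at most the sum D of the minima and terms linear in m
-- are absorbed. As m times the average degeneracy is D, the estimates are made in natural numbers.

module _ {n : ℕ} {P : Fin n → Set} (P? : ∀ x → Dec (P x)) where

  subset : Subset n
  subset = Vec.tabulate (λ x → does (P? x))

  ∈-subset⁺ : ∀ {x} → P x → x ∈ subset
  ∈-subset⁺ {x} px = lookup⇒[]= x subset (trans (lookup∘tabulate _ x) (dec-true (P? x) px))

  ∈-subset⁻ : ∀ {x} → x ∈ subset → P x
  ∈-subset⁻ {x} x∈ with P? x | trans (sym (lookup∘tabulate (λ y → does (P? y)) x)) ([]=⇒lookup x∈)
  ... | yes px | _  = px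
  ... | no  _  | ()

-- The partner of the head is deleted from `ys`, and injectivity keeps the other partners away from
-- it. A relation serves better than a function because edges and far ends are matched by `Joins` in
-- both directions.
length-injection : {A B : Set} (R : A → B → Set) {xs : List A} {ys : List B} → Unique xs →
  (∀ {x} → x ∈ˡ xs → ∃ λ y → y ∈ˡ ys × R x y) →
  (∀ {x x′ y} → R x y → R x′ y → x ≡ x′) →
  length xs ≤ length ys
length-injection R {[]} _ _ _ = z≤n
length-injection R {x ∷ xs} {ys} (x∉ ∷ uniq) f inj with f (here refl)
... | y , y∈ , Rxy with ∈-∃++ y∈
... | as , bs , refl = begin
  suc (length xs)             ≤⟨ s≤s (length-injection R uniq f′ inj) ⟩
  suc (length (as ++ bs))     ≡⟨ cong suc (length-++ as) ⟩
  suc (length as + length bs) ≡⟨ +-suc (length as) (length bs) ⟨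
  length as + suc (length bs) ≡⟨ length-++ as ⟨
  length (as ++ y ∷ bs)       ∎
  where
  open ≤-Reasoning
  f′ : ∀ {x′} → x′ ∈ˡ xs → ∃ λ y′ → y′ ∈ˡ (as ++ bs) × R x′ y′
  f′ {x′} x′∈ with f (there x′∈)
  ... | y′ , y′∈ , Rx′y′ with ∈-++⁻ as y′∈
  ... | inj₁ p           = y′ , ∈-++⁺ˡ p , Rx′y′
  ... | inj₂ (here refl) = ⊥-elim (All.lookup x∉ x′∈ (inj Rxy Rx′y′))
  ... | inj₂ (there p)   = y′ , ∈-++⁺ʳ as p , Rx′y′

length-bijection : {A B : Set} (R : A → B → Set) {xs : List A} {ys : List B} →
  Unique xs → Unique ys →
  (∀ {x} → x ∈ˡ xs → ∃ λ y → y ∈ˡ ys × R x y) →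
  (∀ {y} → y ∈ˡ ys → ∃ λ x → x ∈ˡ xs × R x y) →
  (∀ {x x′ y} → R x y → R x′ y → x ≡ x′) →
  (∀ {x y y′} → R x y → R x y′ → y ≡ y′) →
  length xs ≡ length ys
length-bijection R uxs uys f g inj fun =
  ≤-antisym (length-injection R uxs f inj) (length-injection (λ y x → R x y) uys g fun)

module _ {A B : Set} (L : A → List B) where

  private
    pairs : List A → List (A × B)
    pairs = concatMap (λ x → map (x ,_) (L x))

    ∈-pairs⁻ : ∀ xs {x c} → (x , c) ∈ˡ pairs xs → x ∈ˡ xs × c ∈ˡ L x
    ∈-pairs⁻ (x ∷ xs) p with ∈-++⁻ (map (x ,_) (L x)) p
    ... | inj₁ q with ∈-map⁻ (x ,_) q
    ...   | _ , c∈ , refl = here refl , c∈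
    ∈-pairs⁻ (x ∷ xs) p | inj₂ q with ∈-pairs⁻ xs q
    ... | x∈ , c∈ = there x∈ , c∈

    pairs-unique : ∀ {xs} → Unique xs → (∀ x → Unique (L x)) → Unique (pairs xs)
    pairs-unique []          _  = []
    pairs-unique {x ∷ xs} (x∉ ∷ u) uL = Unique-++⁺
      (Unique-map⁺ (cong proj₂) (uL x))
      (pairs-unique u uL)
      λ { (p , q) → case ∈-map⁻ (x ,_) p of λ { (_ , _ , refl) → All.lookup x∉ (proj₁ (∈-pairs⁻ xs q)) refl } }

    length-pairs : ∀ xs → length (pairs xs) ≡ sum (map (λ x → length (L x)) xs)
    length-pairs []       = refl
    length-pairs (x ∷ xs) = trans (length-++ (map (x ,_) (L x)))
      (cong₂ _+_ (length-map (x ,_) (L x)) (length-pairs xs))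

  -- A charging argument: the pairs of an `x` and an entry of `L x` form one list without
  -- repetitions, and each pair is charged to its own entry of `ys`. The degree sums in both
  -- arboricity bounds are estimated in this way.
  sum-length-injection : {C : Set} (R : A → B → C → Set) {xs : List A} {ys : List C} →
    Unique xs → (∀ x → Unique (L x)) →
    (∀ {x c} → x ∈ˡ xs → c ∈ˡ L x → ∃ λ y → y ∈ˡ ys × R x c y) →
    (∀ {x c x′ c′ y} → R x c y → R x′ c′ y → x ≡ x′ × c ≡ c′) →
    sum (map (λ x → length (L x)) xs) ≤ length ys
  sum-length-injection R {xs} u uL f inj = subst (_≤ _) (length-pairs xs)
    (length-injection (λ p y → R (proj₁ p) (proj₂ p) y) (pairs-unique u uL)
      (λ p → f (proj₁ (∈-pairs⁻ xs p)) (proj₂ (∈-pairs⁻ xs p)))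
      λ r r′ → cong₂ _,_ (proj₁ (inj r r′)) (proj₂ (inj r r′)))

module _ {A : Set} {f g : A → ℕ} where

  sum-mono : ∀ {xs} → (∀ {x} → x ∈ˡ xs → f x ≤ g x) → sum (map f xs) ≤ sum (map g xs)
  sum-mono {[]}     _  = z≤n
  sum-mono {x ∷ xs} le = +-mono-≤ (le (here refl)) (sum-mono (le ∘ there))

  -- The slack `c` at the single entry `y` survives the summation. For `potential` it is the budget
  -- set free by the removal of one edge.
  sum-mono-slack : ∀ {c xs y} → y ∈ˡ xs → (∀ {x} → x ∈ˡ xs → f x ≤ g x) → c + f y ≤ g y →
    c + sum (map f xs) ≤ sum (map g xs)
  sum-mono-slack {c} {x ∷ xs} (here refl) le slack =
    subst (_≤ g x + sum (map g xs)) (+-assoc c (f x) _) (+-mono-≤ slack (sum-mono (le ∘ there)))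
  sum-mono-slack {c} {x ∷ xs} (there y∈) le slack =
    subst (_≤ g x + sum (map g xs)) (rearrange (f x) c (sum (map f xs)))
      (+-mono-≤ (le (here refl)) (sum-mono-slack y∈ (le ∘ there) slack))
    where
    rearrange : ∀ a b c → a + (b + c) ≡ b + (a + c)
    rearrange = solve-∀

sum-const : {A : Set} (c : ℕ) (xs : List A) → sum (map (const c) xs) ≡ length xs * c
sum-const c []       = refl
sum-const c (x ∷ xs) = cong (c +_) (sum-const c xs)

sum-affine : {A : Set} (a b : ℕ) (f : A → ℕ) (xs : List A) →
  sum (map (λ x → a + b * f x) xs) ≡ a * length xs + b * sum (map f xs)
sum-affine a b f []       = sym (cong₂ _+_ (*-zeroʳ a) (*-zeroʳ b))
sum-affine a b f (x ∷ xs) = trans (cong (a + b * f x +_) (sum-affine a b f xs))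
  (rearrange a b (f x) (length xs) (sum (map f xs)))
  where
  rearrange : ∀ a b x l s → a + b * x + (a * l + b * s) ≡ a * suc l + b * (x + s)
  rearrange = solve-∀

length-allFin : ∀ n → length (allFin n) ≡ n
length-allFin n = length-tabulate id

drop-allFin : ∀ {n} (i : Fin n) → drop (toℕ i) (allFin n) ≡ i ∷ drop (suc (toℕ i)) (allFin n)
drop-allFin = drop-tabulate id
  where
  drop-tabulate : ∀ {n} {A : Set} (f : Fin n → A) (i : Fin n) →
    drop (toℕ i) (tabulate f) ≡ f i ∷ drop (suc (toℕ i)) (tabulate f)
  drop-tabulate f zero    = refl
  drop-tabulate f (suc i) = drop-tabulate (f ∘ suc) i

-- A structured language compiled to the machine

data Cmd (R K : ℕ) : Set where
  block : List (Instr R K) → Cmd R K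
  _⨟_   : Cmd R K → Cmd R K → Cmd R K
  when  : Fin R → Cmd R K → Cmd R K
  -- `until x c` repeats c, at least once, until x is nonzero: unlike a while
  -- loop it needs no unconditional jump.
  until : Fin R → Cmd R K → Cmd R K

infixr 5 _⨟_

size : ∀ {R K} → Cmd R K → ℕ
size (block is)  = length is
size (c ⨟ d)     = size c + size d
size (when x c)  = suc (size c)
size (until x c) = size c + 1

-- The number is the address of the first instruction, since the targets of `JZ` are absolute.
-- `size` does not depend on it, so a forward target is known before the body is compiled.
compile : ∀ {R K} → ℕ → Cmd R K → List (Instr R K)
compile p (block is)  = is
compile p (c ⨟ d)     = compile p c ++ compile (p + size c) d
compile p (when x c)  = JZ x (suc p + size c) ∷ compile (suc p) c
compile p (until x c) = compile p c ++ [ JZ x p ]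

length-compile : ∀ {R K} p (c : Cmd R K) → length (compile p c) ≡ size c
length-compile p (block is)  = refl
length-compile p (c ⨟ d)     = trans (length-++ (compile p c))
  (cong₂ _+_ (length-compile p c) (length-compile (p + size c) d))
length-compile p (when x c)  = cong suc (length-compile (suc p) c)
length-compile p (until x c) = trans (length-++ (compile p c)) (cong (_+ 1) (length-compile p c))

-- Symbolic execution and weakest preconditions

write : (ℕ → ℕ) → ℕ → ℕ → ℕ → ℕ
write f i v j = if j ≡ᵇ i then v else f j

write-same : ∀ {f i v j} → j ≡ i → write f i v j ≡ v
write-same {i = zero}          refl = refl
write-same {f} {i = suc i} {v} refl = write-same {f ∘ suc} {i} {v} refl

write-other : ∀ {f i v j} → j ≢ i → write f i v j ≡ f j
write-other {f} {i} {v} {j} j≢i with j ≡ᵇ i in eq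
... | true  = ⊥-elim (j≢i (≡ᵇ⇒≡ j i (subst T (sym eq) _)))
... | false = refl

head-drop-none : ∀ {A : Set} (xs : List A) → head (drop (length xs) xs) ≡ nothing
head-drop-none []       = refl
head-drop-none (x ∷ xs) = head-drop-none xs

drop-suc : ∀ {A : Set} {y : A} {ys} p xs → drop p xs ≡ y ∷ ys → drop (suc p) xs ≡ ys
drop-suc zero    (x ∷ xs) refl = refl
drop-suc (suc p) (x ∷ xs) eq   = drop-suc p xs eq
drop-suc (suc p) []       ()

module Semantics {R K : ℕ} (code : List (Instr R K)) (out : Fin K) (G : Graph) (s : ℕ) where
  open Graph G

  prog : Program
  prog = record { regs = R ; arrays = K ; code = code ; out = out }

  open Machine prog G s using (Config; config; exec; fetch; index; edgeTable; _⇓[_]_; halt; step)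
  open Config using (pc)

  -- The elapsed time is part of the state, so that postconditions can bound it.
  record State : Set where
    constructor state
    field
      reg  : Vector ℕ R
      mem  : Fin K → ℕ → ℕ
      time : ℕ
  open State public

  setReg : Fin R → ℕ → State → State
  setReg x k (state r M t) = state (updateAt r x (const k)) M (suc t)

  setMem : Fin K → ℕ → ℕ → State → State
  setMem A i k (state r M t) = state r (updateAt M A (λ row → write row i k)) (suc t)

  tick : State → State
  tick (state r M t) = state r M (suc t)

  -- The values computed by the instructions are named in the proof of `straight`
  -- rather than substituted: this keeps symbolic states linear in size.
  straight : List (Instr R K) → (State → Set) → State → Set
  straight []                 Q σ = Q σ
  straight (SET x k ∷ is)     Q σ = straight is Q (setReg x k σ)
  straight (ADD x y z ∷ is)   Q σ = ∃ λ v → reg σ y + reg σ z ≡ v × straight is Q (setReg x v σ)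
  straight (SUB x y z ∷ is)   Q σ = ∃ λ v → reg σ y ∸ reg σ z ≡ v × straight is Q (setReg x v σ)
  straight (LOAD x A y ∷ is)  Q σ = ∃ λ i → reg σ y ≡ i × i < s ×
    ∃ λ v → mem σ A i ≡ v × straight is Q (setReg x v σ)
  straight (STORE A y x ∷ is) Q σ = ∃ λ i → reg σ y ≡ i × i < s ×
    ∃ λ v → reg σ x ≡ v × straight is Q (setMem A i v σ)
  straight (JZ x t ∷ is)      Q σ = ⊥
  straight (ORDER x ∷ is)     Q σ = straight is Q (setReg x n σ)
  straight (SIZE x ∷ is)      Q σ = straight is Q (setReg x m σ)
  straight (SRC x y ∷ is)     Q σ =
    ∃ λ e → reg σ y ≡ toℕ e × straight is Q (setReg x (toℕ (src e)) σ)
  straight (TGT x y ∷ is)     Q σ =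
    ∃ λ e → reg σ y ≡ toℕ e × straight is Q (setReg x (toℕ (tgt e)) σ)
  straight (EDGE x y z ∷ is)  Q σ =
    ∃ λ v → edgeTable (reg σ y) (reg σ z) ≡ v × straight is Q (setReg x v σ)

  private
    -- In a `State` a row of memory is a total function, so writes carry no bound; only the cells
    -- below `s` exist in the machine. Rows are therefore compared cell by cell, while the registers
    -- undergo the same `updateAt` on both sides and stay equal as functions.
    record _~_ (σ : State) (κ : Config) : Set where
      constructor sim
      field
        reg≡ : reg σ ≡ Config.reg κ
        mem≡ : ∀ A i → Config.mem κ A i ≡ mem σ A (toℕ i)

    record CodeAt (p : ℕ) (is : List (Instr R K)) : Set where
      constructor _,_
      field
        rest  : List (Instr R K)
        drop≡ : drop p code ≡ is ++ rest

    codeAt-++ˡ : ∀ {p} is {js} → CodeAt p (is ++ js) → CodeAt p is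
    codeAt-++ˡ is {js} (rest , eq) = js ++ rest , trans eq (++-assoc is js rest)

    codeAt-tail : ∀ {p i is} → CodeAt p (i ∷ is) → CodeAt (suc p) is
    codeAt-tail {p} (rest , eq) = rest , drop-suc p code eq

    codeAt-++ʳ : ∀ {p} is {js} → CodeAt p (is ++ js) → CodeAt (p + length is) js
    codeAt-++ʳ {p} []  {js} at = subst (λ q → CodeAt q js) (sym (+-identityʳ p)) at
    codeAt-++ʳ {p} (i ∷ is) {js} at =
      subst (λ q → CodeAt q js) (sym (+-suc p (length is))) (codeAt-++ʳ is (codeAt-tail at))

    -- The relation `⇓` describes complete runs only, so a partial run is given by its effect on
    -- them: every halting run from `finalκ` is prolonged backwards to `κ`. Partial runs then
    -- compose like functions.
    record Outcome (p : ℕ) (Q : State → Set) (τ : ℕ) (κ : Config) : Set where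
      constructor outcome
      field
        {final}  : State
        {finalκ} : Config
        {steps}  : ℕ
        reaches  : ∀ {κ′ t} → finalκ ⇓[ t ] κ′ → κ ⇓[ steps + t ] κ′
        time≡    : time final ≡ steps + τ
        pc≡      : pc finalκ ≡ p
        final~   : final ~ finalκ
        holds    : Q final

    done : ∀ {Q σ κ} → σ ~ κ → Q σ → Outcome (pc κ) Q (time σ) κ
    done s~ q = outcome id refl refl s~ q

    advance : ∀ {p i is κ κ′ q Q τ} → CodeAt p (i ∷ is) → pc κ ≡ p → exec i κ ≡ just κ′ →
      Outcome q Q (suc τ) κ′ → Outcome q Q τ κ
    advance {p} {κ = κ} (rest , eq) refl ex (outcome reaches time≡ pc≡ s~ q) =
      outcome (λ h → step (cong head eq) ex (reaches h)) (trans time≡ (+-suc _ _)) pc≡ s~ q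

    at-pc : ∀ {p q Q τ κ} → p ≡ q → Outcome p Q τ κ → Outcome q Q τ κ
    at-pc refl o = o

    index-< : ∀ {k i} → i < k → ∃ λ j → index k i ≡ just j × toℕ j ≡ i
    index-< {k} {i} i<k with i <? k
    ... | yes p = fromℕ< p , refl , toℕ-fromℕ< p
    ... | no ¬p = ⊥-elim (¬p i<k)

    index-toℕ : ∀ {k} (j : Fin k) → index k (toℕ j) ≡ just j
    index-toℕ j with index-< (toℕ<n j)
    ... | j′ , eq , eq′ = trans eq (cong just (toℕ-injective eq′))

    setMem-~ : ∀ {r M N p τ} A (i : Fin s) v → (∀ B j → N B j ≡ M B (toℕ j)) →
      setMem A (toℕ i) v (state r M τ) ~ config p r (updateAt N A (λ row → updateAt row i (const v)))
    setMem-~ {r} {M} {N} A i v M~N = sim refl go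
      where
      go : ∀ B j → updateAt N A (λ row → updateAt row i (const v)) B j
                 ≡ updateAt M A (λ row → write row (toℕ i) v) B (toℕ j)
      go B j with B ≟ᶠ A
      ... | no B≢A rewrite updateAt-minimal B A {λ row → updateAt row i (const v)} N B≢A
                         | updateAt-minimal B A {λ row → write row (toℕ i) v} M B≢A = M~N B j
      ... | yes refl rewrite updateAt-updates A {λ row → updateAt row i (const v)} N
                           | updateAt-updates A {λ row → write row (toℕ i) v} M with j ≟ᶠ i
      ...   | yes refl = trans (updateAt-updates j (N A)) (sym (write-same {M A} {toℕ j} refl))
      ...   | no j≢i   = trans (updateAt-minimal j i (N A) j≢i)
                           (trans (M~N A j) (sym (write-other {M A} (j≢i ∘ toℕ-injective))))

    run-straight : ∀ is {Q σ p κ} → CodeAt p is → pc κ ≡ p → σ ~ κ → straight is Q σ →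
      Outcome (p + length is) Q (time σ) κ

    continue : ∀ i is {Q σ p κ κ′ τ} → CodeAt p (i ∷ is) → pc κ ≡ p → exec i κ ≡ just κ′ →
      pc κ′ ≡ suc (pc κ) → σ ~ κ′ → time σ ≡ suc τ → straight is Q σ →
      Outcome (p + length (i ∷ is)) Q τ κ
    continue i is {p = p} at refl ex pc≡ s~ refl q =
      advance at refl ex (at-pc (sym (+-suc p (length is))) (run-straight is (codeAt-tail at) pc≡ s~ q))

    run-straight [] {p = p} at refl s~ q = at-pc (sym (+-identityʳ p)) (done s~ q)
    run-straight (SET x k ∷ is) at pc≡ (sim refl m~) q =
      continue _ is at pc≡ refl refl (sim refl m~) refl q
    run-straight (ADD x y z ∷ is) at pc≡ (sim refl m~) (_ , refl , q) =
      continue _ is at pc≡ refl refl (sim refl m~) refl q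
    run-straight (SUB x y z ∷ is) at pc≡ (sim refl m~) (_ , refl , q) =
      continue _ is at pc≡ refl refl (sim refl m~) refl q
    run-straight (LOAD x A y ∷ is) {σ = σ} at pc≡ (sim refl m~) (_ , refl , lt , _ , refl , q) with index-< lt
    ... | j , eq , eq′ = continue _ is at pc≡ (cong (Maybe.map _) eq) refl
      (sim (cong (λ v → updateAt (reg σ) x (const v)) (trans (cong (mem σ A) (sym eq′)) (sym (m~ A j)))) m~) refl q
    run-straight (STORE A y x ∷ is) {σ = σ} at pc≡ (sim refl m~) (_ , refl , lt , _ , refl , q) with index-< lt
    ... | j , eq , eq′ = continue _ is {σ = setMem A (reg σ y) (reg σ x) σ} at pc≡ (cong (Maybe.map _) eq) refl
      (subst (λ i → setMem A i (reg σ x) σ ~ Machine.setMem prog G s A j (reg σ x) (config _ (reg σ) _)) eq′ (setMem-~ A j _ m~)) refl q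
    run-straight (ORDER x ∷ is) at pc≡ (sim refl m~) q =
      continue _ is at pc≡ refl refl (sim refl m~) refl q
    run-straight (SIZE x ∷ is) at pc≡ (sim refl m~) q =
      continue _ is at pc≡ refl refl (sim refl m~) refl q
    run-straight (SRC x y ∷ is) at pc≡ (sim refl m~) (e , eq , q) =
      continue _ is at pc≡ (cong (Maybe.map _) (trans (cong (index m) eq) (index-toℕ e))) refl (sim refl m~) refl q
    run-straight (TGT x y ∷ is) at pc≡ (sim refl m~) (e , eq , q) =
      continue _ is at pc≡ (cong (Maybe.map _) (trans (cong (index m) eq) (index-toℕ e))) refl (sim refl m~) refl q
    run-straight (EDGE x y z ∷ is) at pc≡ (sim refl m~) (_ , refl , q) =
      continue _ is at pc≡ refl refl (sim refl m~) refl q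

    exec-jz : ∀ x t κ {v} → Config.reg κ x ≡ v →
      exec (JZ x t) κ ≡ just (config (if v ≡ᵇ 0 then t else suc (pc κ)) (Config.reg κ) (Config.mem κ))
    exec-jz x t κ refl = refl

    outcome-bind : ∀ {p q P Q τ κ} → Outcome p P τ κ →
      (∀ {σ κ′} → P σ → σ ~ κ′ → pc κ′ ≡ p → Outcome q Q (time σ) κ′) → Outcome q Q τ κ
    outcome-bind {τ = τ} {κ} (outcome {steps = t₁} r₁ time₁ pc₁ s₁ h₁) k with k h₁ s₁ pc₁
    ... | outcome {steps = t₂} r₂ time₂ pc₂ s₂ h₂ = outcome
      (λ {κ′} {t} h → subst (λ t → κ ⇓[ t ] κ′) (trans (sym (+-assoc t₁ t₂ t)) (cong (_+ t) (+-comm t₁ t₂))) (r₁ (r₂ h)))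
      (trans time₂ (trans (cong (t₂ +_) time₁) (sym (+-assoc t₂ t₁ τ))))
      pc₂ s₂ h₂

  -- Quantifying over the address makes a specification valid wherever the command is placed. An
  -- `Outcome` contains an actual run, so termination is included.
  record Wp (c : Cmd R K) (Q : State → Set) (σ : State) : Set where
    constructor wp
    field
      run : ∀ {p κ} → CodeAt p (compile p c) → pc κ ≡ p → σ ~ κ → Outcome (p + size c) Q (time σ) κ

  wp-mono : ∀ {c Q Q′ σ} → (∀ {σ′} → Q σ′ → Q′ σ′) → Wp c Q σ → Wp c Q′ σ
  wp-mono f (wp run) = wp λ at pc≡ s~ → case run at pc≡ s~ of
    λ { (outcome r t p s q) → outcome r t p s (f q) }

  wp-block : ∀ {is Q σ} → straight is Q σ → Wp (block is) Q σ
  wp-block {is} q = wp λ at pc≡ s~ → run-straight is at pc≡ s~ q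

  wp-seq : ∀ {c d Q σ} → Wp c (Wp d Q) σ → Wp (c ⨟ d) Q σ
  wp-seq {c} {d} (wp run) = wp λ {p} at pc≡ s~ →
    outcome-bind (run (codeAt-++ˡ (compile p c) at) pc≡ s~) λ { (wp run′) s~′ pc≡′ →
      at-pc (+-assoc p (size c) (size d))
        (run′ (subst (λ k → CodeAt (p + k) (compile (p + size c) d)) (length-compile p c)
                (codeAt-++ʳ (compile p c) at)) pc≡′ s~′) }

  wp-when : ∀ {x c Q σ} → (reg σ x ≡ 0 → Q (tick σ)) → (∀ {k} → reg σ x ≡ suc k → Wp c Q (tick σ)) →
    Wp (when x c) Q σ
  wp-when {x} {c} {Q} {σ} zero-case suc-case = wp go
    where
    go : ∀ {p κ} → CodeAt p (compile p (when x c)) → pc κ ≡ p → σ ~ κ → Outcome (p + suc (size c)) Q (time σ) κ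
    go {p} {κ} at refl (sim refl m~) with reg σ x in eq
    ... | zero = advance at refl (exec-jz x _ _ eq)
      (at-pc (sym (+-suc p (size c))) (done (sim refl m~) (zero-case refl)))
    ... | suc k = advance at refl (exec-jz x _ _ eq)
      (at-pc (sym (+-suc p (size c))) (Wp.run (suc-case refl) (codeAt-tail at) refl (sim refl m~)))

  -- Only one round is unrolled: the premise already contains the proof for the next round.
  -- Termination is left to the caller, who recurses on an edge index, a list or a fuel.
  wp-until : ∀ {x c Q σ} →
    Wp c (λ σ′ → (reg σ′ x ≡ 0 × Wp (until x c) Q (tick σ′)) ⊎ (reg σ′ x ≢ 0 × Q (tick σ′))) σ →
    Wp (until x c) Q σ
  wp-until {x} {c} {Q} {σ} (wp run) = wp go
    where
    go : ∀ {p κ} → CodeAt p (compile p (until x c)) → pc κ ≡ p → σ ~ κ → Outcome (p + (size c + 1)) Q (time σ) κ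
    go {p} {κ} at pc≡ s~ = outcome-bind (run (codeAt-++ˡ (compile p c) at) pc≡ s~) after
      where
      jz-at : CodeAt (p + size c) [ JZ x p ]
      jz-at = subst (λ k → CodeAt (p + k) [ JZ x p ]) (length-compile p c) (codeAt-++ʳ (compile p c) at)
      after : ∀ {σ′ κ′} → (reg σ′ x ≡ 0 × Wp (until x c) Q (tick σ′)) ⊎ (reg σ′ x ≢ 0 × Q (tick σ′)) →
        σ′ ~ κ′ → pc κ′ ≡ p + size c → Outcome (p + (size c + 1)) Q (time σ′) κ′
      after (inj₁ (eq , wp again)) (sim refl m~) pc≡′ = advance jz-at pc≡′
        (exec-jz x _ _ eq)
        (again at refl (sim refl m~))
      after {σ′} (inj₂ (neq , q)) (sim refl m~) pc≡′ with reg σ′ x in eq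
      ... | zero  = ⊥-elim (neq refl)
      ... | suc k = advance jz-at pc≡′
        (exec-jz x _ _ eq)
        (at-pc (trans (cong suc pc≡′) (trans (sym (+-suc p (size c))) (cong (p +_) (+-comm 1 (size c)))))
          (done (sim refl m~) q))

  start : State
  start = state (const 0) (const (const 0)) 0

  wp-halts : ∀ {c Q} → code ≡ compile 0 c → Wp c Q start →
    ∃ λ t → ∃ λ κ → Machine.initial prog G s ⇓[ t ] κ × ∃ λ σ → time σ ≡ t × Q σ
      × (∀ e → toℕ e < s → Machine.output prog G s κ e ≡ just (mem σ out (toℕ e)))
  wp-halts {c} code≡ (wp run) with run ([] , trans code≡ (sym (++-identityʳ _))) refl (sim refl λ _ _ → refl)
  ... | outcome {final} {κ} {steps} r t refl (sim _ m~) q =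
    steps + 0 , κ , r (halt at-end) , _ , t , q , λ e e<s → case index-< e<s of
      λ { (i , eq , eq′) → trans (cong (Maybe.map _) eq) (cong just (trans (m~ out i) (cong (mem final out) eq′))) }
    where
    at-end : fetch κ ≡ nothing
    at-end = subst (λ k → head (drop k code) ≡ nothing)
      (trans (cong length code≡) (length-compile 0 c)) (head-drop-none code)

length-filter-suc : ∀ {n} {P Q : Fin n → Set} (P? : ∀ x → Dec (P x)) (Q? : ∀ x → Dec (Q x)) (v : Fin n) →
  (∀ {w} → P w → Q w ⊎ w ≡ v) → (∀ {w} → Q w → P w) → P v → ¬ Q v →
  length (filter P? (allFin n)) ≡ suc (length (filter Q? (allFin n)))
length-filter-suc {n} P? Q? v P⇒ Q⇒P Pv ¬Qv = length-bijection _≡_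
  {ys = v ∷ filter Q? (allFin n)}
  (filter⁺ P? (allFin⁺ n))
  (All.tabulate (λ w∈ v≡w → ¬Qv (subst _ (sym v≡w) (proj₂ (∈-filter⁻ Q? {xs = allFin n} w∈)))) ∷ filter⁺ Q? (allFin⁺ n))
  to from trans′ (λ p q → trans (sym p) q)
  where
  trans′ : ∀ {x x′ y : Fin n} → x ≡ y → x′ ≡ y → x ≡ x′
  trans′ p q = trans p (sym q)
  to : ∀ {x} → x ∈ˡ filter P? (allFin n) → ∃ λ y → y ∈ˡ (v ∷ filter Q? (allFin n)) × x ≡ y
  to {x} x∈ with P⇒ (proj₂ (∈-filter⁻ P? {xs = allFin n} x∈))
  ... | inj₁ q    = x , there (∈-filter⁺ Q? (∈-allFin x) q) , refl
  ... | inj₂ refl = x , here refl , refl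
  from : ∀ {y} → y ∈ˡ (v ∷ filter Q? (allFin n)) → ∃ λ x → x ∈ˡ filter P? (allFin n) × x ≡ y
  from (here refl) = v , ∈-filter⁺ P? (∈-allFin v) Pv , refl
  from {y} (there y∈) = y , ∈-filter⁺ P? (∈-allFin y) (Q⇒P (proj₂ (∈-filter⁻ Q? {xs = allFin n} y∈))) , refl

-- Triangles

module Triangles (G : Graph) where
  open Graph G

  joins-sym : ∀ {e u v} → Joins e u v → Joins e v u
  joins-sym (inj₁ p) = inj₂ p
  joins-sym (inj₂ p) = inj₁ p

  joins-self : ∀ e → Joins e (src e) (tgt e)
  joins-self e = inj₁ (refl , refl)

  joins-same : ∀ {e u v x y} → Joins e u v → Joins e x y → (u ≡ x × v ≡ y) ⊎ (u ≡ y × v ≡ x)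
  joins-same (inj₁ (refl , refl)) (inj₁ (p , q)) = inj₁ (p , q)
  joins-same (inj₁ (refl , refl)) (inj₂ (p , q)) = inj₂ (p , q)
  joins-same (inj₂ (refl , refl)) (inj₁ (p , q)) = inj₂ (q , p)
  joins-same (inj₂ (refl , refl)) (inj₂ (p , q)) = inj₁ (q , p)

  joins-≢ : ∀ {e u v} → Joins e u v → u ≢ v
  joins-≢ {e} (inj₁ (p , q)) u≡v = loopless e (trans p (trans u≡v (sym q)))
  joins-≢ {e} (inj₂ (p , q)) u≡v = loopless e (trans p (trans (sym u≡v) (sym q)))

  joins-other : ∀ {e u v w} → Joins e u v → Joins e u w → v ≡ w
  joins-other p q with joins-same p q
  ... | inj₁ (_ , v≡w) = v≡w
  ... | inj₂ (u≡w , v≡u) = trans v≡u u≡w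

  joins-incident : ∀ {e u v} → Joins e u v → Incident u e
  joins-incident (inj₁ (p , _)) = inj₁ p
  joins-incident (inj₂ (_ , q)) = inj₂ q

  incident-joins : ∀ {e u} → Incident u e → ∃ λ v → Joins e u v
  incident-joins {e} (inj₁ p) = tgt e , inj₁ (p , refl)
  incident-joins {e} (inj₂ q) = src e , inj₂ (refl , q)

  adj-sym : ∀ {L u v} → Adj G L u v → Adj G L v u
  adj-sym (e , e∈ , p) = e , e∈ , joins-sym p

  adj-mono : ∀ {L L′ u v} → L ⊆ L′ → Adj G L u v → Adj G L′ u v
  adj-mono L⊆ (e , e∈ , p) = e , L⊆ e∈ , p

  Tri : Subset m → Fin m → Fin n → Set
  Tri L e w = Adj G L (src e) w × Adj G L (tgt e) w

  tri? : ∀ L e w → Dec (Tri L e w)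
  tri? L e w = adj? G L (src e) w ×-dec adj? G L (tgt e) w

  tri-mono : ∀ {L L′ e w} → L ⊆ L′ → Tri L e w → Tri L′ e w
  tri-mono L⊆ (p , q) = adj-mono L⊆ p , adj-mono L⊆ q

  tri-joins : ∀ {L e u v w} → Joins e u v → Tri L e w → Adj G L u w × Adj G L v w
  tri-joins (inj₁ (refl , refl)) (p , q) = p , q
  tri-joins (inj₂ (refl , refl)) (p , q) = q , p

  joins-tri : ∀ {L e u v w} → Joins e u v → Adj G L u w → Adj G L v w → Tri L e w
  joins-tri (inj₁ (refl , refl)) p q = p , q
  joins-tri (inj₂ (refl , refl)) p q = q , p

  triangles-mono′ : ∀ {L L′ e} → (∀ {w} → Tri L e w → Tri L′ e w) → triangles G L e ≤ triangles G L′ e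
  triangles-mono′ {L} {L′} {e} f = length-injection _≡_ (filter⁺ (tri? L e) (allFin⁺ n))
    (λ {w} w∈ → w , ∈-filter⁺ (tri? L′ e) (∈-allFin w) (f (proj₂ (∈-filter⁻ (tri? L e) {xs = allFin n} w∈))) , refl)
    (λ p q → trans p (sym q))

  triangles-mono : ∀ {L L′ e} → L ⊆ L′ → triangles G L e ≤ triangles G L′ e
  triangles-mono {L} {L′} {e} L⊆ = triangles-mono′ {L} {L′} {e} (tri-mono {L} {L′} {e} L⊆)

  incidents : Fin n → List (Fin m)
  incidents u = filter (incident? u) (allFin m)

  incidents-unique : ∀ u → Unique (incidents u)
  incidents-unique u = filter⁺ (incident? u) (allFin⁺ m)

  ∈-incidents⁺ : ∀ {u e} → Incident u e → e ∈ˡ incidents u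
  ∈-incidents⁺ {u} {e} = ∈-filter⁺ (incident? u) (∈-allFin e)

  ∈-incidents⁻ : ∀ {u e} → e ∈ˡ incidents u → Incident u e
  ∈-incidents⁻ {u} e∈ = proj₂ (∈-filter⁻ (incident? u) {xs = allFin m} e∈)

  Closes : Fin n → Fin n → Fin m → Set
  Closes u v f = ∃ λ w → Joins f u w × Adj G ⊤ v w

  closes? : ∀ u v f → Dec (Closes u v f)
  closes? u v f = any? (λ w → joins? f u w ×-dec adj? G ⊤ v w)

  -- An edge at `u` and its far end determine each other, by `simple` and `joins-other`. So a walk
  -- over the edges at either end of `e` counts the triangles, and neither degree is exceeded.
  triangles-closes : ∀ {e u v} → Joins e u v →
    triangles G ⊤ e ≡ length (filter (closes? u v) (incidents u))
  triangles-closes {e} {u} {v} e-uv = sym (length-bijection (λ f w → Joins f u w)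
    (filter⁺ (closes? u v) (incidents-unique u)) (filter⁺ (tri? ⊤ e) (allFin⁺ n))
    to from simple joins-other)
    where
    to : ∀ {f} → f ∈ˡ filter (closes? u v) (incidents u) → ∃ λ w → w ∈ˡ filter (tri? ⊤ e) (allFin n) × Joins f u w
    to {f} f∈ with proj₂ (∈-filter⁻ (closes? u v) {xs = incidents u} f∈)
    ... | w , f-uw , vw = w , ∈-filter⁺ (tri? ⊤ e) (∈-allFin w) (joins-tri e-uv (f , ∈⊤ , f-uw) vw) , f-uw
    from : ∀ {w} → w ∈ˡ filter (tri? ⊤ e) (allFin n) → ∃ λ f → f ∈ˡ filter (closes? u v) (incidents u) × Joins f u w
    from {w} w∈ with tri-joins {⊤} e-uv (proj₂ (∈-filter⁻ (tri? ⊤ e) {xs = allFin n} w∈))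
    ... | (f , _ , f-uw) , vw = f , ∈-filter⁺ (closes? u v) (∈-incidents⁺ (joins-incident f-uw)) (w , f-uw , vw) , f-uw

  -- The edges x other than e = uv in a triangle with e in A whose edge at u is in l.
  Pending : Subset m → Fin n → Fin n → List (Fin m) → Fin m → Set
  Pending A u v l x = ∃ λ f → f ∈ˡ l × ∃ λ g → ∃ λ w →
    Joins f u w × Joins g v w × f ∈ A × g ∈ A × (x ≡ f ⊎ x ≡ g)

  pending? : ∀ A u v l x → Dec (Pending A u v l x)
  pending? A u v l x = any? λ f → decMember _≟ᶠ_ f l ×-dec any? λ g → any? λ w →
    joins? f u w ×-dec joins? g v w ×-dec (f ∈? A) ×-dec (g ∈? A) ×-dec ((x ≟ᶠ f) ⊎-dec (x ≟ᶠ g))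

  module _ {A A′ : Subset m} {e u v} (e-uv : Joins e u v) (e∈A : e ∈ A)
           (A′⊆A : ∀ {x} → x ∈ A′ → x ∈ A × x ≢ e) (A⊆A′ : ∀ {x} → x ∈ A → x ≢ e → x ∈ A′) where

    -- A triangle of `f` that uses `e` must have apex `b`, so no other apex is lost. That `g`
    -- remains shows that this triangle was there before the removal.
    triangles-lose : ∀ {a b f g w} → Joins e a b → f ∈ A′ → g ∈ A′ → Joins f a w → Joins g b w →
      triangles G A f ≡ suc (triangles G A′ f)
    triangles-lose {a} {b} {f} {g} {w} e-ab f∈ g∈ f-aw g-bw =
      length-filter-suc (tri? A f) (tri? A′ f) b split (tri-mono {A′} {A} {f} (proj₁ ∘ A′⊆A))
        (joins-tri f-aw (e , e∈A , e-ab) (g , proj₁ (A′⊆A g∈) , joins-sym g-bw)) absent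
      where
      split : ∀ {z} → Tri A f z → Tri A′ f z ⊎ z ≡ b
      split {z} t with z ≟ᶠ b | tri-joins {A} f-aw t
      ... | yes z≡b | _ = inj₂ z≡b
      ... | no  z≢b | (h , h∈ , h-az) , (h′ , h′∈ , h′-wz) = inj₁
        (joins-tri f-aw (h , A⊆A′ h∈ (λ { refl → z≢b (joins-other h-az e-ab) }) , h-az)
                        (h′ , A⊆A′ h′∈ h′≢e , h′-wz))
        where
        h′≢e : h′ ≢ e
        h′≢e refl with joins-same h′-wz e-ab
        ... | inj₁ (w≡a , _) = joins-≢ f-aw (sym w≡a)
        ... | inj₂ (w≡b , _) = joins-≢ g-bw (sym w≡b)
      absent : ¬ Tri A′ f b
      absent t with tri-joins {A′} f-aw t
      ... | (h , h∈ , h-ab) , _ = proj₂ (A′⊆A h∈) (simple h-ab e-ab)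

    triangles-pending : ∀ {x} → Pending A′ u v (incidents u) x → triangles G A x ≡ suc (triangles G A′ x)
    triangles-pending (f , _ , g , w , f-uw , g-vw , f∈ , g∈ , inj₁ refl) = triangles-lose e-uv f∈ g∈ f-uw g-vw
    triangles-pending (f , _ , g , w , f-uw , g-vw , f∈ , g∈ , inj₂ refl) =
      triangles-lose (joins-sym e-uv) g∈ f∈ g-vw f-uw

    -- A triangle of `x` that breaks contains `e`, and its third edge is still there. So `x` would
    -- be pending, as the edge at `u` or as the edge at `v`; these are the two cases of `lost`.
    triangles-keep : ∀ {x} → x ∈ A′ → ¬ Pending A′ u v (incidents u) x → triangles G A x ≡ triangles G A′ x
    triangles-keep {x} x∈ ¬pend = ≤-antisym (triangles-mono′ {A} {A′} {x} survives)
                                            (triangles-mono {A′} {A} {x} (proj₁ ∘ A′⊆A))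
      where
      lost : ∀ {a b w h} → Joins x a b → Joins e a w → h ∈ A → Joins h b w → ⊥
      lost {a} {b} {w} {h} x-ab e-aw h∈ h-bw with h∈′
        where
        h∈′ : h ∈ A′
        h∈′ = A⊆A′ h∈ λ { refl → joins-≢ x-ab (joins-other (joins-sym e-aw) (joins-sym h-bw)) }
      ... | h∈′ with joins-same e-uv e-aw
      ... | inj₁ (refl , refl) = ¬pend (x , ∈-incidents⁺ (joins-incident x-ab) , h , b , x-ab , joins-sym h-bw , x∈ , h∈′ , inj₁ refl)
      ... | inj₂ (refl , refl) = ¬pend (h , ∈-incidents⁺ (joins-incident (joins-sym h-bw)) , x , b , joins-sym h-bw , x-ab , h∈′ , x∈ , inj₂ refl)
      survives : ∀ {w} → Tri A x w → Tri A′ x w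
      survives ((h , h∈ , h-w) , (h′ , h′∈ , h′-w)) =
        (h , A⊆A′ h∈ (λ { refl → lost (joins-self x) h-w h′∈ h′-w }) , h-w) ,
        (h′ , A⊆A′ h′∈ (λ { refl → lost (joins-sym (joins-self x)) h′-w h∈ h-w }) , h′-w)

-- Truss components

module Components (G : Graph) where
  open Graph G
  open Triangles G

  -- Connectivity is left out: peeling deals with arbitrary trusses, and `trussness` passes to
  -- components at the end.
  InTruss : ℕ → Fin m → Set
  InTruss k e = ∃ λ L → IsTruss G k L × e ∈ L

  TrussBound : Fin m → ℕ → Set
  TrussBound e b = ∀ {k L} → IsTruss G k L → e ∈ L → k ≤ b

  module _ (X : Subset m) (r : Fin n) where

    private
      Touches : Subset m → Fin m → Set
      Touches C f = ∃ λ v → Incident v f × ∃ λ g → g ∈ C × Incident v g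

      touches? : ∀ C f → Dec (Touches C f)
      touches? C f = any? λ v → incident? v f ×-dec any? λ g → (g ∈? C) ×-dec incident? v g

      Rooted : Subset m → Set
      Rooted C = ∀ {v} → VertexOf G C v → Star (Adj G C) r v

      add : Subset m → Fin m → Subset m
      add C f = subset (λ x → (x ∈? C) ⊎-dec (x ≟ᶠ f))

      star-mono : ∀ {C D u v} → C ⊆ D → Star (Adj G C) u v → Star (Adj G D) u v
      star-mono C⊆ ε        = ε
      star-mono C⊆ (a ◅ as) = adj-mono C⊆ a ◅ star-mono C⊆ as

      module _ {C : Subset m} {f : Fin m} where

        ∈-add⁺ˡ : C ⊆ add C f
        ∈-add⁺ˡ x∈ = ∈-subset⁺ (λ x → (x ∈? C) ⊎-dec (x ≟ᶠ f)) (inj₁ x∈)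

        ∈-add⁺ʳ : f ∈ add C f
        ∈-add⁺ʳ = ∈-subset⁺ (λ x → (x ∈? C) ⊎-dec (x ≟ᶠ f)) (inj₂ refl)

        ∈-add⁻ : ∀ {x} → x ∈ add C f → x ∈ C ⊎ x ≡ f
        ∈-add⁻ = ∈-subset⁻ (λ x → (x ∈? C) ⊎-dec (x ≟ᶠ f))

        add-rooted : Rooted C → Touches C f → Rooted (add C f)
        add-rooted rooted (v , v∈f , g , g∈C , v∈g) {w} (x , x∈ , w∈x) with ∈-add⁻ x∈
        ... | inj₁ x∈C = star-mono ∈-add⁺ˡ (rooted (x , x∈C , w∈x))
        ... | inj₂ refl with incident-joins v∈f | incident-joins w∈x
        ...   | v′ , f-vv′ | w′ , f-ww′ with joins-same f-vv′ f-ww′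
        ...     | inj₁ (refl , _) = star-mono ∈-add⁺ˡ (rooted (g , g∈C , v∈g))
        ...     | inj₂ (_ , refl) = star-mono ∈-add⁺ˡ (rooted (g , g∈C , v∈g)) ◅◅ ((x , ∈-add⁺ʳ , f-vv′) ◅ ε)

    record Component (C₀ : Subset m) : Set where
      field
        edges     : Subset m
        ⊆X        : edges ⊆ X
        rooted    : Rooted edges
        closed    : ∀ {f} → f ∈ X → Touches edges f → f ∈ edges
        extends   : C₀ ⊆ edges

    private
      -- Every added edge leaves the complement of `C`, whose cardinality therefore bounds the
      -- number of rounds.
      grow : ∀ fuel C → ∣ ∁ C ∣ < fuel → C ⊆ X → Rooted C → Component C
      grow (suc fuel) C (s≤s bound) C⊆X rooted
        with any? (λ f → (f ∈? X) ×-dec ¬? (f ∈? C) ×-dec touches? C f)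
      ... | no none = record
        { edges = C ; ⊆X = C⊆X ; rooted = rooted ; extends = id
        ; closed = λ {f} f∈X touch → case f ∈? C of λ
            { (yes f∈C) → f∈C ; (no f∉C) → ⊥-elim (none (f , f∈X , f∉C , touch)) } }
      ... | yes (f , f∈X , f∉C , touch) = record
        { edges = edges ; ⊆X = ⊆X ; rooted = rooted′ ; closed = closed ; extends = extends ∘ ∈-add⁺ˡ }
        where
        larger : Component (add C f)
        larger = grow fuel (add C f)
          (≤-trans (p⊂q⇒∣p∣<∣q∣ (p⊂q⇒∁p⊃∁q (∈-add⁺ˡ , f , ∈-add⁺ʳ , f∉C))) bound)
          (λ x∈ → case ∈-add⁻ x∈ of λ { (inj₁ x∈C) → C⊆X x∈C ; (inj₂ refl) → f∈X })
          (add-rooted rooted touch)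
        open Component larger renaming (rooted to rooted′)

    component : ∀ C → C ⊆ X → (∀ {v} → VertexOf G C v → Star (Adj G C) r v) → Component C
    component C = grow (suc ∣ ∁ C ∣) C ≤-refl

  star-sym : ∀ {C u v} → Star (Adj G C) u v → Star (Adj G C) v u
  star-sym ε        = ε
  star-sym (a ◅ as) = star-sym as ◅◅ (adj-sym a ◅ ε)

  -- The component is the set of edges reachable from e within the edges f with τ f ≥ τ e.
  trussness : (τ : Fin m → ℕ) → (∀ e → InTruss (τ e) e) → (∀ e → TrussBound e (τ e)) →
    ∀ e → IsTrussness G e (τ e)
  trussness τ low up e = (edges , ((connected , truss) , maximal) , e∈) , λ { k (L , ((_ , t) , _) , e∈L) → up e t e∈L }
    where
    k : ℕ
    k = τ e
    inX? : ∀ f → Dec (k ≤ τ f)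
    inX? f = k ≤? τ f
    X : Subset m
    X = subset inX?
    one : Subset m
    one = subset (_≟ᶠ e)
    e∈one : e ∈ one
    e∈one = ∈-subset⁺ (_≟ᶠ e) refl
    one-rooted : ∀ {v} → VertexOf G one v → Star (Adj G one) (src e) v
    one-rooted (x , x∈ , inc) with ∈-subset⁻ (_≟ᶠ e) x∈
    one-rooted (x , x∈ , inj₁ refl) | refl = ε
    one-rooted (x , x∈ , inj₂ refl) | refl = (e , x∈ , joins-self e) ◅ ε
    reachable : Component X (src e) one
    reachable = component X (src e) one
      (λ x∈ → ∈-subset⁺ inX? (subst (λ y → k ≤ τ y) (sym (∈-subset⁻ (_≟ᶠ e) x∈)) ≤-refl)) one-rooted
    open Component reachable
    e∈ : e ∈ edges
    e∈ = extends e∈one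
    connected : Connected G edges
    connected u∈ v∈ = star-sym (rooted u∈) ◅◅ rooted v∈
    truss-⊆X : ∀ {k′ L} → IsTruss G k′ L → k ≤ k′ → L ⊆ X
    truss-⊆X t k≤k′ f∈L = ∈-subset⁺ inX? (≤-trans k≤k′ (up _ t f∈L))
    truss : IsTruss G k edges
    -- The truss `L` of order `τ f` around `f` lies in `X` because `k ≤ τ f`. Its triangles at `f`
    -- touch `f`, so closure puts their edges into the component.
    truss f f∈ with low f
    ... | L , t , f∈L = ≤-trans k≤τf (≤-trans (t f f∈L) (triangles-mono′ {L} {edges} {f} λ
        { ((h , h∈ , h-w) , (h′ , h′∈ , h′-w)) →
          (h , closed (L⊆X h∈) (src f , joins-incident h-w , f , f∈ , inj₁ refl) , h-w) ,
          (h′ , closed (L⊆X h′∈) (tgt f , joins-incident h′-w , f , f∈ , inj₂ refl) , h′-w) }))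
      where
      k≤τf : k ≤ τ f
      k≤τf = ∈-subset⁻ inX? (⊆X f∈)
      L⊆X : L ⊆ X
      L⊆X = truss-⊆X t k≤τf
    maximal : ∀ L′ → IsConnectedTruss G k L′ → edges ⊆ L′ → L′ ⊆ edges
    maximal L′ (conn , t) ⊆L′ {f} f∈ = walk (e , e∈ , inj₁ refl) (conn (e , ⊆L′ e∈ , inj₁ refl) (f , f∈ , inj₁ refl))
      where
      L′⊆X : L′ ⊆ X
      L′⊆X = truss-⊆X t ≤-refl
      -- A path in the larger truss stays in `X`, and each of its edges touches the part of the
      -- component reached so far.
      walk : ∀ {u} → VertexOf G edges u → Star (Adj G L′) u (src f) → f ∈ edges
      walk (g , g∈ , u∈g) ε = closed (L′⊆X f∈) (src f , inj₁ refl , g , g∈ , u∈g)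
      walk (g , g∈ , u∈g) ((h , h∈ , h-uw) ◅ path) =
        walk (h , closed (L′⊆X h∈) (_ , joins-incident h-uw , g , g∈ , u∈g) , joins-incident (joins-sym h-uw)) path

-- Peeling

module Peeling (G : Graph) where
  open Graph G
  open Triangles G
  open Components G

  minDeg : Fin m → ℕ
  minDeg e = deg (src e) ⊓ deg (tgt e)

  None : Fin m → Set
  None _ = ⊥

  -- A is the set of edges not yet removed.
  record LevelStart (k : ℕ) (A : Subset m) (supp : Fin m → ℕ) : Set where
    field
      done-truss : ∀ e → supp e < k → InTruss (supp e) e
      done-bound : ∀ e → supp e < k → TrussBound e (supp e)
      alive⁺     : ∀ {e} → k ≤ supp e → e ∈ A
      alive⁻     : ∀ {e} → e ∈ A → k ≤ supp e
      exact      : ∀ e → k ≤ supp e → supp e ≡ triangles G A e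
      supp≤deg   : ∀ e → supp e ≤ minDeg e

  -- Edges with supp ≤ k are removed or wait to be removed; for the others, supp
  -- still counts one destroyed triangle at each edge satisfying Pd.
  record Level (k : ℕ) (A : Subset m) (Pd : Fin m → Set) (supp : Fin m → ℕ) : Set where
    field
      low      : ∀ e → InTruss (supp e ⊓ k) e
      up       : ∀ e → supp e ≤ k → TrussBound e (supp e)
      dead     : ∀ {e} → e ∉ A → supp e ≤ k
      exact    : ∀ e → k < supp e →
        (Pd e × supp e ≡ suc (triangles G A e)) ⊎ (¬ Pd e × supp e ≡ triangles G A e)
      supp≤deg : ∀ e → supp e ≤ minDeg e

  -- A truss of order above `k` avoids every edge bounded by `k`, so it lies in `A`, where `e` has
  -- at most `k` triangles.
  truss-bound : ∀ {k A e} → (∀ {f} → f ∉ A → TrussBound f k) → triangles G A e ≤ k → TrussBound e k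
  truss-bound {k} {A} {e} bound le {k′} {L} t e∈L with k′ ≤? k
  ... | yes k′≤k = k′≤k
  ... | no  k′≰k = ≤-trans (t e e∈L) (≤-trans (triangles-mono {L} {A} {e} L⊆A) le)
    where
    L⊆A : L ⊆ A
    L⊆A {f} f∈L with f ∈? A
    ... | yes f∈A = f∈A
    ... | no  f∉A = ⊥-elim (k′≰k (bound f∉A t f∈L))

  -- With all remaining counts exact and at least `k`, the set `A` is itself a truss of order `k`,
  -- which gives `low`. A count equal to `k` is final by `truss-bound`, because the removed edges
  -- are bounded below `k`.
  start⇒level : ∀ {k A supp} → LevelStart k A supp → Level k A None supp
  start⇒level {k} {A} {supp} S = record
    { low = low ; up = up ; exact = λ e k<s → inj₂ (id , exact e (<⇒≤ k<s)) ; supp≤deg = supp≤deg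
    ; dead = λ {e} e∉A → case k ≤? supp e of λ
        { (yes k≤s) → ⊥-elim (e∉A (alive⁺ k≤s)) ; (no k≰s) → <⇒≤ (≰⇒> k≰s) } }
    where
    open LevelStart S
    low : ∀ e → InTruss (supp e ⊓ k) e
    low e with k ≤? supp e
    ... | yes k≤s = A , (λ f f∈A → subst (_≤ triangles G A f) (sym (m≥n⇒m⊓n≡n k≤s))
                            (subst (k ≤_) (exact f (alive⁻ f∈A)) (alive⁻ f∈A))) , alive⁺ k≤s
    ... | no  k≰s = subst (λ j → InTruss j e) (sym (m≤n⇒m⊓n≡m (<⇒≤ (≰⇒> k≰s)))) (done-truss e (≰⇒> k≰s))
    up : ∀ e → supp e ≤ k → TrussBound e (supp e)
    up e s≤k with k ≤? supp e
    ... | no  k≰s = done-bound e (≰⇒> k≰s)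
    ... | yes k≤s = truss-bound {A = A}
      (λ {f} f∉A t f∈L → ≤-trans (done-bound f (dead′ f∉A) t f∈L) (≤-trans (<⇒≤ (dead′ f∉A)) k≤s))
      (≤-reflexive (sym (exact e k≤s)))
      where
      dead′ : ∀ {f} → f ∉ A → supp f < k
      dead′ {f} f∉A with k ≤? supp f
      ... | yes k≤f = ⊥-elim (f∉A (alive⁺ k≤f))
      ... | no  k≰f = ≰⇒> k≰f

  level⇒start : ∀ {k A supp} → Level k A None supp → (∀ {e} → e ∈ A → k < supp e) → LevelStart (suc k) A supp
  level⇒start {k} {A} {supp} L alive = record
    { done-truss = λ e s<k → subst (λ j → InTruss j e) (m≤n⇒m⊓n≡m (≤-pred s<k)) (low e)
    ; done-bound = λ e s<k → up e (≤-pred s<k)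
    ; alive⁺ = λ {e} k<s → case e ∈? A of λ { (yes e∈A) → e∈A ; (no e∉A) → ⊥-elim (<⇒≱ k<s (dead e∉A)) }
    ; alive⁻ = alive
    ; exact = λ e k<s → case exact e k<s of λ { (inj₁ (() , _)) ; (inj₂ (_ , eq)) → eq }
    ; supp≤deg = supp≤deg }
    where open Level L

  level-cong : ∀ {k A Pd Pd′ supp} → (∀ {x} → Pd x → Pd′ x) → (∀ {x} → Pd′ x → Pd x) →
    Level k A Pd supp → Level k A Pd′ supp
  level-cong f g L = record { Level L ; exact = λ e k<s → case Level.exact L e k<s of
    λ { (inj₁ (p , eq)) → inj₁ (f p , eq) ; (inj₂ (¬p , eq)) → inj₂ (¬p ∘ g , eq) } }

  module _ {k : ℕ} {A A′ : Subset m} {e : Fin m} {u v : Fin n} {supp : Fin m → ℕ} (e-uv : Joins e u v) (e∈A : e ∈ A)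
           (A′⊆A : ∀ {x} → x ∈ A′ → x ∈ A × x ≢ e) (A⊆A′ : ∀ {x} → x ∈ A → x ≢ e → x ∈ A′) where

    -- Only the set shrinks, no count changes. What the counts above `k` now have in excess is one
    -- triangle at every pending edge, to be taken off during the walk.
    level-remove : supp e ≤ k → Level k A None supp → Level k A′ (Pending A′ u v (incidents u)) supp
    level-remove s≤k L = record
      { Level L
      ; dead = λ {x} x∉A′ → case x ≟ᶠ e of λ
          { (yes refl) → s≤k ; (no x≢e) → Level.dead L λ x∈A → x∉A′ (A⊆A′ x∈A x≢e) }
      ; exact = exact′ }
      where
      exact′ : ∀ x → k < supp x →
        (Pending A′ u v (incidents u) x × supp x ≡ suc (triangles G A′ x))
        ⊎ (¬ Pending A′ u v (incidents u) x × supp x ≡ triangles G A′ x)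
      exact′ x k<s with Level.exact L x k<s
      ... | inj₂ (_ , eq) with pending? A′ u v (incidents u) x
      ...   | yes pend = inj₁ (pend , trans eq (triangles-pending e-uv e∈A A′⊆A A⊆A′ pend))
      ...   | no ¬pend = inj₂ (¬pend , trans eq (triangles-keep e-uv e∈A A′⊆A A⊆A′ x∈A′ ¬pend))
        where
        x∈A′ : x ∈ A′
        x∈A′ with x ∈? A
        ... | yes x∈A = A⊆A′ x∈A λ { refl → <⇒≱ k<s s≤k }
        ... | no  x∉A = ⊥-elim (<⇒≱ k<s (Level.dead L x∉A))

  -- Exactness is claimed above `k` only, so an edge at or below `k` leaves the pending set without
  -- a decrement. This is what freezes a count at its final value.
  level-skip : ∀ {k A Pd supp f} → supp f ≤ k → Level k A Pd supp → Level k A (λ x → Pd x × x ≢ f) supp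
  level-skip {f = f} s≤k L = record { Level L ; exact = λ e k<s → case Level.exact L e k<s of λ
    { (inj₁ (p , eq)) → inj₁ ((p , λ { refl → <⇒≱ k<s s≤k }) , eq)
    ; (inj₂ (¬p , eq)) → inj₂ (¬p ∘ proj₁ , eq) } }

  -- The count stays at least `k`, so its minimum with `k`, and thereby `low`, does not change. If
  -- it reaches `k`, it is exact in `A` while removed edges are bounded by `k`, and `truss-bound`
  -- makes it final.
  level-decrement : ∀ {k A Pd supp supp′ f} → Level k A Pd supp → Pd f → k < supp f →
    supp f ≡ suc (supp′ f) → (∀ x → x ≢ f → supp′ x ≡ supp x) →
    Level k A (λ x → Pd x × x ≢ f) supp′
  level-decrement {k} {A} {Pd} {supp} {supp′} {f} L pd k<s dec same = record
    { low = low′ ; up = up′ ; dead = λ {x} x∉A → ≤-trans (supp′≤ x) (dead x∉A)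
    ; exact = exact′ ; supp≤deg = λ x → ≤-trans (supp′≤ x) (supp≤deg x) }
    where
    open Level L
    supp′≤ : ∀ x → supp′ x ≤ supp x
    supp′≤ x with x ≟ᶠ f
    ... | yes refl = subst (supp′ x ≤_) (sym dec) (n≤1+n _)
    ... | no  x≢f  = ≤-reflexive (same x x≢f)
    k≤s′ : k ≤ supp′ f
    k≤s′ = ≤-pred (subst (k <_) dec k<s)
    supp′f≡ : supp′ f ≡ triangles G A f
    supp′f≡ with exact f k<s
    ... | inj₁ (_ , eq)  = suc-injective (trans (sym dec) eq)
    ... | inj₂ (¬p , _) = ⊥-elim (¬p pd)
    low′ : ∀ x → InTruss (supp′ x ⊓ k) x
    low′ x with x ≟ᶠ f
    ... | yes refl = subst (λ j → InTruss j x) (trans (m≥n⇒m⊓n≡n (<⇒≤ k<s)) (sym (m≥n⇒m⊓n≡n k≤s′))) (low x)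
    ... | no  x≢f  = subst (λ j → InTruss (j ⊓ k) x) (sym (same x x≢f)) (low x)
    up′ : ∀ x → supp′ x ≤ k → TrussBound x (supp′ x)
    up′ x s≤k with x ≟ᶠ f
    ... | no x≢f = subst (TrussBound x) (sym (same x x≢f)) (up x (subst (_≤ k) (same x x≢f) s≤k))
    ... | yes refl = truss-bound {A = A}
      (λ {y} y∉A t y∈L → ≤-trans (up y (dead y∉A) t y∈L) (≤-trans (dead y∉A) k≤s′))
      (≤-reflexive (sym supp′f≡))
    exact′ : ∀ x → k < supp′ x →
      ((Pd x × x ≢ f) × supp′ x ≡ suc (triangles G A x)) ⊎ (¬ (Pd x × x ≢ f) × supp′ x ≡ triangles G A x)
    exact′ x k<s′ with x ≟ᶠ f
    ... | yes refl = inj₂ ((λ p → proj₂ p refl) , supp′f≡)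
    ... | no  x≢f with exact x (subst (k <_) (same x x≢f) k<s′)
    ...   | inj₁ (p , eq)  = inj₁ ((p , x≢f) , trans (same x x≢f) eq)
    ...   | inj₂ (¬p , eq) = inj₂ (¬p ∘ proj₁ , trans (same x x≢f) eq)

  start-trussness : ∀ {k A supp} → LevelStart k A supp → (∀ e → supp e < k) → ∀ e → IsTrussness G e (supp e)
  start-trussness S all-done = trussness _ (λ e → done-truss e (all-done e)) (λ e → done-bound e (all-done e))
    where open LevelStart S

  record Stack (k : ℕ) (A : Subset m) (supp : Fin m → ℕ) (l : List (Fin m)) : Set where
    field
      unique   : Unique l
      sound    : ∀ {e} → e ∈ˡ l → supp e ≤ k × e ∈ A
      complete : ∀ {e} → supp e ≤ k → e ∈ A → e ∈ˡ l

  stack-pop : ∀ {k A A′ supp e l} → (∀ {x} → x ∈ A′ → x ∈ A × x ≢ e) → (∀ {x} → x ∈ A → x ≢ e → x ∈ A′) →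
    Stack k A supp (e ∷ l) → Stack k A′ supp l
  stack-pop {e = e} {l} A′⊆A A⊆A′ S with Stack.unique S
  ... | e∉ ∷ u = record
    { unique = u
    ; sound = λ x∈ → proj₁ (sound (there x∈)) , A⊆A′ (proj₂ (sound (there x∈))) (λ x≡e → All.lookup e∉ x∈ (sym x≡e))
    ; complete = λ s≤k x∈A′ → case complete s≤k (proj₁ (A′⊆A x∈A′)) of λ
        { (here x≡e) → ⊥-elim (proj₂ (A′⊆A x∈A′) x≡e) ; (there x∈) → x∈ } }
    where open Stack S

  module _ {k : ℕ} {A : Subset m} {supp supp′ : Fin m → ℕ} {f : Fin m} {l : List (Fin m)} (same : ∀ x → x ≢ f → supp′ x ≡ supp x) (k<s : k < supp f) (S : Stack k A supp l) where
    open Stack S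

    ∉-stack : f ∉ˡ l
    ∉-stack f∈ = <⇒≱ k<s (proj₁ (sound f∈))

    private
      ∈⇒≢ : ∀ {x} → x ∈ˡ l → x ≢ f
      ∈⇒≢ x∈ refl = ∉-stack x∈
      sound′ : ∀ {x} → x ∈ˡ l → supp′ x ≤ k × x ∈ A
      sound′ {x} x∈ = subst (_≤ k) (sym (same x (∈⇒≢ x∈))) (proj₁ (sound x∈)) , proj₂ (sound x∈)

    stack-stay : k < supp′ f → Stack k A supp′ l
    stack-stay k<s′ = record { unique = unique ; sound = sound′ ; complete = λ {x} s≤k x∈A →
      case x ≟ᶠ f of λ { (yes refl) → ⊥-elim (<⇒≱ k<s′ s≤k)
                       ; (no x≢f) → complete (subst (_≤ k) (same x x≢f) s≤k) x∈A } }

    stack-push : supp′ f ≤ k → f ∈ A → Stack k A supp′ (f ∷ l)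
    stack-push s≤k f∈A = record
      { unique = All.tabulate (λ x∈ f≡x → ∈⇒≢ x∈ (sym f≡x)) ∷ unique
      ; sound = λ { (here refl) → s≤k , f∈A ; (there x∈) → sound′ x∈ }
      ; complete = λ {x} s≤k x∈A → case x ≟ᶠ f of λ
          { (yes refl) → here refl ; (no x≢f) → there (complete (subst (_≤ k) (same x x≢f) s≤k) x∈A) } }

  -- A removed edge is not unlinked from the live list at once; the next scan drops it, recognised
  -- by a count below the new level. Hence `cover` speaks of counts at least `k` only.
  record Scan (k : ℕ) (supp : Fin m → ℕ) (todo kept stk : List (Fin m)) : Set where
    field
      todo-unique : Unique todo
      kept-unique : Unique kept
      stk-unique  : Unique stk
      fresh       : ∀ {e} → e ∈ˡ todo → e ∉ˡ kept × e ∉ˡ stk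
      cover       : ∀ {e} → k ≤ supp e → e ∈ˡ todo ⊎ e ∈ˡ kept ⊎ e ∈ˡ stk
      kept>       : ∀ {e} → e ∈ˡ kept → k < supp e
      stk≡        : ∀ {e} → e ∈ˡ stk → supp e ≡ k

  module _ {k supp f todo kept stk} (S : Scan k supp (f ∷ todo) kept stk) where
    open Scan S

    private
      f∉todo : f ∉ˡ todo
      f∉todo = Unique[x∷xs]⇒x∉xs todo-unique
      unique′ : ∀ {A : Set} {x : A} {xs} → Unique (x ∷ xs) → Unique xs
      unique′ (_ ∷ u) = u
      ∉⇒unique : ∀ {A : Set} {x : A} {xs} → x ∉ˡ xs → Unique xs → Unique (x ∷ xs)
      ∉⇒unique x∉ u = All.tabulate (λ y∈ x≡y → x∉ (subst (_∈ˡ _) (sym x≡y) y∈)) ∷ u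
      ∉-cons : ∀ {e l} → e ∈ˡ todo → e ∉ˡ l → e ∉ˡ (f ∷ l)
      ∉-cons e∈ e∉ (here refl) = f∉todo e∈
      ∉-cons e∈ e∉ (there e∈l) = e∉ e∈l

    scan-keep : k < supp f → Scan k supp todo (f ∷ kept) stk
    scan-keep k<s = record
      { todo-unique = unique′ todo-unique
      ; kept-unique = ∉⇒unique (proj₁ (fresh (here refl))) kept-unique
      ; stk-unique = stk-unique
      ; fresh = λ e∈ → ∉-cons e∈ (proj₁ (fresh (there e∈))) , proj₂ (fresh (there e∈))
      ; cover = λ k≤s → case cover k≤s of λ
          { (inj₁ (here refl)) → inj₂ (inj₁ (here refl)) ; (inj₁ (there e∈)) → inj₁ e∈
          ; (inj₂ (inj₁ e∈)) → inj₂ (inj₁ (there e∈)) ; (inj₂ (inj₂ e∈)) → inj₂ (inj₂ e∈) }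
      ; kept> = λ { (here refl) → k<s ; (there e∈) → kept> e∈ }
      ; stk≡ = stk≡ }

    scan-push : supp f ≡ k → Scan k supp todo kept (f ∷ stk)
    scan-push s≡k = record
      { todo-unique = unique′ todo-unique
      ; kept-unique = kept-unique
      ; stk-unique = ∉⇒unique (proj₂ (fresh (here refl))) stk-unique
      ; fresh = λ e∈ → proj₁ (fresh (there e∈)) , ∉-cons e∈ (proj₂ (fresh (there e∈)))
      ; cover = λ k≤s → case cover k≤s of λ
          { (inj₁ (here refl)) → inj₂ (inj₂ (here refl)) ; (inj₁ (there e∈)) → inj₁ e∈
          ; (inj₂ (inj₁ e∈)) → inj₂ (inj₁ e∈) ; (inj₂ (inj₂ e∈)) → inj₂ (inj₂ (there e∈)) }
      ; kept> = kept>
      ; stk≡ = λ { (here refl) → s≡k ; (there e∈) → stk≡ e∈ } }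

    scan-drop : supp f < k → Scan k supp todo kept stk
    scan-drop s<k = record
      { todo-unique = unique′ todo-unique ; kept-unique = kept-unique ; stk-unique = stk-unique
      ; fresh = fresh ∘ there
      ; cover = λ k≤s → case cover k≤s of λ
          { (inj₁ (here refl)) → ⊥-elim (<⇒≱ s<k k≤s) ; (inj₁ (there e∈)) → inj₁ e∈ ; (inj₂ r) → inj₂ r }
      ; kept> = kept> ; stk≡ = stk≡ }

  scan-start : ∀ {k supp live} → Unique live → (∀ {e} → k ≤ supp e → e ∈ˡ live) → Scan k supp live [] []
  scan-start u cover = record
    { todo-unique = u ; kept-unique = [] ; stk-unique = []
    ; fresh = λ _ → (λ ()) , (λ ()) ; cover = inj₁ ∘ cover ; kept> = λ () ; stk≡ = λ () }

  scan-kept : ∀ {k supp kept stk} → Scan k supp [] kept stk → ∀ {e} → k < supp e → e ∈ˡ kept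
  scan-kept S k<s with Scan.cover S (<⇒≤ k<s)
  ... | inj₁ ()
  ... | inj₂ (inj₁ e∈) = e∈
  ... | inj₂ (inj₂ e∈) = ⊥-elim (<-irrefl (sym (Scan.stk≡ S e∈)) k<s)

  scan-stack : ∀ {k A supp kept stk} → LevelStart k A supp → Scan k supp [] kept stk → Stack k A supp stk
  scan-stack {k} {A} {supp} L S = record
    { unique = stk-unique
    ; sound = λ e∈ → ≤-reflexive (stk≡ e∈) , alive⁺ (≤-reflexive (sym (stk≡ e∈)))
    ; complete = λ s≤k e∈A → case cover (alive⁻ e∈A) of λ
        { (inj₁ ()) ; (inj₂ (inj₁ e∈)) → ⊥-elim (<⇒≱ (kept> e∈) s≤k) ; (inj₂ (inj₂ e∈)) → e∈ } }
    where
    open LevelStart L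
    open Scan S

-- Linked lists in memory; the pointer to i is 1 + i, and 0 ends the list

Linked : ∀ {m} → (ℕ → ℕ) → ℕ → List (Fin m) → Set
Linked next p []      = p ≡ 0
Linked next p (e ∷ l) = p ≡ suc (toℕ e) × Linked next (next (toℕ e)) l

linked-frame : ∀ {m next p} {l : List (Fin m)} {i v} → (∀ {f} → f ∈ˡ l → toℕ f ≢ i) →
  Linked next p l → Linked (write next i v) p l
linked-frame {l = []}    _     eq       = eq
linked-frame {next = next} {l = e ∷ l} {i} {v} fresh (eq , ls) = eq ,
  subst (λ p → Linked (write next i v) p l) (sym (write-other {next} (fresh (here refl)))) (linked-frame (fresh ∘ there) ls)

linked-push : ∀ {m next p} {l : List (Fin m)} {e} → e ∉ˡ l →
  Linked next p l → Linked (write next (toℕ e) p) (suc (toℕ e)) (e ∷ l)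
linked-push {next = next} {p} {l} {e} e∉ ls = refl ,
  subst (λ q → Linked (write next (toℕ e) p) q l) (sym (write-same {next} {toℕ e} refl))
    (linked-frame (λ f∈ eq → e∉ (subst (_∈ˡ l) (toℕ-injective eq) f∈)) ls)

-- The program

-- `rE` holds the current edge, `rK` the level, `rSP` the top of the stack, `rLV` the head of the
-- live list. `rU` and `rV` are the ends of the edge, `rC` is the cursor in a list, `rF`, `rG` and
-- `rW` are the other two edges and the apex of a triangle, `rH` is the argument of `decrement`, and
-- `rX` carries the loop tests.
rE rK rSP rLV rU rV rC rF rG rW rA rB rX rY rZ rH : Fin 16
rE  = # 0
rK  = # 1
rSP = # 2
rLV = # 3
rU  = # 4
rV  = # 5
rC  = # 6
rF  = # 7
rG  = # 8
rW  = # 9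
rA  = # 10
rB  = # 11
rX  = # 12
rY  = # 13
rZ  = # 14
rH  = # 15

-- `HEAD` and `DEG` are indexed by vertices, the others by edges. The links `NXL` and `NXS` are
-- separate because an edge pushed on the stack during a removal still stands in the live list.
SUPP HEAD DEG NS NT DEAD NXL NXS : Fin 8
SUPP = # 0
HEAD = # 1
DEG  = # 2
NS   = # 3
NT   = # 4
DEAD = # 5
NXL  = # 6
NXS  = # 7

Code : Set
Code = Cmd 16 8

-- The edges at v form a linked list from HEAD v; the successor of edge e is
-- NS e in the list of its source and NT e in the list of its target.
buildBody : Code
buildBody = block
  ( SET rZ 1 ∷ SUB rE rE rZ ∷ SRC rU rE ∷ TGT rV rE ∷ ADD rB rZ rE
  ∷ LOAD rA HEAD rU ∷ STORE NS rE rA ∷ STORE HEAD rU rB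
  ∷ LOAD rA DEG rU ∷ ADD rA rZ rA ∷ STORE DEG rU rA
  ∷ LOAD rA HEAD rV ∷ STORE NT rE rA ∷ STORE HEAD rV rB
  ∷ LOAD rA DEG rV ∷ ADD rA rZ rA ∷ STORE DEG rV rA
  -- `SET` to 0 followed by `ADD` copies a register. The test computed next, 1 minus `rE`, is
  -- nonzero exactly when the countdown has reached edge 0.
  ∷ STORE NXL rE rLV ∷ SET rLV 0 ∷ ADD rLV rLV rB
  ∷ SET rX 1 ∷ SUB rX rX rE ∷ [] )

build : Code
build = block [ SIZE rE ] ⨟ until rX buildBody

-- The far end is source plus target minus `rU`, without a case distinction. `rX` gets the distance
-- between the source and `rU`: if it is zero, the successor loaded from `NS` is right, otherwise
-- the one from `NT` replaces it.
visitLocate visitAdvance visitLast : Code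
visitLocate = block
  ( SET rZ 1 ∷ SUB rF rC rZ ∷ SRC rA rF ∷ TGT rB rF ∷ ADD rW rA rB ∷ SUB rW rW rU
  ∷ SUB rX rA rU ∷ SUB rY rU rA ∷ ADD rX rX rY ∷ LOAD rC NS rF ∷ [] )
visitAdvance = when rX (block [ LOAD rC NT rF ])
visitLast = block ( SET rX 1 ∷ SUB rX rX rC ∷ [] )

visitClose visit forTriangles : Code → Code
visitClose body = block [ EDGE rG rV rW ] ⨟ when rG (block ( SET rZ 1 ∷ SUB rG rG rZ ∷ [] ) ⨟ body) ⨟ visitLast
visit body = visitLocate ⨟ visitAdvance ⨟ visitClose body

swapEnds : Code
swapEnds = block ( SET rZ 0 ∷ ADD rZ rZ rU ∷ SET rU 0 ∷ ADD rU rU rV ∷ SET rV 0 ∷ ADD rV rV rZ ∷ [] )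

-- Runs body for each triangle of edge E, with its other edges in F and G.
forTriangles body =
  block ( SRC rU rE ∷ TGT rV rE ∷ LOAD rA DEG rU ∷ LOAD rB DEG rV ∷ SUB rX rA rB ∷ [] )
  ⨟ when rX swapEnds
  ⨟ block [ LOAD rC HEAD rU ]
  ⨟ when rC (until rX (visit body))

AdjacencyOf : (G : Graph) → let open Graph G in (head deg ns nt : ℕ → ℕ) → List (Fin m) → Set

-- A variant of `Linked` in which the link array depends on the edge: every edge stands in the lists
-- of both ends, and being the source or not decides which successor belongs to this list.
Chain : (G : Graph) → let open Graph G in (ns nt : ℕ → ℕ) → Fin n → ℕ → List (Fin m) → Set
Chain G ns nt u p []      = p ≡ 0
Chain G ns nt u p (f ∷ l) = p ≡ suc (toℕ f) × Incident u f
  × Chain G ns nt u (if does (src f ≟ᶠ u) then ns (toℕ f) else nt (toℕ f)) l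
  where open Graph G

AdjacencyOf G head degs ns nt done =
  (∀ x → Chain G ns nt x (head (toℕ x)) (filter (incident? x) done))
  × (∀ x → degs (toℕ x) ≡ length (filter (incident? x) done))
  where open Graph G

module _ (G : Graph) where
  open Graph G

  chain-frame : ∀ {ns nt x p i a b} {l : List (Fin m)} → (∀ {f} → f ∈ˡ l → toℕ f ≢ i) →
    Chain G ns nt x p l → Chain G (write ns i a) (write nt i b) x p l
  chain-frame {l = []} fresh eq = eq
  chain-frame {ns} {nt} {x} {p} {i} {a} {b} {f ∷ l} fresh (eq , inc , ch) = eq , inc ,
    subst (λ q → Chain G _ _ x q l) (sym same) (chain-frame (fresh ∘ there) ch)
    where
    same : (if does (src f ≟ᶠ x) then write ns i a (toℕ f) else write nt i b (toℕ f))
         ≡ (if does (src f ≟ᶠ x) then ns (toℕ f) else nt (toℕ f))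
    same = cong₂ (λ p q → if does (src f ≟ᶠ x) then p else q)
      (write-other {ns} (fresh (here refl))) (write-other {nt} (fresh (here refl)))

  -- At `v` the program reads `HEAD` and `DEG` after writing them at `u`, hence `head′` and `degs′`;
  -- without loops these agree with the old values at `v`.
  adjacency-cons : ∀ {head degs ns nt e done i} → e ∉ˡ done → i ≡ toℕ e →
    AdjacencyOf G head degs ns nt done →
    let u = toℕ (src e) ; v = toℕ (tgt e)
        head′ = write head u (suc i) ; degs′ = write degs u (suc (degs u)) in
    AdjacencyOf G (write head′ v (suc i)) (write degs′ v (suc (degs′ v)))
      (write ns i (head u)) (write nt i (head′ v)) (e ∷ done)
  adjacency-cons {head} {degs} {ns} {nt} {e} {done} {i} e∉ refl (chain , deg≡) = chain′ , deg≡′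
    where
    u = toℕ (src e)
    v = toℕ (tgt e)
    head′ = write head u (suc i)
    degs′ = write degs u (suc (degs u))
    ns′ = write ns i (head u)
    nt′ = write nt i (head′ v)
    u≢v : u ≢ v
    u≢v = loopless e ∘ toℕ-injective
    head-v : head′ v ≡ head v
    head-v = write-other {head} (u≢v ∘ sym)
    frame : ∀ x p → Chain G ns nt x p (filter (incident? x) done) → Chain G ns′ nt′ x p (filter (incident? x) done)
    frame x p = chain-frame λ f∈ eq →
      e∉ (subst (_∈ˡ done) (toℕ-injective eq) (proj₁ (∈-filter⁻ (incident? x) {xs = done} f∈)))
    extend : ∀ {x} → Incident x e → (if does (src e ≟ᶠ x) then ns′ i else nt′ i) ≡ head (toℕ x) →
      Chain G ns′ nt′ x (suc i) (filter (incident? x) (e ∷ done))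
    extend {x} inc eq = subst (Chain G ns′ nt′ x (suc i)) (sym (filter-accept (incident? x) inc))
      (refl , inc , subst (λ p → Chain G ns′ nt′ x p _) (sym eq) (frame x _ (chain x)))
    chain′ : ∀ x → Chain G ns′ nt′ x (write head′ v (suc i) (toℕ x)) (filter (incident? x) (e ∷ done))
    chain′ x = cases x (src e ≟ᶠ x) (tgt e ≟ᶠ x)
      where
      cases : ∀ x → Dec (src e ≡ x) → Dec (tgt e ≡ x) →
        Chain G ns′ nt′ x (write head′ v (suc i) (toℕ x)) (filter (incident? x) (e ∷ done))
      cases x (yes refl) _ = subst (λ p → Chain G ns′ nt′ x p _)
        (sym (trans (write-other {head′} u≢v) (write-same {head} {u} refl)))
        (extend (inj₁ refl) (trans (cong (λ b → if b then ns′ i else nt′ i) (dec-true (x ≟ᶠ x) refl)) (write-same {ns} {i} refl)))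
      cases x (no u≢x) (yes refl) = subst (λ p → Chain G ns′ nt′ x p _) (sym (write-same {head′} {v} refl))
        (extend (inj₂ refl) (trans (cong (λ b → if b then ns′ i else nt′ i) (dec-false (src e ≟ᶠ x) u≢x))
          (trans (write-same {nt} {i} refl) head-v)))
      cases x (no u≢x) (no v≢x) = subst₂ (Chain G ns′ nt′ x)
        (sym (trans (write-other {head′} (v≢x ∘ sym ∘ toℕ-injective)) (write-other {head} (u≢x ∘ sym ∘ toℕ-injective))))
        (sym (filter-reject (incident? x) λ { (inj₁ p) → u≢x p ; (inj₂ q) → v≢x q }))
        (frame x _ (chain x))
    deg≡′ : ∀ x → write degs′ v (suc (degs′ v)) (toℕ x) ≡ length (filter (incident? x) (e ∷ done))
    deg≡′ x = cases x (src e ≟ᶠ x) (tgt e ≟ᶠ x)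
      where
      cases : ∀ x → Dec (src e ≡ x) → Dec (tgt e ≡ x) →
          write degs′ v (suc (degs′ v)) (toℕ x) ≡ length (filter (incident? x) (e ∷ done))
      cases x (yes refl) _ = trans (write-other {degs′} u≢v) (trans (write-same {degs} {u} refl)
        (trans (cong suc (deg≡ x)) (cong length (sym (filter-accept (incident? x) (inj₁ refl))))))
      cases x (no u≢x) (yes refl) = trans (write-same {degs′} {v} refl)
        (trans (cong suc (trans (write-other {degs} (u≢v ∘ sym)) (deg≡ x)))
          (cong length (sym (filter-accept (incident? x) (inj₂ refl)))))
      cases x (no u≢x) (no v≢x) = trans (write-other {degs′} (v≢x ∘ sym ∘ toℕ-injective))
        (trans (write-other {degs} (u≢x ∘ sym ∘ toℕ-injective))
          (trans (deg≡ x) (cong length (sym (filter-reject (incident? x) λ { (inj₁ p) → u≢x p ; (inj₂ q) → v≢x q })))))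

-- Correctness and running time of the program

module Building (code : List (Instr 16 8)) (G : Graph) (s : ℕ) (n≤s : Graph.n G ≤ s) (m≤s : Graph.m G ≤ s) where
  open Graph G
  open Semantics code SUPP G s

  vertex<s : ∀ {i} (v : Fin n) → i ≡ toℕ v → i < s
  vertex<s v refl = ≤-trans (toℕ<n v) n≤s

  edge<s : ∀ {i} (e : Fin m) → i ≡ toℕ e → i < s
  edge<s e refl = ≤-trans (toℕ<n e) m≤s

  Mem : Set
  Mem = Fin 8 → ℕ → ℕ

  -- The part of the state that scratch registers and time do not affect.
  record View : Set where
    constructor mkView
    field
      M          : Mem
      e k sp lv : ℕ

  view : State → View
  view σ = mkView (mem σ) (reg σ rE) (reg σ rK) (reg σ rSP) (reg σ rLV)

  Static : Mem → List (Fin m) → Set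
  Static M = AdjacencyOf G (M HEAD) (M DEG) (M NS) (M NT)

  -- The loop counts down, so the edges already stored are a `drop` of `allFin m`, and prepending to
  -- linked lists reproduces the order of `allFin m`.
  record BuildInv (k : ℕ) (σ : State) : Set where
    field
      e≡    : reg σ rE ≡ k
      adj   : Static (mem σ) (drop k (allFin m))
      live  : Linked (mem σ NXL) (reg σ rLV) (drop k (allFin m))
      supp0 : ∀ i → mem σ SUPP i ≡ 0
      dead0 : ∀ i → mem σ DEAD i ≡ 0

  ∉-drop : ∀ (e : Fin m) → e ∉ˡ drop (suc (toℕ e)) (allFin m)
  ∉-drop e = Unique[x∷xs]⇒x∉xs (subst Unique (drop-allFin e) (Unique-drop⁺ (toℕ e) (allFin⁺ m)))

  build-step : ∀ {σ} (e : Fin m) → BuildInv (suc (toℕ e)) σ →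
    Wp buildBody (λ σ′ → BuildInv (toℕ e) σ′ × reg σ′ rX ≡ 1 ∸ toℕ e × time σ′ ≡ 22 + time σ) σ
  build-step {σ} e inv = wp-block
    ( i , i≡ , e , refl , e , refl , suc i , refl
    , u , refl , u< , h u , refl , i , refl , e< , h u , refl , u , refl , u< , suc i , refl
    , u , refl , u< , d u , refl , suc (d u) , refl , u , refl , u< , suc (d u) , refl
    , v , refl , v< , h′ v , refl , i , refl , e< , h′ v , refl , v , refl , v< , suc i , refl
    , v , refl , v< , d′ v , refl , suc (d′ v) , refl , v , refl , v< , suc (d′ v) , refl
    , i , refl , e< , reg σ rLV , refl , suc i , refl
    , 1 ∸ i , refl
    , record { e≡ = refl
             ; adj = subst (AdjacencyOf G (write h′ v (suc i)) (write d′ v (suc (d′ v)))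
                       (write (mem σ NS) i (h u)) (write (mem σ NT) i (h′ v))) (sym (drop-allFin e)) (adjacency-cons G {h} {d} {mem σ NS} {mem σ NT} (∉-drop e) refl adj)
             ; live = subst (Linked (write (mem σ NXL) i (reg σ rLV)) (suc i)) (sym (drop-allFin e)) (linked-push (∉-drop e) live)
             ; supp0 = supp0 ; dead0 = dead0 }
    , refl , refl )
    where
    open BuildInv inv
    i = toℕ e
    u = toℕ (src e)
    v = toℕ (tgt e)
    h = mem σ HEAD
    d = mem σ DEG
    h′ = write h u (suc i)
    d′ = write d u (suc (d u))
    i≡ : reg σ rE ∸ 1 ≡ toℕ e
    i≡ = cong (_∸ 1) e≡
    e< = edge<s e refl
    u< = vertex<s (src e) refl
    v< = vertex<s (tgt e) refl

  -- The `suc` in the time of a round pays for the closing `JZ`. The time bound gains the summand of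
  -- one edge per round and ends as the full sum.
  countdown : ∀ {c} (Inv : ℕ → State → Set) (cost : Fin m → ℕ) →
    (∀ {k σ} → Inv k σ → Inv k (tick σ)) →
    (∀ {σ} e → Inv (suc (toℕ e)) σ →
      Wp c (λ σ′ → Inv (toℕ e) σ′ × reg σ′ rX ≡ 1 ∸ toℕ e × suc (time σ′) ≤ cost e + time σ) σ) →
    ∀ k {σ} T → suc k ≤ m → Inv (suc k) σ →
    time σ ≤ T + sum (map cost (drop (suc k) (allFin m))) →
    Wp (until rX c) (λ σ′ → Inv 0 σ′ × time σ′ ≤ T + sum (map cost (allFin m))) σ
  countdown {c} Inv cost inv-tick body k {σ} T k<m inv le =
    wp-until (wp-mono (next k e≡) (body e (subst (λ j → Inv (suc j) σ) (sym e≡) inv)))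
    where
    Q : State → Set
    Q σ′ = Inv 0 σ′ × time σ′ ≤ T + sum (map cost (allFin m))
    e : Fin m
    e = fromℕ< k<m
    e≡ : toℕ e ≡ k
    e≡ = toℕ-fromℕ< k<m
    le′ : ∀ {t j} → toℕ e ≡ j → t ≤ cost e + time σ → t ≤ T + sum (map cost (drop j (allFin m)))
    le′ {t} {j} refl t≤ = begin
      t                                                       ≤⟨ t≤ ⟩
      cost e + time σ                                         ≤⟨ +-monoʳ-≤ (cost e) le ⟩
      cost e + (T + sum (map cost (drop (suc k) (allFin m)))) ≡⟨ swap (cost e) T _ ⟩
      T + (cost e + sum (map cost (drop (suc k) (allFin m)))) ≡⟨ cong (λ k → T + (cost e + sum (map cost (drop (suc k) (allFin m))))) e≡ ⟨
      T + sum (map cost (e ∷ drop (suc j) (allFin m)))        ≡⟨ cong (λ l → T + sum (map cost l)) (drop-allFin e) ⟨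
      T + sum (map cost (drop j (allFin m)))                  ∎
      where
      open ≤-Reasoning
      swap : ∀ a b c → a + (b + c) ≡ b + (a + c)
      swap = solve-∀
    next : ∀ j {σ′} → toℕ e ≡ j →
      Inv (toℕ e) σ′ × reg σ′ rX ≡ 1 ∸ toℕ e × suc (time σ′) ≤ cost e + time σ →
      (reg σ′ rX ≡ 0 × Wp (until rX c) Q (tick σ′)) ⊎ (reg σ′ rX ≢ 0 × Q (tick σ′))
    next zero eq (inv′ , x≡ , t≤) = inj₂
      ( (λ x≡0 → case trans (sym (trans x≡ (cong (1 ∸_) eq))) x≡0 of λ ())
      , inv-tick (subst (λ j → Inv j _) eq inv′) , le′ eq t≤ )
    next (suc j) eq (inv′ , x≡ , t≤) = inj₁
      ( trans x≡ (trans (cong (1 ∸_) eq) (0∸n≡0 j))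
      , countdown Inv cost inv-tick body j T (≤-trans (≤-reflexive (sym eq)) (<⇒≤ (toℕ<n e)))
          (inv-tick (subst (λ j → Inv j _) eq inv′)) (le′ eq t≤) )


  build-spec : ∀ {k} → m ≡ suc k →
    Wp build (λ σ → BuildInv 0 σ × time σ ≤ 1 + sum (map (const 23) (allFin m))) start
  build-spec {k} m≡ = wp-seq (wp-block
    (countdown BuildInv (const 23) (λ inv → record { BuildInv inv }) step k 1 (≤-reflexive (sym m≡)) start-inv (s≤s z≤n)))
    where
    step : ∀ {σ} e → BuildInv (suc (toℕ e)) σ →
      Wp buildBody (λ σ′ → BuildInv (toℕ e) σ′ × reg σ′ rX ≡ 1 ∸ toℕ e × suc (time σ′) ≤ 23 + time σ) σ
    step e inv = wp-mono (λ { (inv′ , x≡ , t≡) → inv′ , x≡ , s≤s (≤-reflexive t≡) }) (build-step e inv)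
    start-inv : BuildInv (suc k) (setReg rE m start)
    start-inv = record
      { e≡ = m≡
      ; adj = subst (Static (const (const 0))) (sym no-edges) ((λ x → refl) , λ x → refl)
      ; live = subst (Linked (const 0) 0) (sym no-edges) refl
      ; supp0 = λ _ → refl ; dead0 = λ _ → refl }
      where
      drop-all : ∀ {A : Set} (xs : List A) k → length xs ≡ k → drop k xs ≡ []
      drop-all []       _ refl = refl
      drop-all (x ∷ xs) _ refl = drop-all xs _ refl
      no-edges : drop (suc k) (allFin m) ≡ []
      no-edges = drop-all (allFin m) (suc k) (trans (length-allFin m) m≡)

-- Walking over the triangles of an edge

module Traversal (code : List (Instr 16 8)) (G : Graph) (s : ℕ) (n≤s : Graph.n G ≤ s) (m≤s : Graph.m G ≤ s) where
  open Graph G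
  open Triangles G
  open Peeling G
  open Semantics code SUPP G s
  open Machine prog G s using (edgeTable)
  open Building code G s n≤s m≤s

  edgeTable-spec : ∀ u v → (edgeTable (toℕ u) (toℕ v) ≡ 0 × ¬ Adj G ⊤ u v)
    ⊎ ∃ λ g → edgeTable (toℕ u) (toℕ v) ≡ suc (toℕ g) × Joins g u v
  edgeTable-spec u v with any? (λ e →
      ((toℕ (src e) ≟ℕ toℕ u) ×-dec (toℕ (tgt e) ≟ℕ toℕ v)) ⊎-dec
      ((toℕ (src e) ≟ℕ toℕ v) ×-dec (toℕ (tgt e) ≟ℕ toℕ u)))
  ... | yes (e , inj₁ (p , q)) = inj₂ (e , refl , inj₁ (toℕ-injective p , toℕ-injective q))
  ... | yes (e , inj₂ (p , q)) = inj₂ (e , refl , inj₂ (toℕ-injective p , toℕ-injective q))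
  ... | no none = inj₁ (refl , λ { (e , _ , inj₁ (refl , refl)) → none (e , inj₁ (refl , refl))
                                 ; (e , _ , inj₂ (refl , refl)) → none (e , inj₂ (refl , refl)) })

  -- What the walk itself needs after a body has run: both ends, the cursor, which already points to
  -- the next edge, and the links.
  record Keeps (σ σ′ : State) : Set where
    field
      u≡  : reg σ′ rU ≡ reg σ rU
      v≡  : reg σ′ rV ≡ reg σ rV
      c≡  : reg σ′ rC ≡ reg σ rC
      ns≡ : mem σ′ NS ≡ mem σ NS
      nt≡ : mem σ′ NT ≡ mem σ NT

  -- `I l` is the invariant while the edges `l` at `u` are still ahead. A visit consumes the head of
  -- the list, by the body if the edge closes a triangle and otherwise by `skip-spec` with an
  -- unchanged view.
  module _ {u v : Fin n} (body : Code) (cost : ℕ) (I : List (Fin m) → View → Set)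
    (body-spec : ∀ {f g w l σ} → Joins f u w → Joins g v w → I (f ∷ l) (view σ) →
      reg σ rF ≡ toℕ f → reg σ rG ≡ toℕ g →
      Wp body (λ σ′ → I l (view σ′) × Keeps σ σ′ × time σ′ ≤ cost + time σ) σ)
    (skip-spec : ∀ {f w l V} → Joins f u w → ¬ Adj G ⊤ v w → I (f ∷ l) V → I l V) where

    record Visiting (l : List (Fin m)) (σ : State) : Set where
      field
        u≡    : reg σ rU ≡ toℕ u
        v≡    : reg σ rV ≡ toℕ v
        chain : Chain G (mem σ NS) (mem σ NT) u (reg σ rC) l

    visiting-keeps : ∀ {l σ σ′} → Keeps σ σ′ → Visiting l σ → Visiting l σ′
    visiting-keeps {l} {σ} {σ′} K V = record
      { u≡ = trans K.u≡ (Visiting.u≡ V) ; v≡ = trans K.v≡ (Visiting.v≡ V)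
      ; chain = chain-cong K.ns≡ K.nt≡ K.c≡ (Visiting.chain V) }
      where
      module K = Keeps K
      chain-cong : ∀ {a a′ b b′ p p′} → a′ ≡ a → b′ ≡ b → p′ ≡ p → Chain G a b u p l → Chain G a′ b′ u p′ l
      chain-cong refl refl refl ch = ch

    Visited : List (Fin m) → ℕ → State → Set
    Visited l T σ = Visiting l σ × I l (view σ) × reg σ rX ≡ 1 ∸ reg σ rC × time σ ≤ T

    last-spec : ∀ {l T σ} → Visiting l σ → I l (view σ) → 2 + time σ ≤ T → Wp visitLast (Visited l T) σ
    last-spec V inv le = wp-block (_ , refl , record { Visiting V } , inv , refl , le)

    close-spec : ∀ {f w l T σ} → Joins f u w → reg σ rF ≡ toℕ f → reg σ rW ≡ toℕ w →
      Visiting l σ → I (f ∷ l) (view σ) → cost + (6 + time σ) ≤ T → Wp (visitClose body) (Visited l T) σ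
    close-spec {f} {w} {l} {T} {σ} f-uw f≡ w≡ V inv le with edgeTable-spec v w
    ... | inj₁ (eq , none) = wp-seq (wp-block (0 , trans (cong₂ edgeTable (Visiting.v≡ V) w≡) eq ,
        wp-seq (wp-when
          (λ _ → last-spec (record { Visiting V }) (skip-spec f-uw none inv)
            (≤-trans (+-monoˡ-≤ (time σ) (s≤s (s≤s (s≤s (s≤s z≤n))))) (≤-trans (m≤n+m _ cost) le)))
          (λ ()))))
    ... | inj₂ (g , eq , g-vw) = wp-seq (wp-block (suc (toℕ g) , trans (cong₂ edgeTable (Visiting.v≡ V) w≡) eq ,
        wp-seq (wp-when (λ ())
          (λ _ → wp-seq (wp-block (toℕ g , refl ,
            wp-mono (λ { (inv′ , K , t≤) → last-spec (visiting-keeps K (record { Visiting V })) inv′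
                (≤-trans (+-monoʳ-≤ 2 t≤) (≤-trans (≤-reflexive (rearrange cost (time σ))) le)) })
              (body-spec f-uw g-vw inv f≡ refl)))))))
      where
      rearrange : ∀ c t → 2 + (c + (4 + t)) ≡ c + (6 + t)
      rearrange = solve-∀

    advance-spec : ∀ {f w l T σ} → Joins f u w → reg σ rF ≡ toℕ f → reg σ rW ≡ toℕ w →
      reg σ rU ≡ toℕ u → reg σ rV ≡ toℕ v →
      (reg σ rX ≡ 0 → src f ≡ u) → (src f ≡ u → reg σ rX ≡ 0) → reg σ rC ≡ mem σ NS (toℕ f) →
      Chain G (mem σ NS) (mem σ NT) u (if does (src f ≟ᶠ u) then mem σ NS (toℕ f) else mem σ NT (toℕ f)) l →
      I (f ∷ l) (view σ) → cost + (8 + time σ) ≤ T → Wp (visitAdvance ⨟ visitClose body) (Visited l T) σ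
    advance-spec {f} {w} {l} {T} {σ} f-uw f≡ w≡ u≡ v≡ x≡0⇒ ⇒x≡0 c≡ chain inv le = wp-seq (wp-when
      (λ x≡0 → close-spec f-uw f≡ w≡
        (record { u≡ = u≡ ; v≡ = v≡ ; chain = subst (λ p → Chain G _ _ u p l) (from-src (x≡0⇒ x≡0)) chain })
        inv (≤-trans (+-monoʳ-≤ cost (n≤1+n _)) le))
      (λ {k} x≡ → wp-block (toℕ f , f≡ , edge<s f refl , mem σ NT (toℕ f) , refl ,
        close-spec f-uw f≡ w≡
          (record { u≡ = u≡ ; v≡ = v≡ ; chain = subst (λ p → Chain G (mem σ NS) (mem σ NT) u p l)
            (from-tgt (λ eq → case trans (sym x≡) (⇒x≡0 eq) of λ ())) chain })
          inv le)))
      where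
      from-src : src f ≡ u → (if does (src f ≟ᶠ u) then mem σ NS (toℕ f) else mem σ NT (toℕ f)) ≡ reg σ rC
      from-src eq = trans (cong (λ b → if b then mem σ NS (toℕ f) else mem σ NT (toℕ f)) (dec-true (src f ≟ᶠ u) eq)) (sym c≡)
      from-tgt : src f ≢ u → (if does (src f ≟ᶠ u) then mem σ NS (toℕ f) else mem σ NT (toℕ f)) ≡ mem σ NT (toℕ f)
      from-tgt neq = cong (λ b → if b then mem σ NS (toℕ f) else mem σ NT (toℕ f)) (dec-false (src f ≟ᶠ u) neq)

    visit-spec : ∀ {f l T σ} → Visiting (f ∷ l) σ → I (f ∷ l) (view σ) → cost + (18 + time σ) ≤ T →
      Wp (visit body) (Visited l T) σ
    visit-spec {f} {l} {T} {σ} V inv le with Visiting.chain V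
    ... | c≡ , inc , chain with incident-joins inc
    ... | w , f-uw = wp-seq (wp-block
      ( toℕ f , cong (_∸ 1) c≡ , f , refl , f , refl
      , toℕ (src f) + toℕ (tgt f) , refl , toℕ w , trans (cong (toℕ (src f) + toℕ (tgt f) ∸_) u≡) (other f-uw)
      , x₁ , cong (toℕ (src f) ∸_) u≡ , x₂ , cong (_∸ toℕ (src f)) u≡ , x₁ + x₂ , refl
      , toℕ f , refl , edge<s f refl , mem σ NS (toℕ f) , refl
      , advance-spec f-uw refl refl u≡ v≡ to from refl chain inv le ))
      where
      open Visiting V using (u≡; v≡)
      x₁ = toℕ (src f) ∸ toℕ u
      x₂ = toℕ u ∸ toℕ (src f)
      other : Joins f u w → toℕ (src f) + toℕ (tgt f) ∸ toℕ u ≡ toℕ w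
      other (inj₁ (refl , refl)) = m+n∸m≡n (toℕ (src f)) (toℕ (tgt f))
      other (inj₂ (refl , refl)) = m+n∸n≡m (toℕ (src f)) (toℕ (tgt f))
      to : x₁ + x₂ ≡ 0 → src f ≡ u
      to eq = toℕ-injective (≤-antisym (m∸n≡0⇒m≤n (m+n≡0⇒m≡0 x₁ eq)) (m∸n≡0⇒m≤n (m+n≡0⇒n≡0 x₁ eq)))
      from : src f ≡ u → x₁ + x₂ ≡ 0
      from refl = cong₂ _+_ (n∸n≡0 (toℕ u)) (n∸n≡0 (toℕ u))

    -- A visit takes at most 18 instructions besides the body, 10 of them in `visitLocate`; the
    -- closing jump and one unit of slack make 20.
    visit-all : ∀ f l {σ} T → Visiting (f ∷ l) σ → I (f ∷ l) (view σ) →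
      time σ + length (f ∷ l) * (20 + cost) ≤ T →
      Wp (until rX (visit body)) (λ σ′ → I [] (view σ′) × time σ′ ≤ T) σ
    visit-all f l {σ} T V inv le = wp-until (wp-mono (next l le) (visit-spec V inv ≤-refl))
      where
      next : ∀ l {σ′} → time σ + length (f ∷ l) * (20 + cost) ≤ T → Visited l (cost + (18 + time σ)) σ′ →
        (reg σ′ rX ≡ 0 × Wp (until rX (visit body)) (λ σ′ → I [] (view σ′) × time σ′ ≤ T) (tick σ′))
        ⊎ (reg σ′ rX ≢ 0 × I [] (view σ′) × time (tick σ′) ≤ T)
      next [] {σ′} le (V′ , inv′ , x≡ , t≤) = inj₂
        ( (λ x≡0 → case trans (sym (trans x≡ (cong (1 ∸_) (Visiting.chain V′)))) x≡0 of λ ())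
        , inv′ , ≤-trans (s≤s t≤) (≤-trans (≤-trans (n≤1+n _) (≤-reflexive (rearrange cost (time σ)))) le) )
        where
        rearrange : ∀ c t → 1 + (1 + (c + (18 + t))) ≡ t + 1 * (20 + c)
        rearrange = solve-∀
      next (f′ ∷ l′) {σ′} le (V′ , inv′ , x≡ , t≤) = inj₁
        ( trans x≡ (trans (cong (1 ∸_) (proj₁ (Visiting.chain V′))) (0∸n≡0 (toℕ f′)))
        , visit-all f′ l′ T (record { Visiting V′ }) inv′
            (≤-trans (+-monoˡ-≤ _ (s≤s t≤)) (≤-trans (≤-trans (n≤1+n _) (≤-reflexive (rearrange cost (time σ) (length l′)))) le)) )
        where
        rearrange : ∀ c t l → 1 + (1 + (c + (18 + t)) + (1 + l) * (20 + c)) ≡ t + (2 + l) * (20 + c)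
        rearrange = solve-∀

  -- Which end becomes `u` is decided by the degrees, so the invariant is required for both
  -- orientations at the start and returned for an unknown one. After the possible swap, `deg u` is
  -- `minDeg e`, which bounds the number of visits.
  forTriangles-spec : ∀ {e σ} (body : Code) (cost : ℕ) (I : Fin n → Fin n → List (Fin m) → View → Set) →
    (∀ {u v f g w l σ} → Joins e u v → Joins f u w → Joins g v w → I u v (f ∷ l) (view σ) →
      reg σ rF ≡ toℕ f → reg σ rG ≡ toℕ g →
      Wp body (λ σ′ → I u v l (view σ′) × Keeps σ σ′ × time σ′ ≤ cost + time σ) σ) →
    (∀ {u v f w l V} → Joins f u w → ¬ Adj G ⊤ v w → I u v (f ∷ l) V → I u v l V) →
    reg σ rE ≡ toℕ e → Static (mem σ) (allFin m) →
    (∀ {u v} → Joins e u v → I u v (incidents u) (view σ)) →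
    Wp (forTriangles body)
      (λ σ′ → (∃ λ u → ∃ λ v → Joins e u v × I u v [] (view σ′))
            × time σ′ ≤ time σ + (15 + minDeg e * (20 + cost))) σ
  forTriangles-spec {e} {σ} body cost I body-spec skip-spec e≡ (chains , degs) inv =
    wp-seq (wp-block
      ( e , e≡ , e , e≡
      , toℕ (src e) , refl , vertex<s (src e) refl , deg (src e) , degs (src e)
      , toℕ (tgt e) , refl , vertex<s (tgt e) refl , deg (tgt e) , degs (tgt e)
      , deg (src e) ∸ deg (tgt e) , refl
      , wp-seq (wp-when
          (λ le → rest (joins-self e) refl refl
            (≤-reflexive (sym (m≤n⇒m⊓n≡m (m∸n≡0⇒m≤n {deg (src e)} le)))) inv chains
            (+-monoˡ-≤ (time σ) (s≤s (s≤s (s≤s (s≤s (s≤s (s≤s z≤n))))))))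
          (λ {k} gt → wp-block
            ( _ , refl , _ , refl , _ , refl
            , rest (joins-sym (joins-self e)) refl refl
                (≤-reflexive (sym (m≥n⇒m⊓n≡n (<⇒≤ (m∸n≢0⇒n<m {deg (src e)} (λ eq → case trans (sym eq) gt of λ ()))))))
                inv chains ≤-refl ))) ))
    where
    Q : State → Set
    Q σ′ = (∃ λ u → ∃ λ v → Joins e u v × I u v [] (view σ′)) × time σ′ ≤ time σ + (15 + minDeg e * (20 + cost))
    rest : ∀ {u v σ₁} → Joins e u v → reg σ₁ rU ≡ toℕ u → reg σ₁ rV ≡ toℕ v → deg u ≤ minDeg e →
      (∀ {u v} → Joins e u v → I u v (incidents u) (view σ₁)) →
      (∀ x → Chain G (mem σ₁ NS) (mem σ₁ NT) x (mem σ₁ HEAD (toℕ x)) (incidents x)) →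
      time σ₁ ≤ 12 + time σ →
      Wp (block [ LOAD rC HEAD rU ] ⨟ when rC (until rX (visit body))) Q σ₁
    rest {u} {v} {σ₁} e-uv u≡ v≡ deg≤ inv chains t≤ =
      wp-seq (wp-block (toℕ u , u≡ , vertex<s u refl , mem σ₁ HEAD (toℕ u) , refl ,
        loop (incidents u) (chains u) (inv e-uv) ≤-refl))
      where
      open ≤-Reasoning
      loop : ∀ l → Chain G (mem σ₁ NS) (mem σ₁ NT) u (mem σ₁ HEAD (toℕ u)) l →
        I u v l (view σ₁) → length l ≤ deg u →
        Wp (when rC (until rX (visit body))) Q (setReg rC (mem σ₁ HEAD (toℕ u)) σ₁)
      loop [] c≡ inv _ = wp-when
        (λ _ → (u , v , e-uv , inv) , (begin
          2 + time σ₁                                 ≤⟨ +-monoʳ-≤ 2 t≤ ⟩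
          14 + time σ                                 ≡⟨ +-comm 14 (time σ) ⟩
          time σ + 14                                 ≤⟨ +-monoʳ-≤ (time σ) (m≤m+n 14 _) ⟩
          time σ + (15 + minDeg e * (20 + cost))      ∎))
        (λ neq → case trans (sym c≡) neq of λ ())
      loop (f ∷ l) ch inv len = wp-when
        (λ c≡0 → case trans (sym (proj₁ ch)) c≡0 of λ ())
        (λ _ → wp-mono (λ { (inv′ , t≤′) → (u , v , e-uv , inv′) , t≤′ })
          (visit-all {u} {v} body cost (I u v) (body-spec e-uv) skip-spec f l (time σ + (15 + minDeg e * (20 + cost)))
            (record { u≡ = u≡ ; v≡ = v≡ ; chain = ch }) inv (begin
              2 + time σ₁ + length (f ∷ l) * (20 + cost)   ≤⟨ +-mono-≤ (+-monoʳ-≤ 2 t≤) (*-monoˡ-≤ (20 + cost) (≤-trans len deg≤)) ⟩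
              14 + time σ + minDeg e * (20 + cost)         ≤⟨ n≤1+n _ ⟩
              15 + time σ + minDeg e * (20 + cost)         ≡⟨ cong (_+ minDeg e * (20 + cost)) (+-comm 15 (time σ)) ⟩
              time σ + 15 + minDeg e * (20 + cost)         ≡⟨ +-assoc (time σ) 15 _ ⟩
              time σ + (15 + minDeg e * (20 + cost))       ∎)))

-- Counting the triangles of every edge

countBody countStep count : Code
countBody = block ( LOAD rA SUPP rE ∷ SET rZ 1 ∷ ADD rA rZ rA ∷ STORE SUPP rE rA ∷ [] )
countStep =
  block ( SET rZ 1 ∷ SUB rE rE rZ ∷ [] )
  ⨟ forTriangles countBody
  ⨟ block ( SET rX 1 ∷ SUB rX rX rE ∷ [] )
count = block [ SIZE rE ] ⨟ until rX countStep

module Counting (code : List (Instr 16 8)) (G : Graph) (s : ℕ) (n≤s : Graph.n G ≤ s) (m≤s : Graph.m G ≤ s) where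
  open Graph G
  open Triangles G
  open Peeling G
  open Semantics code SUPP G s
  open Building code G s n≤s m≤s
  open Traversal code G s n≤s m≤s

  record Counted (k : ℕ) (σ : State) : Set where
    field
      e≡    : reg σ rE ≡ k
      adj   : Static (mem σ) (allFin m)
      live  : Linked (mem σ NXL) (reg σ rLV) (allFin m)
      dead0 : ∀ i → mem σ DEAD i ≡ 0
      above : ∀ e → k ≤ toℕ e → mem σ SUPP (toℕ e) ≡ triangles G ⊤ e
      below : ∀ (e : Fin m) → toℕ e < k → mem σ SUPP (toℕ e) ≡ 0

  record CountingAt (e : Fin m) (u v : Fin n) (l : List (Fin m)) (V : View) : Set where
    open View V using (M; lv)
    field
      e≡      : View.e V ≡ toℕ e
      adj     : Static M (allFin m)
      live    : Linked (M NXL) lv (allFin m)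
      dead0   : ∀ i → M DEAD i ≡ 0
      above   : ∀ x → toℕ e < toℕ x → M SUPP (toℕ x) ≡ triangles G ⊤ x
      below   : ∀ (x : Fin m) → toℕ x < toℕ e → M SUPP (toℕ x) ≡ 0
      current : M SUPP (toℕ e) + length (filter (closes? u v) l) ≡ triangles G ⊤ e

  countBody-spec : ∀ {e u v f g w l σ} → Joins e u v → Joins f u w → Joins g v w →
    CountingAt e u v (f ∷ l) (view σ) → reg σ rF ≡ toℕ f → reg σ rG ≡ toℕ g →
    Wp countBody (λ σ′ → CountingAt e u v l (view σ′) × Keeps σ σ′ × time σ′ ≤ 4 + time σ) σ
  countBody-spec {e} {u} {v} {f} {g} {w} {l} {σ} _ f-uw g-vw inv _ _ = wp-block
    ( toℕ e , e≡ , edge<s e refl , S (toℕ e) , refl , suc (S (toℕ e)) , refl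
    , toℕ e , e≡ , edge<s e refl , suc (S (toℕ e)) , refl
    , record { e≡ = e≡ ; adj = adj ; live = live ; dead0 = dead0
             ; above = λ x e<x → trans (write-other {S} (<⇒≢ e<x ∘ sym)) (above x e<x)
             ; below = λ x x<e → trans (write-other {S} (<⇒≢ x<e)) (below x x<e)
             ; current = trans (cong (_+ length (filter (closes? u v) l)) (write-same {S} {toℕ e} refl))
                 (trans (sym (+-suc (S (toℕ e)) _))
                   (trans (cong (λ l → S (toℕ e) + length l) (sym (filter-accept (closes? u v) (w , f-uw , g , ∈⊤ , g-vw))))
                     current)) }
    , record { u≡ = refl ; v≡ = refl ; c≡ = refl ; ns≡ = refl ; nt≡ = refl }
    , ≤-refl )
    where
    open CountingAt inv
    S = mem σ SUPP

  countBody-skip : ∀ {e u v f w l V} → Joins f u w → ¬ Adj G ⊤ v w → CountingAt e u v (f ∷ l) V → CountingAt e u v l V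
  countBody-skip {e} {u} {v} {f} {w} {l} {V} f-uw none inv = record
    { CountingAt inv
    ; current = subst (λ l → View.M V SUPP (toℕ e) + length l ≡ triangles G ⊤ e)
        (filter-reject (closes? u v) λ { (w′ , f-uw′ , vw′) → none (subst (Adj G ⊤ v) (joins-other f-uw′ f-uw) vw′) })
        (CountingAt.current inv) }

  -- 20 is 15 for the traversal plus 5 for lowering `rE`, the test and the jump; 24 is 20 for a
  -- visit plus 4 for `countBody`.
  countCost : Fin m → ℕ
  countCost e = 20 + 24 * minDeg e

  countStep-spec : ∀ {σ} e → Counted (suc (toℕ e)) σ →
    Wp countStep (λ σ′ → Counted (toℕ e) σ′ × reg σ′ rX ≡ 1 ∸ toℕ e × suc (time σ′) ≤ countCost e + time σ) σ
  countStep-spec {σ} e inv = wp-seq (wp-block (toℕ e , cong (_∸ 1) e≡ ,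
    wp-seq (wp-mono finish
      (forTriangles-spec {e} countBody 4 (CountingAt e) countBody-spec countBody-skip refl adj start-inv))))
    where
    open Counted inv
    start-inv : ∀ {u v} → Joins e u v → CountingAt e u v (incidents u) (mkView (mem σ) (toℕ e) (reg σ rK) (reg σ rSP) (reg σ rLV))
    start-inv e-uv = record
      { e≡ = refl ; adj = adj ; live = live ; dead0 = dead0
      ; above = above
      ; below = λ x x<e → below x (<-trans x<e (n<1+n _))
      ; current = trans (cong (_+ _) (below e (n<1+n _))) (sym (triangles-closes e-uv)) }
    finish : ∀ {σ′} → (∃ λ u → ∃ λ v → Joins e u v × CountingAt e u v [] (view σ′))
        × time σ′ ≤ 2 + time σ + (15 + minDeg e * 24) →
      Wp (block (SET rX 1 ∷ SUB rX rX rE ∷ []))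
        (λ σ′ → Counted (toℕ e) σ′ × reg σ′ rX ≡ 1 ∸ toℕ e × suc (time σ′) ≤ countCost e + time σ) σ′
    finish ((u , v , _ , done) , t≤) = wp-block (_ , refl ,
      record { CountingAt done
             ; above = λ x e≤x → case x ≟ᶠ e of λ
                 { (yes refl) → trans (sym (+-identityʳ _)) (CountingAt.current done)
                 ; (no x≢e) → CountingAt.above done x (≤∧≢⇒< e≤x (x≢e ∘ sym ∘ toℕ-injective)) } }
      , cong (1 ∸_) (CountingAt.e≡ done)
      , ≤-trans (+-monoʳ-≤ 3 t≤) (≤-reflexive (rearrange (time σ) (minDeg e))))
      where
      rearrange : ∀ t d → 3 + (2 + t + (15 + d * 24)) ≡ 20 + 24 * d + t
      rearrange = solve-∀

  count-spec : ∀ {k T σ} → m ≡ suc k → BuildInv 0 σ → time σ ≤ T →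
    Wp count (λ σ′ → Counted 0 σ′ × time σ′ ≤ 1 + T + sum (map countCost (allFin m))) σ
  count-spec {k} {T} {σ} m≡ inv t≤ = wp-seq (wp-block
    (countdown Counted countCost (λ inv → record { Counted inv }) countStep-spec k (1 + T) (≤-reflexive (sym m≡))
      (record { e≡ = m≡ ; adj = adj ; live = live ; dead0 = dead0
              ; above = λ e k<e → ⊥-elim (<⇒≱ (toℕ<n e) (≤-trans (≤-reflexive m≡) k<e))
              ; below = λ e _ → supp0 (toℕ e) })
      (≤-trans (s≤s t≤) (m≤m+n (1 + T) _))))
    where open BuildInv inv

-- The peeling loop

decrementBody decrement removeBody scanStep scan drainStep drain level peel : Code

decrementBody =
  -- `rB` holds the excess of the count over the level, so `rY` becomes 1 exactly when the decrement
  -- reaches the level; only then is the edge pushed.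
  block ( SET rZ 1 ∷ SUB rA rA rZ ∷ STORE SUPP rH rA ∷ SUB rB rB rZ ∷ SET rY 1 ∷ SUB rY rY rB ∷ [] )
  ⨟ when rY (block ( STORE NXS rH rSP ∷ SET rY 1 ∷ ADD rSP rY rH ∷ [] ))

decrement = block ( LOAD rA SUPP rH ∷ SUB rB rA rK ∷ [] ) ⨟ when rB decrementBody

removeBody =
  -- `rX` is nonzero exactly when neither of the two edges has been removed.
  block ( LOAD rA DEAD rF ∷ LOAD rB DEAD rG ∷ ADD rA rA rB ∷ SET rX 1 ∷ SUB rX rX rA ∷ [] )
  ⨟ when rX (block ( SET rH 0 ∷ ADD rH rH rF ∷ [] ) ⨟ decrement
             ⨟ block ( SET rH 0 ∷ ADD rH rH rG ∷ [] ) ⨟ decrement)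

scanStep =
  -- `rX` is the excess and `rB` the deficit of the count, so `rY` is 1 exactly when the count
  -- equals the level. The next link is read first because keeping the edge overwrites its `NXL`.
  block ( SET rZ 1 ∷ SUB rF rC rZ ∷ LOAD rC NXL rF ∷ LOAD rA SUPP rF ∷ SUB rX rA rK ∷ SUB rB rK rA
        ∷ SUB rY rZ rX ∷ SUB rY rY rB ∷ [] )
  ⨟ when rX (block ( STORE NXL rF rLV ∷ ADD rLV rZ rF ∷ [] ))
  ⨟ when rY (block ( STORE NXS rF rSP ∷ ADD rSP rZ rF ∷ [] ))
  ⨟ visitLast

scan = block ( SET rC 0 ∷ ADD rC rC rLV ∷ SET rLV 0 ∷ [] ) ⨟ until rX scanStep

drainStep =
  block ( SET rZ 1 ∷ SUB rE rSP rZ ∷ LOAD rSP NXS rE ∷ STORE DEAD rE rZ ∷ [] )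
  ⨟ forTriangles removeBody
  ⨟ block ( SET rX 1 ∷ SUB rX rX rSP ∷ [] )

drain = when rSP (until rX drainStep)

level = scan ⨟ drain ⨟ block ( SET rZ 1 ∷ ADD rK rZ rK ∷ SET rX 1 ∷ SUB rX rX rLV ∷ [] )

peel = block ( SET rK 0 ∷ SET rSP 0 ∷ [] ) ⨟ until rX level

module Levels (code : List (Instr 16 8)) (G : Graph) (s : ℕ) (n≤s : Graph.n G ≤ s) (m≤s : Graph.m G ≤ s) where
  open Graph G
  open Triangles G
  open Peeling G
  open Semantics code SUPP G s
  open Building code G s n≤s m≤s
  open Traversal code G s n≤s m≤s

  support : Mem → Fin m → ℕ
  support M e = M SUPP (toℕ e)

  Flags : Mem → Subset m → Set
  Flags M A = ∀ e → (e ∈ A × M DEAD (toℕ e) ≡ 0) ⊎ (e ∉ A × M DEAD (toℕ e) ≡ 1)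

  -- The machine knows `A` only through `flags`, and both lists only through their links. As
  -- parameters they let the lemmas on `Stack` and `Level` apply directly.
  record Draining (k : ℕ) (live : List (Fin m)) (A : Subset m) (Pd : Fin m → Set) (stk : List (Fin m)) (V : View) : Set where
    open View V using (M; sp; lv)
    field
      k≡         : View.k V ≡ k
      adj        : Static M (allFin m)
      flags      : Flags M A
      live-links : Linked (M NXL) lv live
      cover      : ∀ {e} → k < support M e → e ∈ˡ live
      stk-links  : Linked (M NXS) sp stk
      stack      : Stack k A (support M) stk
      levelled   : Level k A Pd (support M)

  module _ {k : ℕ} {live : List (Fin m)} {A : Subset m} where

    KeepsFG : State → State → Set
    KeepsFG σ σ′ = Keeps σ σ′ × reg σ′ rF ≡ reg σ rF × reg σ′ rG ≡ reg σ rG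

    Decremented : (Fin m → Set) → ℕ → State → State → Set
    Decremented Pd T σ σ′ = (∃ λ stk → Draining k live A Pd stk (view σ′)) × KeepsFG σ σ′ × time σ′ ≤ T

    -- The longest of the three paths takes 13 instructions: the count was above the level and has
    -- now reached it, so the edge is pushed.
    decrement-spec : ∀ {Pd stk f σ} → Draining k live A Pd stk (view σ) → Pd f → f ∈ A → reg σ rH ≡ toℕ f →
      Wp decrement (Decremented (λ x → Pd x × x ≢ f) (13 + time σ) σ) σ
    decrement-spec {Pd} {stk} {f} {σ} inv pd f∈A h≡ = wp-seq (wp-block
      ( toℕ f , h≡ , edge<s f refl , S (toℕ f) , refl , S (toℕ f) ∸ k , cong (S (toℕ f) ∸_) k≡
      , wp-when
          (λ s∸k≡0 → (stk , record { Draining inv ; levelled = level-skip (m∸n≡0⇒m≤n s∸k≡0) levelled })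
                   , (record { u≡ = refl ; v≡ = refl ; c≡ = refl ; ns≡ = refl ; nt≡ = refl } , refl , refl)
                   , +-monoˡ-≤ (time σ) (s≤s (s≤s (s≤s z≤n))))
          (λ {j} s∸k≡ → wp-seq (wp-block
            ( S (toℕ f) ∸ 1 , refl , toℕ f , h≡ , edge<s f refl , S (toℕ f) ∸ 1 , refl
            , j , cong (_∸ 1) s∸k≡ , 1 ∸ j , refl
            , wp-when
                (λ y≡0 → (stk , record { k≡ = k≡ ; adj = adj ; flags = flags ; live-links = live-links
                            ; cover = cover′ s∸k≡ ; stk-links = stk-links
                            ; stack = stack-stay (same s∸k≡) (k<s s∸k≡) stack (stays s∸k≡ y≡0)
                            ; levelled = levelled′ s∸k≡ })
                  , (record { u≡ = refl ; v≡ = refl ; c≡ = refl ; ns≡ = refl ; nt≡ = refl } , refl , refl)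
                  , +-monoˡ-≤ (time σ) (m≤m+n 10 3))
                (λ {i} y≡ → wp-block
                  ( toℕ f , h≡ , edge<s f refl , reg σ rSP , refl , suc (toℕ f) , cong suc h≡
                  , ( f ∷ stk , record { k≡ = k≡ ; adj = adj ; flags = flags ; live-links = live-links
                        ; cover = cover′ s∸k≡
                        ; stk-links = linked-push (∉-stack (same s∸k≡) (k<s s∸k≡) stack) stk-links
                        ; stack = stack-push (same s∸k≡) (k<s s∸k≡) stack (drops s∸k≡ y≡) f∈A
                        ; levelled = levelled′ s∸k≡ })
                  , (record { u≡ = refl ; v≡ = refl ; c≡ = refl ; ns≡ = refl ; nt≡ = refl } , refl , refl)
                  , ≤-refl ))))) ))
      where
      open Draining inv
      S = mem σ SUPP
      S′ : ℕ → ℕ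
      S′ = write S (toℕ f) (S (toℕ f) ∸ 1)
      supp′ : Fin m → ℕ
      supp′ x = S′ (toℕ x)
      same′ : ∀ x → x ≢ f → supp′ x ≡ S (toℕ x)
      same′ x x≢f = write-other {S} (x≢f ∘ toℕ-injective)
      module _ {j : ℕ} (s∸k≡ : S (toℕ f) ∸ k ≡ suc j) where
        s≡ : S (toℕ f) ≡ suc j + k
        s≡ = trans (sym (m∸n+n≡m {S (toℕ f)} {k} (<⇒≤ (m∸n≢0⇒n<m {S (toℕ f)} λ eq → case trans (sym eq) s∸k≡ of λ ()))))
                   (cong (_+ k) s∸k≡)
        k<s : k < S (toℕ f)
        k<s = subst (k <_) (sym s≡) (s≤s (m≤n+m k j))
        supp′f≡ : supp′ f ≡ j + k
        supp′f≡ = trans (write-same {S} {toℕ f} refl) (cong (_∸ 1) s≡)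
        same : ∀ x → x ≢ f → supp′ x ≡ S (toℕ x)
        same = same′
        supp′≤ : ∀ x → supp′ x ≤ S (toℕ x)
        supp′≤ x with x ≟ᶠ f
        ... | yes refl = ≤-trans (≤-reflexive supp′f≡) (≤-trans (n≤1+n _) (≤-reflexive (sym s≡)))
        ... | no x≢f   = ≤-reflexive (same x x≢f)
        cover′ : ∀ {x} → k < supp′ x → x ∈ˡ live
        cover′ {x} k<s′ = cover (≤-trans k<s′ (supp′≤ x))
        levelled′ : Level k A (λ x → Pd x × x ≢ f) supp′
        levelled′ = level-decrement levelled pd k<s (trans s≡ (cong suc (sym supp′f≡))) same
        stays : 1 ∸ j ≡ 0 → k < supp′ f
        stays eq = subst (k <_) (sym supp′f≡) (+-monoˡ-≤ k (m∸n≡0⇒m≤n eq))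
        drops : ∀ {i} → 1 ∸ j ≡ suc i → supp′ f ≤ k
        drops eq = ≤-reflexive (trans supp′f≡ (cong (_+ k) (j≡0 j eq)))
          where
          j≡0 : ∀ {i} j → 1 ∸ j ≡ suc i → j ≡ 0
          j≡0 zero    _  = refl
          j≡0 (suc j) eq = case trans (sym (0∸n≡0 j)) eq of λ ()

    RemovingAt : Fin n → Fin n → List (Fin m) → View → Set
    RemovingAt u v l V = Unique l × ∃ λ stk → Draining k live A (Pending A u v l) stk V

    pending-skip : ∀ {u v f l stk V} →
      (∀ {g w} → Joins f u w → Joins g v w → f ∈ A → g ∈ A → ⊥) →
      Draining k live A (Pending A u v (f ∷ l)) stk V → Draining k live A (Pending A u v l) stk V
    pending-skip none D = record { Draining D ; levelled = level-cong
      (λ { (_ , here refl , _ , _ , f-uw , g-vw , f∈ , g∈ , _) → ⊥-elim (none f-uw g-vw f∈ g∈)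
         ; (f , there f∈l , r) → f , f∈l , r })
      (λ { (f , f∈l , r) → f , there f∈l , r }) (Draining.levelled D) }

    -- Different triangles over the base from `u` to `v` share no other edge. So treating `f` and
    -- `g` takes exactly these two off the pending set and leaves what is pending through `l`. 36 is
    -- 6 for the test plus twice 15 for a copy and a `decrement`.
    removeBody-spec : ∀ {u v f g w l σ} → u ≢ v → Joins f u w → Joins g v w → RemovingAt u v (f ∷ l) (view σ) →
      reg σ rF ≡ toℕ f → reg σ rG ≡ toℕ g →
      Wp removeBody (λ σ′ → RemovingAt u v l (view σ′) × Keeps σ σ′ × time σ′ ≤ 36 + time σ) σ
    removeBody-spec {u} {v} {f} {g} {w} {l} {σ} u≢v f-uw g-vw (f∉l ∷ uniq , stk , inv) f≡ g≡ =
      go (Draining.flags inv f) (Draining.flags inv g)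
      where
      D = mem σ DEAD
      Q : State → Set
      Q σ′ = RemovingAt u v l (view σ′) × Keeps σ σ′ × time σ′ ≤ 36 + time σ
      keeps : ∀ {σ₁ σ₂ σ₃} → Keeps σ₁ σ₂ → Keeps σ₂ σ₃ → Keeps σ₁ σ₃
      keeps K L = record { u≡ = trans L.u≡ K.u≡ ; v≡ = trans L.v≡ K.v≡ ; c≡ = trans L.c≡ K.c≡
                         ; ns≡ = trans L.ns≡ K.ns≡ ; nt≡ = trans L.nt≡ K.nt≡ }
        where
        module K = Keeps K
        module L = Keeps L
      skip : ∀ {a b} → D (toℕ f) ≡ a → D (toℕ g) ≡ b → 1 ∸ (a + b) ≡ 0 → (f ∈ A → g ∈ A → ⊥) → Wp removeBody Q σ
      skip {a} {b} Df Dg none dead = wp-seq (wp-block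
        ( toℕ f , f≡ , edge<s f refl , a , Df , toℕ g , g≡ , edge<s g refl , b , Dg , a + b , refl , 0 , none
        , wp-when
            (λ _ → (uniq , stk , pending-skip
                (λ { f-uw′ g-vw′ f∈ g∈ → dead f∈ (subst (_∈ A)
                     (simple g-vw′ (subst (Joins g v) (joins-other f-uw f-uw′) g-vw)) g∈) })
                (record { Draining inv }))
              , record { u≡ = refl ; v≡ = refl ; c≡ = refl ; ns≡ = refl ; nt≡ = refl }
              , +-monoˡ-≤ (time σ) (m≤m+n 6 30))
            (λ ()) ))
      go : (f ∈ A × D (toℕ f) ≡ 0) ⊎ (f ∉ A × D (toℕ f) ≡ 1) →
           (g ∈ A × D (toℕ g) ≡ 0) ⊎ (g ∉ A × D (toℕ g) ≡ 1) → Wp removeBody Q σ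
      go (inj₂ (f∉ , Df)) (inj₁ (_ , Dg)) = skip Df Dg refl (λ f∈ _ → f∉ f∈)
      go (inj₂ (f∉ , Df)) (inj₂ (_ , Dg)) = skip Df Dg refl (λ f∈ _ → f∉ f∈)
      go (inj₁ (_ , Df)) (inj₂ (g∉ , Dg)) = skip Df Dg refl (λ _ g∈ → g∉ g∈)
      go (inj₁ (f∈ , Df)) (inj₁ (g∈ , Dg)) = wp-seq (wp-block
        ( toℕ f , f≡ , edge<s f refl , 0 , Df , toℕ g , g≡ , edge<s g refl , 0 , Dg , 0 , refl , 1 , refl
        , wp-when (λ ()) (λ _ → wp-seq (wp-block (toℕ f , f≡ ,
            wp-seq (wp-mono
              (λ { {σ₁} ((stk₁ , inv₁) , (K₁ , _ , g≡₁) , t₁) → wp-seq (wp-block (toℕ g , trans g≡₁ g≡ ,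
                  wp-mono
                    (λ { {σ₂} ((stk₂ , inv₂) , (K₂ , _) , t₂) →
                       (uniq , stk₂ , record { Draining inv₂ ; levelled = level-cong drop-fg keep-fg (Draining.levelled inv₂) })
                       , keeps {σ} {σ₁} {σ₂} (record { Keeps K₁ }) (record { Keeps K₂ })
                       , ≤-trans t₂ (+-monoʳ-≤ 15 t₁) })
                    (decrement-spec {f = g} (record { Draining inv₁ }) (pend-g , g≢f) g∈ refl))) })
              (decrement-spec {f = f} (record { Draining inv }) pend-f f∈ refl))))) ))
        where
        pend-f : Pending A u v (f ∷ l) f
        pend-f = f , here refl , g , w , f-uw , g-vw , f∈ , g∈ , inj₁ refl
        pend-g : Pending A u v (f ∷ l) g
        pend-g = f , here refl , g , w , f-uw , g-vw , f∈ , g∈ , inj₂ refl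
        g≢f : g ≢ f
        g≢f refl = u≢v (joins-other (joins-sym f-uw) (joins-sym g-vw))
        drop-fg : ∀ {x} → (Pending A u v (f ∷ l) x × x ≢ f) × x ≢ g → Pending A u v l x
        drop-fg ((( _ , here refl , _ , _ , f-uw′ , g-vw′ , _ , _ , inj₁ x≡f) , x≢f) , x≢g) = ⊥-elim (x≢f x≡f)
        drop-fg ((( _ , here refl , g′ , w′ , f-uw′ , g-vw′ , _ , _ , inj₂ refl) , x≢f) , x≢g) =
          ⊥-elim (x≢g (simple g-vw′ (subst (Joins g v) (joins-other f-uw f-uw′) g-vw)))
        drop-fg (((f′ , there f′∈ , r) , _) , _) = f′ , f′∈ , r
        keep-fg : ∀ {x} → Pending A u v l x → (Pending A u v (f ∷ l) x × x ≢ f) × x ≢ g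
        keep-fg {x} (f′ , f′∈ , g′ , w′ , f-uw′ , g-vw′ , f′∈A , g′∈A , x≡) =
          ((f′ , there f′∈ , g′ , w′ , f-uw′ , g-vw′ , f′∈A , g′∈A , x≡) , x≢f x≡) , x≢g x≡
          where
          f≢f′ : f ≢ f′
          f≢f′ = All.lookup f∉l f′∈
          x≢f : x ≡ f′ ⊎ x ≡ g′ → x ≢ f
          x≢f (inj₁ refl) refl = f≢f′ refl
          x≢f (inj₂ refl) refl with joins-same f-uw g-vw′
          ... | inj₁ (u≡v , _) = u≢v u≡v
          ... | inj₂ (u≡w′ , _) = joins-≢ f-uw′ u≡w′
          x≢g : x ≡ f′ ⊎ x ≡ g′ → x ≢ g
          x≢g (inj₁ refl) refl with joins-same g-vw f-uw′
          ... | inj₁ (v≡u , _) = u≢v (sym v≡u)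
          ... | inj₂ (v≡w′ , _) = joins-≢ g-vw′ v≡w′
          x≢g (inj₂ refl) refl = f≢f′ (simple f-uw (subst (Joins f′ u) (joins-other g-vw′ g-vw) f-uw′))

-- Amortised time of the peeling loop

module Decomposition (code : List (Instr 16 8)) (G : Graph) (s : ℕ) (n≤s : Graph.n G ≤ s) (m≤s : Graph.m G ≤ s) where
  open Graph G
  open Triangles G
  open Peeling G
  open Semantics code SUPP G s
  open Building code G s n≤s m≤s
  open Traversal code G s n≤s m≤s
  open Counting code G s n≤s m≤s
  open Levels code G s n≤s m≤s

  -- 22 is 15 for the traversal plus 7 for popping and marking the edge, the test and the jump; 56
  -- is 20 for a visit plus 36 for `removeBody`.
  removeCost : Fin m → ℕ
  removeCost e = 22 + 56 * minDeg e

  weight : Subset m → Fin m → ℕ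
  weight A e = if does (e ∈? A) then removeCost e else 0

  -- The time reserved for the removal of the edges of A.
  potential : Subset m → ℕ
  potential A = sum (map (weight A) (allFin m))

  weight-∈ : ∀ {A e} → e ∈ A → weight A e ≡ removeCost e
  weight-∈ {A} {e} e∈ = cong (λ b → if b then removeCost e else 0) (dec-true (e ∈? A) e∈)

  weight-∉ : ∀ {A e} → e ∉ A → weight A e ≡ 0
  weight-∉ {A} {e} e∉ = cong (λ b → if b then removeCost e else 0) (dec-false (e ∈? A) e∉)

  weight≤ : ∀ A e → weight A e ≤ removeCost e
  weight≤ A e with does (e ∈? A)
  ... | true  = ≤-refl
  ... | false = z≤n

  weight-mono : ∀ {A A′} → A′ ⊆ A → ∀ x → weight A′ x ≤ weight A x
  weight-mono {A} {A′} A′⊆A x = cases (x ∈? A′)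
    where
    cases : Dec (x ∈ A′) → weight A′ x ≤ weight A x
    cases (yes x∈) = ≤-reflexive (trans (weight-∈ x∈) (sym (weight-∈ (A′⊆A x∈))))
    cases (no  x∉) = ≤-trans (≤-reflexive (weight-∉ x∉)) z≤n

  potential-remove : ∀ {A A′ e} → e ∈ A → A′ ⊆ A → e ∉ A′ → removeCost e + potential A′ ≤ potential A
  potential-remove {A} {A′} {e} e∈A A′⊆A e∉A′ = sum-mono-slack (∈-allFin e) (λ {x} _ → weight-mono A′⊆A x)
    (≤-reflexive (trans (cong (removeCost e +_) (weight-∉ e∉A′)) (trans (+-identityʳ _) (sym (weight-∈ e∈A)))))

  Drained : ℕ → List (Fin m) → ℕ → State → Set
  Drained k live T σ = ∃ λ A → Draining k live A None [] (view σ) × time σ + potential A ≤ T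

  record DrainStepped (k : ℕ) (live : List (Fin m)) (P T : ℕ) (σ : State) : Set where
    field
      A         : Subset m
      stk       : List (Fin m)
      draining  : Draining k live A None stk (view σ)
      x≡        : reg σ rX ≡ 1 ∸ reg σ rSP
      progress  : potential A < P
      time≤     : suc (time σ) + potential A ≤ T

  drainStep-spec : ∀ {k live A e stk σ} → Draining k live A None (e ∷ stk) (view σ) →
    Wp drainStep (DrainStepped k live (potential A) (time σ + potential A)) σ
  drainStep-spec {k} {live} {A} {e} {stk} {σ} inv = wp-seq (wp-block
    ( toℕ e , cong (_∸ 1) (proj₁ stk-links)
    , toℕ e , refl , edge<s e refl , mem σ NXS (toℕ e) , refl
    , toℕ e , refl , edge<s e refl , 1 , refl
    , wp-seq (wp-mono finish (forTriangles-spec {e} removeBody 36 (RemovingAt {k} {live} {A′})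
        (λ e-uv f-uw g-vw → removeBody-spec (joins-≢ e-uv) f-uw g-vw)
        skip refl adj (λ e-uv → incidents-unique _ , stk , start-removing e-uv))) ))
    where
    open Draining inv
    keep? : ∀ x → Dec (x ∈ A × x ≢ e)
    keep? x = (x ∈? A) ×-dec ¬? (x ≟ᶠ e)
    A′ : Subset m
    A′ = subset keep?
    A′⊆A : ∀ {x} → x ∈ A′ → x ∈ A × x ≢ e
    A′⊆A = ∈-subset⁻ keep?
    A⊆A′ : ∀ {x} → x ∈ A → x ≢ e → x ∈ A′
    A⊆A′ x∈ x≢e = ∈-subset⁺ keep? (x∈ , x≢e)
    e∈A : e ∈ A
    e∈A = proj₂ (Stack.sound stack (here refl))
    D = mem σ DEAD
    V′ : View
    V′ = mkView (updateAt (mem σ) DEAD (λ row → write row (toℕ e) 1)) (toℕ e) (reg σ rK) (mem σ NXS (toℕ e)) (reg σ rLV)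
    flags′ : Flags (View.M V′) A′
    flags′ x = cases (x ≟ᶠ e) (flags x)
      where
      cases : Dec (x ≡ e) → (x ∈ A × D (toℕ x) ≡ 0) ⊎ (x ∉ A × D (toℕ x) ≡ 1) →
        (x ∈ A′ × write D (toℕ e) 1 (toℕ x) ≡ 0) ⊎ (x ∉ A′ × write D (toℕ e) 1 (toℕ x) ≡ 1)
      cases (yes refl) _ = inj₂ ((λ x∈ → proj₂ (A′⊆A x∈) refl) , write-same {D} {toℕ x} refl)
      cases (no x≢e) (inj₁ (x∈ , d≡)) = inj₁ (A⊆A′ x∈ x≢e , trans (write-other {D} (x≢e ∘ toℕ-injective)) d≡)
      cases (no x≢e) (inj₂ (x∉ , d≡)) = inj₂ ((λ x∈ → x∉ (proj₁ (A′⊆A x∈))) , trans (write-other {D} (x≢e ∘ toℕ-injective)) d≡)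
    start-removing : ∀ {u v} → Joins e u v → Draining k live A′ (Pending A′ u v (incidents u)) stk V′
    start-removing e-uv = record
      { k≡ = k≡ ; adj = adj ; flags = flags′ ; live-links = live-links ; cover = cover
      ; stk-links = proj₂ stk-links
      ; stack = stack-pop A′⊆A A⊆A′ stack
      ; levelled = level-remove e-uv e∈A A′⊆A A⊆A′ (proj₁ (Stack.sound stack (here refl))) levelled }
    skip : ∀ {u v f w l V} → Joins f u w → ¬ Adj G ⊤ v w → RemovingAt {k} {live} {A′} u v (f ∷ l) V → RemovingAt {k} {live} {A′} u v l V
    skip {v = v} f-uw none (_ ∷ uniq , stk′ , D) = uniq , stk′ , pending-skip
      (λ {g} f-uw′ g-vw′ _ _ → none (g , ∈⊤ , subst (Joins g v) (joins-other f-uw′ f-uw) g-vw′)) D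
    bound : removeCost e + potential A′ ≤ potential A
    bound = potential-remove e∈A (proj₁ ∘ A′⊆A) (λ e∈ → proj₂ (A′⊆A e∈) refl)
    finish : ∀ {σ′} → (∃ λ u → ∃ λ v → Joins e u v × RemovingAt {k} {live} {A′} u v [] (view σ′))
        × time σ′ ≤ 4 + time σ + (15 + minDeg e * 56) →
      Wp (block (SET rX 1 ∷ SUB rX rX rSP ∷ [])) (DrainStepped k live (potential A) (time σ + potential A)) σ′
    finish {σ′} ((u , v , _ , _ , stk′ , D) , t≤) = wp-block (1 ∸ reg σ′ rSP , refl , record
      { A = A′ ; stk = stk′
      ; draining = record { Draining D ; levelled = level-cong (λ { (_ , () , _) }) (λ ()) (Draining.levelled D) }
      ; x≡ = refl
      ; progress = ≤-trans (+-monoˡ-≤ (potential A′) {1} {removeCost e} (s≤s z≤n)) bound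
      ; time≤ = begin
          3 + time σ′ + potential A′                                 ≤⟨ +-monoˡ-≤ (potential A′) (+-monoʳ-≤ 3 t≤) ⟩
          3 + (4 + time σ + (15 + minDeg e * 56)) + potential A′     ≡⟨ rearrange (time σ) (minDeg e) (potential A′) ⟩
          time σ + (removeCost e + potential A′)                     ≤⟨ +-monoʳ-≤ (time σ) bound ⟩
          time σ + potential A                                       ∎ })
      where
      open ≤-Reasoning
      rearrange : ∀ t d p → 3 + (4 + t + (15 + d * 56)) + p ≡ t + (22 + 56 * d + p)
      rearrange = solve-∀

  -- The potential serves twice: it bounds the time, and its strict decrease at every removal bounds
  -- the number of rounds.
  drain-loop : ∀ fuel {k live A e stk σ T} → potential A < fuel → Draining k live A None (e ∷ stk) (view σ) →
    time σ + potential A ≤ T → Wp (until rX drainStep) (Drained k live T) σ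
  drain-loop (suc fuel) {k} {live} {A} {e} {stk} {σ} {T} (s≤s p<) inv t≤ =
    wp-until (wp-mono next (drainStep-spec (record { Draining inv })))
    where
    next : ∀ {σ′} → DrainStepped k live (potential A) (time σ + potential A) σ′ →
      (reg σ′ rX ≡ 0 × Wp (until rX drainStep) (Drained k live T) (tick σ′)) ⊎ (reg σ′ rX ≢ 0 × Drained k live T (tick σ′))
    next {σ′} S with DrainStepped.stk S | DrainStepped.draining S
    ... | [] | D = inj₂
      ( (λ x≡0 → case trans (sym (trans (DrainStepped.x≡ S) (cong (1 ∸_) (Draining.stk-links D)))) x≡0 of λ ())
      , DrainStepped.A S , record { Draining D } , ≤-trans (DrainStepped.time≤ S) t≤ )
    ... | e′ ∷ stk′ | D = inj₁
      ( trans (DrainStepped.x≡ S) (trans (cong (1 ∸_) (proj₁ (Draining.stk-links D))) (0∸n≡0 (toℕ e′)))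
      , drain-loop fuel (≤-trans (DrainStepped.progress S) p<) (record { Draining D }) (≤-trans (DrainStepped.time≤ S) t≤) )

  drain-spec : ∀ {k live A stk σ} → Draining k live A None stk (view σ) →
    Wp drain (Drained k live (suc (time σ) + potential A)) σ
  drain-spec {k} {live} {A} {[]} {σ} inv = wp-when
    (λ _ → A , record { Draining inv } , ≤-refl)
    (λ neq → case trans (sym (Draining.stk-links inv)) neq of λ ())
  drain-spec {k} {live} {A} {e ∷ stk} {σ} inv = wp-when
    (λ eq → case trans (sym (proj₁ (Draining.stk-links inv))) eq of λ ())
    (λ _ → drain-loop (suc (potential A)) ≤-refl (record { Draining inv }) ≤-refl)

  -- The time reserved for scanning the edges of l at the levels from k on: the edge
  -- e is scanned at the levels up to 1 + minDeg e at most.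
  scanPotential : ℕ → List (Fin m) → ℕ
  scanPotential k l = sum (map (λ e → 26 * (2 + minDeg e ∸ k)) l)

  record Scanning (k : ℕ) (A : Subset m) (todo kept stk : List (Fin m)) (σ : State) : Set where
    field
      k≡         : reg σ rK ≡ k
      adj        : Static (mem σ) (allFin m)
      flags      : Flags (mem σ) A
      start-inv  : LevelStart k A (support (mem σ))
      scanned    : Scan k (support (mem σ)) todo kept stk
      todo-links : Linked (mem σ NXL) (reg σ rC) todo
      kept-links : Linked (mem σ NXL) (reg σ rLV) kept
      stk-links  : Linked (mem σ NXS) (reg σ rSP) stk
      bound      : ∀ {e} → e ∈ˡ todo → k ≤ suc (minDeg e)

  Scanned : ℕ → Subset m → List (Fin m) → ℕ → State → Set
  Scanned k A todo T σ = ∃ λ kept → ∃ λ stk → Scanning k A todo kept stk σ × time σ + scanPotential (suc k) kept ≤ T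

  private
    ∸-suc : ∀ {a b} → b < a → ∃ λ j → a ∸ b ≡ suc j
    ∸-suc {suc a} {zero}  _       = a , refl
    ∸-suc {suc a} {suc b} (s≤s p) = ∸-suc p

  -- If the edge is kept, the summand with `1 + minDeg f` becomes its share of the potential of the
  -- next level; if it is pushed or dropped, the share is given up. The constant 16 covers all three
  -- branches.
  scanStep-spec : ∀ {k A f todo kept stk σ} → Scanning k A (f ∷ todo) kept stk σ →
    Wp scanStep (λ σ′ → Scanned k A todo (16 + time σ + (26 * (1 + minDeg f ∸ k) + scanPotential (suc k) kept)) σ′
                      × reg σ′ rX ≡ 1 ∸ reg σ′ rC) σ
  scanStep-spec {k} {A} {f} {todo} {kept} {stk} {σ} inv with <-cmp k (mem σ SUPP (toℕ f))
  ... | tri< k<s _ _ with ∸-suc k<s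
  ...   | j , eq = wp-seq (wp-block
    ( toℕ f , cong (_∸ 1) (proj₁ todo-links)
    , toℕ f , refl , edge<s f refl , mem σ NXL (toℕ f) , refl , toℕ f , refl , edge<s f refl , mem σ SUPP (toℕ f) , refl
    , suc j , trans (cong (mem σ SUPP (toℕ f) ∸_) k≡) eq
    , 0 , trans (cong (_∸ mem σ SUPP (toℕ f)) k≡) (m≤n⇒m∸n≡0 (<⇒≤ k<s))
    , 0 , 0∸n≡0 j , 0 , refl
    , wp-seq (wp-when (λ ()) (λ _ → wp-block
        ( toℕ f , refl , edge<s f refl , reg σ rLV , refl , suc (toℕ f) , refl
        , wp-seq (wp-when (λ _ → wp-block ( _ , refl
            , ( f ∷ kept , stk , record
                { k≡ = k≡ ; adj = adj ; flags = flags ; start-inv = start-inv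
                ; scanned = scan-keep scanned k<s
                ; todo-links = linked-frame (λ g∈ g≡f → f∉todo (subst (_∈ˡ todo) (toℕ-injective g≡f) g∈)) (proj₂ todo-links)
                ; kept-links = linked-push f∉kept kept-links
                ; stk-links = stk-links
                ; bound = bound ∘ there }
              , ≤-trans (+-monoˡ-≤ (26 * (1 + minDeg f ∸ k) + scanPotential (suc k) kept) (+-monoˡ-≤ (time σ) (n≤1+n 14)))
                  (n≤1+n _) )
            , refl )) (λ ())) ))) ))
    where
    open Scanning inv
    f∉todo : f ∉ˡ todo
    f∉todo = Unique[x∷xs]⇒x∉xs (Scan.todo-unique scanned)
    f∉kept : f ∉ˡ kept
    f∉kept = proj₁ (Scan.fresh scanned (here refl))
  scanStep-spec {k} {A} {f} {todo} {kept} {stk} {σ} inv | tri≈ _ k≡s _ = wp-seq (wp-block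
    ( toℕ f , cong (_∸ 1) (proj₁ todo-links)
    , toℕ f , refl , edge<s f refl , mem σ NXL (toℕ f) , refl , toℕ f , refl , edge<s f refl , mem σ SUPP (toℕ f) , refl
    , 0 , trans (cong (mem σ SUPP (toℕ f) ∸_) (trans k≡ k≡s)) (n∸n≡0 (mem σ SUPP (toℕ f)))
    , 0 , trans (cong (_∸ mem σ SUPP (toℕ f)) (trans k≡ k≡s)) (n∸n≡0 (mem σ SUPP (toℕ f)))
    , 1 , refl , 1 , refl
    , wp-seq (wp-when (λ _ → wp-seq (wp-when (λ ()) (λ _ → wp-block
        ( toℕ f , refl , edge<s f refl , reg σ rSP , refl , suc (toℕ f) , refl
        , wp-block ( _ , refl
          , ( kept , f ∷ stk , record
              { k≡ = k≡ ; adj = adj ; flags = flags ; start-inv = start-inv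
              ; scanned = scan-push scanned (sym k≡s)
              ; todo-links = proj₂ todo-links
              ; kept-links = kept-links
              ; stk-links = linked-push (proj₂ (Scan.fresh scanned (here refl))) stk-links
              ; bound = bound ∘ there }
            , +-mono-≤ (+-monoˡ-≤ (time σ) (m≤n+m 14 2)) (m≤n+m (scanPotential (suc k) kept) _) )
          , refl ) )))) (λ ())) ))
    where open Scanning inv
  scanStep-spec {k} {A} {f} {todo} {kept} {stk} {σ} inv | tri> _ _ s<k with ∸-suc s<k
  ...   | j , eq = wp-seq (wp-block
    ( toℕ f , cong (_∸ 1) (proj₁ todo-links)
    , toℕ f , refl , edge<s f refl , mem σ NXL (toℕ f) , refl , toℕ f , refl , edge<s f refl , mem σ SUPP (toℕ f) , refl
    , 0 , trans (cong (mem σ SUPP (toℕ f) ∸_) k≡) (m≤n⇒m∸n≡0 (<⇒≤ s<k))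
    , suc j , trans (cong (_∸ mem σ SUPP (toℕ f)) k≡) eq
    , 1 , refl , 0 , 0∸n≡0 j
    , wp-seq (wp-when (λ _ → wp-seq (wp-when (λ _ → wp-block ( _ , refl
          , ( kept , stk , record
              { k≡ = k≡ ; adj = adj ; flags = flags ; start-inv = start-inv
              ; scanned = scan-drop scanned s<k
              ; todo-links = proj₂ todo-links
              ; kept-links = kept-links
              ; stk-links = stk-links
              ; bound = bound ∘ there }
            , +-mono-≤ (+-monoˡ-≤ (time σ) (m≤n+m 12 4)) (m≤n+m (scanPotential (suc k) kept) _) )
          , refl )) (λ ()))) (λ ())) ))
    where open Scanning inv

  -- Of the 26 per edge, 16 pay for the step and 1 for its jump. The other 9 of the last edge pay
  -- for the rest of the level, 3 instructions before the scan and 6 after it; hence `9 + T`.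
  scan-loop : ∀ {k A} f todo {kept stk σ} T → Scanning k A (f ∷ todo) kept stk σ →
    time σ + (scanPotential (suc k) kept + scanPotential k (f ∷ todo)) ≤ 9 + T →
    Wp (until rX scanStep) (Scanned k A [] T) σ
  scan-loop {k} {A} f todo {kept} {stk} {σ} T inv t≤ = wp-until (wp-mono (next todo t≤) (scanStep-spec inv))
    where
    open ≤-Reasoning
    w = 26 * (1 + minDeg f ∸ k)
    P = scanPotential (suc k) kept
    -- `bound` keeps the subtraction from being truncated, so the next level needs exactly 26 less.
    w-suc : 26 * (2 + minDeg f ∸ k) ≡ 26 + w
    w-suc = trans (cong (26 *_) (+-∸-assoc 1 {1 + minDeg f} {k} (Scanning.bound inv (here refl)))) (*-suc 26 (1 + minDeg f ∸ k))
    next : ∀ todo {σ′} → time σ + (P + scanPotential k (f ∷ todo)) ≤ 9 + T →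
      Scanned k A todo (16 + time σ + (w + P)) σ′ × reg σ′ rX ≡ 1 ∸ reg σ′ rC →
      (reg σ′ rX ≡ 0 × Wp (until rX scanStep) (Scanned k A [] T) (tick σ′))
      ⊎ (reg σ′ rX ≢ 0 × Scanned k A [] T (tick σ′))
    next [] {σ′} t≤ ((kept′ , stk′ , inv′ , t≤′) , x≡) = inj₂
      ( (λ x≡0 → case trans (sym (trans x≡ (cong (1 ∸_) (Scanning.todo-links inv′)))) x≡0 of λ ())
      , kept′ , stk′ , record { Scanning inv′ }
      , +-cancelˡ-≤ 9 _ _ (begin
          9 + (suc (time σ′) + scanPotential (suc k) kept′) ≤⟨ +-monoʳ-≤ 10 t≤′ ⟩
          10 + (16 + time σ + (w + P))                      ≡⟨ rearrange (time σ) w P ⟩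
          time σ + (P + (26 + w + 0))                       ≡⟨ cong (λ x → time σ + (P + (x + 0))) w-suc ⟨
          time σ + (P + scanPotential k (f ∷ []))           ≤⟨ t≤ ⟩
          9 + T                                             ∎) )
      where
      rearrange : ∀ t w p → 10 + (16 + t + (w + p)) ≡ t + (p + (26 + w + 0))
      rearrange = solve-∀
    next (f′ ∷ todo′) {σ′} t≤ ((kept′ , stk′ , inv′ , t≤′) , x≡) = inj₁
      ( trans x≡ (trans (cong (1 ∸_) (proj₁ (Scanning.todo-links inv′))) (0∸n≡0 (toℕ f′)))
      , scan-loop f′ todo′ T (record { Scanning inv′ }) (begin
          suc (time σ′) + (scanPotential (suc k) kept′ + R)   ≡⟨ cong suc (+-assoc (time σ′) _ R) ⟨
          suc (time σ′ + scanPotential (suc k) kept′ + R)     ≤⟨ s≤s (+-monoˡ-≤ R t≤′) ⟩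
          suc (16 + time σ + (w + P) + R)                     ≤⟨ m≤m+n _ 9 ⟩
          suc (16 + time σ + (w + P) + R) + 9                 ≡⟨ rearrange (time σ) w P R ⟩
          time σ + (P + (26 + w + R))                         ≡⟨ cong (λ x → time σ + (P + (x + R))) w-suc ⟨
          time σ + (P + scanPotential k (f ∷ f′ ∷ todo′))     ≤⟨ t≤ ⟩
          9 + T                                               ∎) )
      where
      R = scanPotential k (f′ ∷ todo′)
      rearrange : ∀ t w p r → suc (16 + t + (w + p) + r) + 9 ≡ t + (p + (26 + w + r))
      rearrange = solve-∀

  record AtLevel (k : ℕ) (A : Subset m) (live : List (Fin m)) (σ : State) : Set where
    field
      k≡         : reg σ rK ≡ k
      sp≡        : reg σ rSP ≡ 0
      adj        : Static (mem σ) (allFin m)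
      flags      : Flags (mem σ) A
      start-inv  : LevelStart k A (support (mem σ))
      live-links : Linked (mem σ NXL) (reg σ rLV) live
      unique     : Unique live
      cover      : ∀ {e} → k ≤ support (mem σ) e → e ∈ˡ live
      bound      : ∀ {e} → e ∈ˡ live → k ≤ suc (minDeg e)

  record Levelled (k T : ℕ) (σ : State) : Set where
    field
      A     : Subset m
      live  : List (Fin m)
      inv   : AtLevel (suc k) A live σ
      x≡    : reg σ rX ≡ 1 ∸ reg σ rLV
      time≤ : suc (time σ) + (scanPotential (suc k) live + potential A) ≤ T

  level-spec : ∀ {k A f l σ} → AtLevel k A (f ∷ l) σ →
    Wp level (Levelled k (time σ + (scanPotential k (f ∷ l) + potential A))) σ
  level-spec {k} {A} {f} {l} {σ} inv = wp-seq (wp-seq (wp-block ( reg σ rLV , refl ,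
    wp-mono drain-phase (scan-loop f l (3 + time σ + scanPotential k (f ∷ l) ∸ 9)
      (record { k≡ = k≡ ; adj = adj ; flags = flags ; start-inv = start-inv
              ; scanned = scan-start unique cover
              ; todo-links = live-links ; kept-links = refl ; stk-links = sp≡ ; bound = bound })
      (≤-reflexive (sym (m+[n∸m]≡n nine≤)))) )))
    where
    open AtLevel inv
    open ≤-Reasoning
    S = scanPotential k (f ∷ l)
    nine≤ : 9 ≤ 3 + time σ + S
    nine≤ = begin
      9                                            ≤⟨ m≤m+n 9 17 ⟩
      26                                           ≤⟨ m≤m+n 26 _ ⟩
      26 + 26 * (1 + minDeg f ∸ k)                 ≡⟨ *-suc 26 (1 + minDeg f ∸ k) ⟨
      26 * suc (1 + minDeg f ∸ k)                  ≡⟨ cong (26 *_) (+-∸-assoc 1 {1 + minDeg f} {k} (bound (here refl))) ⟨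
      26 * (2 + minDeg f ∸ k)                      ≤⟨ m≤m+n _ _ ⟩
      S                                            ≤⟨ m≤n+m S (3 + time σ) ⟩
      3 + time σ + S                               ∎
    drain-phase : ∀ {σ₁} → Scanned k A [] (3 + time σ + S ∸ 9) σ₁ →
      Wp (drain ⨟ block ( SET rZ 1 ∷ ADD rK rZ rK ∷ SET rX 1 ∷ SUB rX rX rLV ∷ [] ))
        (Levelled k (time σ + (S + potential A))) σ₁
    drain-phase {σ₁} (kept , stk , scanning , t≤) = wp-seq (wp-mono finish (drain-spec (record
      { k≡ = Scanning.k≡ scanning ; adj = Scanning.adj scanning ; flags = Scanning.flags scanning
      ; live-links = Scanning.kept-links scanning
      ; cover = scan-kept scanned
      ; stk-links = Scanning.stk-links scanning
      ; stack = scan-stack (Scanning.start-inv scanning) scanned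
      ; levelled = start⇒level (Scanning.start-inv scanning) })))
      where
      scanned : Scan k (support (mem σ₁)) [] kept stk
      scanned = Scanning.scanned scanning
      finish : ∀ {σ₂} → Drained k kept (suc (time σ₁) + potential A) σ₂ →
        Wp (block ( SET rZ 1 ∷ ADD rK rZ rK ∷ SET rX 1 ∷ SUB rX rX rLV ∷ [] ))
          (Levelled k (time σ + (S + potential A))) σ₂
      finish {σ₂} (A′ , D , t≤′) = wp-block (suc k , cong suc (Draining.k≡ D) , 1 ∸ reg σ₂ rLV , refl , record
        { A = A′ ; live = kept
        ; inv = record
          { k≡ = refl ; sp≡ = Draining.stk-links D ; adj = Draining.adj D ; flags = Draining.flags D
          -- The stack is complete and empty, so no remaining edge has a count of at most `k`.
          ; start-inv = level⇒start (Draining.levelled D) (λ {e} e∈A → ≰⇒> λ s≤k →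
              case Stack.complete (Draining.stack D) s≤k e∈A of λ ())
          ; live-links = Draining.live-links D
          ; unique = Scan.kept-unique scanned
          ; cover = Draining.cover D
          ; bound = λ {e} e∈ → s≤s (<⇒≤ (≤-trans (Scan.kept> scanned e∈) (LevelStart.supp≤deg (Scanning.start-inv scanning) e))) }
        ; x≡ = refl
        -- Scanning and draining are bounded separately; the time between them occurs on both sides
        -- of the added bounds and cancels.
        ; time≤ = +-cancelʳ-≤ (time σ₁) _ _ (begin
            5 + time σ₂ + (K + potential A′) + time σ₁          ≡⟨ rearrange₁ (time σ₂) (potential A′) K (time σ₁) ⟩
            5 + (time σ₂ + potential A′) + (time σ₁ + K)        ≤⟨ +-mono-≤ (+-monoʳ-≤ 5 t≤′) t≤ ⟩
            5 + (suc (time σ₁) + potential A) + (3 + time σ + S ∸ 9) ≡⟨ rearrange₂ (time σ₁) (potential A) _ ⟩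
            6 + (3 + time σ + S ∸ 9) + (potential A + time σ₁)  ≡⟨ cong (_+ (potential A + time σ₁)) six ⟩
            time σ + S + (potential A + time σ₁)                ≡⟨ rearrange₃ (time σ) S (potential A) (time σ₁) ⟩
            time σ + (S + potential A) + time σ₁                ∎) })
        where
        K = scanPotential (suc k) kept
        six : 6 + (3 + time σ + S ∸ 9) ≡ time σ + S
        six = +-cancelˡ-≡ 3 _ _ (m+[n∸m]≡n nine≤)
        rearrange₁ : ∀ t p k u → 5 + t + (k + p) + u ≡ 5 + (t + p) + (u + k)
        rearrange₁ = solve-∀
        rearrange₂ : ∀ u p x → 5 + (suc u + p) + x ≡ 6 + x + (p + u)
        rearrange₂ = solve-∀
        rearrange₃ : ∀ t s p u → t + s + (p + u) ≡ t + (s + p) + u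
        rearrange₃ = solve-∀

  Decomposed : ℕ → State → Set
  Decomposed T σ = (∀ e → IsTrussness G e (mem σ SUPP (toℕ e))) × time σ ≤ T

  minDeg≤m : ∀ e → minDeg e ≤ m
  minDeg≤m e = ≤-trans (m⊓n≤m (deg (src e)) _)
    (subst (deg (src e) ≤_) (length-allFin m) (length-filter (incident? (src e)) (allFin m)))

  -- An edge is live at level `k` only if `k` is at most one more than its smaller degree, hence at
  -- most `suc m`. This limits the number of levels and provides the fuel.
  level-loop : ∀ fuel {k A f l σ T} → suc m < k + fuel → AtLevel k A (f ∷ l) σ →
    time σ + (scanPotential k (f ∷ l) + potential A) ≤ T → Wp (until rX level) (Decomposed T) σ
  level-loop zero {k} {f = f} bound inv _ = ⊥-elim (<⇒≱ bound (≤-trans (≤-reflexive (+-identityʳ k))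
    (≤-trans (AtLevel.bound inv (here refl)) (s≤s (minDeg≤m f)))))
  level-loop (suc fuel) {k} {A} {f} {l} {σ} {T} bound inv t≤ = wp-until (wp-mono next (level-spec inv))
    where
    next : ∀ {σ′} → Levelled k (time σ + (scanPotential k (f ∷ l) + potential A)) σ′ →
      (reg σ′ rX ≡ 0 × Wp (until rX level) (Decomposed T) (tick σ′)) ⊎ (reg σ′ rX ≢ 0 × Decomposed T (tick σ′))
    next {σ′} L with Levelled.live L | Levelled.inv L | Levelled.time≤ L
    ... | [] | inv′ | t≤′ = inj₂
      ( (λ x≡0 → case trans (sym (trans (Levelled.x≡ L) (cong (1 ∸_) (AtLevel.live-links inv′)))) x≡0 of λ ())
      , start-trussness (AtLevel.start-inv inv′) (λ e → ≰⇒> λ k≤s → case AtLevel.cover inv′ k≤s of λ ())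
      , ≤-trans (m≤m+n _ _) (≤-trans t≤′ t≤) )
    ... | f′ ∷ l′ | inv′ | t≤′ = inj₁
      ( trans (Levelled.x≡ L) (trans (cong (1 ∸_) (proj₁ (AtLevel.live-links inv′))) (0∸n≡0 (toℕ f′)))
      , level-loop fuel (subst (suc m <_) (+-suc k fuel) bound) (record { AtLevel inv′ }) (≤-trans t≤′ t≤) )

  triangles≤minDeg : ∀ e → triangles G ⊤ e ≤ minDeg e
  triangles≤minDeg e = ⊓-glb (le (joins-self e)) (le (joins-sym (joins-self e)))
    where
    le : ∀ {u v} → Joins e u v → triangles G ⊤ e ≤ deg u
    le {u} {v} e-uv = ≤-trans (≤-reflexive (triangles-closes e-uv)) (length-filter (closes? u v) (incidents u))

  peel-spec : ∀ {k T σ} → m ≡ suc k → Counted 0 σ → time σ ≤ T →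
    Wp peel (Decomposed (2 + T + (scanPotential 0 (allFin m) + potential ⊤))) σ
  peel-spec {k} {T} {σ} m≡ inv t≤ = wp-seq (wp-block (nonempty (allFin m) refl at-start))
    where
    open Counted inv
    σ₁ : State
    σ₁ = setReg rSP 0 (setReg rK 0 σ)
    supp≡ : ∀ e → mem σ SUPP (toℕ e) ≡ triangles G ⊤ e
    supp≡ e = above e z≤n
    at-start : AtLevel 0 ⊤ (allFin m) σ₁
    at-start = record
      { k≡ = refl ; sp≡ = refl ; adj = adj
      ; flags = λ e → inj₁ (∈⊤ , dead0 (toℕ e))
      ; start-inv = record
        { done-truss = λ e () ; done-bound = λ e ()
        ; alive⁺ = λ _ → ∈⊤ ; alive⁻ = λ _ → z≤n
        ; exact = λ e _ → supp≡ e
        ; supp≤deg = λ e → subst (_≤ minDeg e) (sym (supp≡ e)) (triangles≤minDeg e) }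
      ; live-links = live ; unique = allFin⁺ m
      ; cover = λ {e} _ → ∈-allFin e ; bound = λ _ → z≤n }
    nonempty : ∀ l → l ≡ allFin m → AtLevel 0 ⊤ l σ₁ →
      Wp (until rX level) (Decomposed (2 + T + (scanPotential 0 (allFin m) + potential ⊤))) σ₁
    nonempty [] eq _ = case trans (trans (cong length eq) (length-allFin m)) m≡ of λ ()
    nonempty (f ∷ l) eq inv = level-loop (2 + m) ≤-refl inv
      (≤-trans (≤-reflexive (cong (λ l → 2 + time σ + (scanPotential 0 l + potential ⊤)) eq))
        (+-monoˡ-≤ _ (+-monoʳ-≤ 2 t≤)))

-- Rationals

fromℚᵘ-* : ∀ p q → ℚ.fromℚᵘ p ℚ.* ℚ.fromℚᵘ q ≡ ℚ.fromℚᵘ (p ℚᵘ.* q)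
fromℚᵘ-* p q = ℚ.toℚᵘ-injective (begin-equality
  ℚ.toℚᵘ (ℚ.fromℚᵘ p ℚ.* ℚ.fromℚᵘ q)                ≃⟨ ℚ.toℚᵘ-homo-* (ℚ.fromℚᵘ p) (ℚ.fromℚᵘ q) ⟩
  ℚ.toℚᵘ (ℚ.fromℚᵘ p) ℚᵘ.* ℚ.toℚᵘ (ℚ.fromℚᵘ q)     ≃⟨ ℚᵘ.*-cong (ℚ.toℚᵘ-fromℚᵘ p) (ℚ.toℚᵘ-fromℚᵘ q) ⟩
  p ℚᵘ.* q                                          ≃⟨ ℚ.toℚᵘ-fromℚᵘ (p ℚᵘ.* q) ⟨
  ℚ.toℚᵘ (ℚ.fromℚᵘ (p ℚᵘ.* q))                      ∎)
  where open ℚᵘ.≤-Reasoning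

ℕ→ℚ-* : ∀ a b → ℕ→ℚ a ℚ.* ℕ→ℚ b ≡ ℕ→ℚ (a * b)
ℕ→ℚ-* a b = trans (fromℚᵘ-* (mkℚᵘ (ℤ.+ a) 0) (mkℚᵘ (ℤ.+ b) 0))
  (ℚ.fromℚᵘ-cong {mkℚᵘ (ℤ.+ a) 0 ℚᵘ.* mkℚᵘ (ℤ.+ b) 0} {mkℚᵘ (ℤ.+ (a * b)) 0}
    (*≡* (cong (ℤ._* ℤ.+ 1) (sym (ℤ.pos-* a b)))))

ℕ→ℚ-mono : ∀ {a b} → a ≤ b → ℕ→ℚ a ℚ.≤ ℕ→ℚ b
ℕ→ℚ-mono {a} {b} a≤b = ℚ.toℚᵘ-cancel-≤ (begin
  ℚ.toℚᵘ (ℕ→ℚ a)     ≃⟨ ℚ.toℚᵘ-fromℚᵘ (mkℚᵘ (ℤ.+ a) 0) ⟩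
  mkℚᵘ (ℤ.+ a) 0     ≤⟨ *≤* (ℤ.*-monoʳ-≤-nonNeg (ℤ.+ 1) (ℤ.+≤+ a≤b)) ⟩
  mkℚᵘ (ℤ.+ b) 0     ≃⟨ ℚ.toℚᵘ-fromℚᵘ (mkℚᵘ (ℤ.+ b) 0) ⟨
  ℚ.toℚᵘ (ℕ→ℚ b)     ∎)
  where open ℚᵘ.≤-Reasoning

ℕ→ℚ-*-/ : ∀ k d .{{_ : NonZero k}} → ℕ→ℚ k ℚ.* (ℤ.+ d ℚ./ k) ≡ ℕ→ℚ d
ℕ→ℚ-*-/ (suc k) d = trans (fromℚᵘ-* (mkℚᵘ (ℤ.+ suc k) 0) (mkℚᵘ (ℤ.+ d) k))
  (ℚ.fromℚᵘ-cong {mkℚᵘ (ℤ.+ suc k) 0 ℚᵘ.* mkℚᵘ (ℤ.+ d) k} {mkℚᵘ (ℤ.+ d) 0} (*≡* (begin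
    ℤ.+ suc k ℤ.* ℤ.+ d ℤ.* ℤ.+ 1     ≡⟨ ℤ.*-identityʳ _ ⟩
    ℤ.+ suc k ℤ.* ℤ.+ d               ≡⟨ ℤ.*-comm (ℤ.+ suc k) (ℤ.+ d) ⟩
    ℤ.+ d ℤ.* ℤ.+ suc k               ≡⟨ cong (λ j → ℤ.+ d ℤ.* ℤ.+ suc j) (+-identityʳ k) ⟨
    ℤ.+ d ℤ.* ℤ.+ suc (k + 0)         ∎)))
  where open ≡-Reasoning

module _ (G : Graph) .{{_ : NonZero (Graph.m G)}} where
  open Graph G

  minDegSum : ℕ
  minDegSum = sum (map (λ e → deg (src e) ⊓ deg (tgt e)) (allFin m))

  -- Multiplication by `m` cancels the denominator of `δ̄`, so bounds that involve it reduce to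
  -- bounds between natural numbers.
  m*δ̄ : ℕ→ℚ m ℚ.* δ̄ ≡ ℕ→ℚ minDegSum
  m*δ̄ = ℕ→ℚ-*-/ m minDegSum

-- The complete program, its running time and its memory

main : Code
main = build ⨟ count ⨟ peel

decomposition : Program
decomposition = record { regs = 16 ; arrays = 8 ; code = compile 0 main ; out = SUPP }

module _ (G : Graph) where
  open Graph G

  -- Every vertex is an end of some edge. So arrays indexed by vertices still fit into memory linear
  -- in `m`.
  vertices≤2m : n ≤ m + m
  vertices≤2m = subst₂ _≤_ (length-allFin n)
    (trans (length-++ (map src (allFin m)))
      (cong₂ _+_ (trans (length-map src (allFin m)) (length-allFin m)) (trans (length-map tgt (allFin m)) (length-allFin m))))
    (length-injection _≡_ {ys = map src (allFin m) ++ map tgt (allFin m)} (allFin⁺ n)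
      (λ {v} _ → v , endpoint v (no-isolated v) , refl) (λ p q → trans p (sym q)))
    where
    endpoint : ∀ v → (∃ λ e → Incident v e) → v ∈ˡ (map src (allFin m) ++ map tgt (allFin m))
    endpoint v (e , inj₁ refl) = ∈-++⁺ˡ (∈-map⁺ src (∈-allFin e))
    endpoint v (e , inj₂ refl) = ∈-++⁺ʳ (map src (allFin m)) (∈-map⁺ tgt (∈-allFin e))

  deg-positive : ∀ {v e} → Incident v e → 1 ≤ deg v
  deg-positive {v} {e} inc with filter (incident? v) (allFin m) | ∈-filter⁺ (incident? v) (∈-allFin e) inc
  ... | _ ∷ _ | _ = s≤s z≤n

  open Peeling G using (minDeg)

  -- Both ends of an edge have positive degree. This absorbs the terms linear in `m` into the sum of
  -- the minima.
  m≤minDegSum : m ≤ sum (map minDeg (allFin m))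
  m≤minDegSum = subst (_≤ sum (map minDeg (allFin m)))
    (trans (sum-const 1 (allFin m)) (trans (*-identityʳ _) (length-allFin m)))
    (sum-mono {f = const 1} {minDeg} {allFin m} λ {e} _ → ⊓-glb (deg-positive {e = e} (inj₁ refl)) (deg-positive {e = e} (inj₂ refl)))

  module _ (k : ℕ) (m≡ : m ≡ suc k) where
    private
      s : ℕ
      -- All arrays have the same length, which must suffice for vertices and for edges.
      s = n + m
      1≤m : 1 ≤ m
      1≤m = subst (1 ≤_) (sym m≡) (s≤s z≤n)
      scale : ∀ a {b} → 1 ≤ b → a ≤ a * b
      scale a {b} 1≤b = subst (_≤ a * b) (*-identityʳ a) (*-monoʳ-≤ a 1≤b)
    open Semantics (compile 0 main) SUPP G s
    open Counting (compile 0 main) G s (m≤m+n n m) (m≤n+m m n)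
    open Decomposition (compile 0 main) G s (m≤m+n n m) (m≤n+m m n)

    private
      D : ℕ
      D = sum (map minDeg (allFin m))
      T₁ T₂ T₃ : ℕ
      T₁ = 1 + sum (map (const 23) (allFin m))
      T₂ = 1 + T₁ + sum (map countCost (allFin m))
      T₃ = 2 + T₂ + (scanPotential 0 (allFin m) + potential ⊤)

      main-spec : Wp main (Decomposed T₃) start
      main-spec = wp-seq (wp-mono
        (λ { (built , t₁) → wp-seq (wp-mono (λ { (counted , t₂) → peel-spec m≡ counted t₂ }) (count-spec m≡ built t₁)) })
        (build-spec m≡))
        where open Building (compile 0 main) G s (m≤m+n n m) (m≤n+m m n)

      -- Building costs 23m, counting 20m + 24D, scanning 52m + 26D and removing 22m + 56D, besides
      -- 4 single instructions. Since `m` is at most `D`, this is at most 4 + 117 + 106 times `D`.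
      T₃≤ : T₃ ≤ 227 * D
      T₃≤ = begin
        T₃
          ≤⟨ +-monoʳ-≤ (2 + T₂) (+-monoʳ-≤ (scanPotential 0 (allFin m)) (sum-mono {xs = allFin m} (λ {e} _ → weight≤ ⊤ e))) ⟩
        2 + T₂ + (scanPotential 0 (allFin m) + sum (map removeCost (allFin m)))
          ≡⟨ cong₂ (λ x y → 2 + x + y)
               (cong₂ (λ x y → 1 + (1 + x) + y) (trans (sum-const 23 (allFin m)) (cong (_* 23) (length-allFin m))) (sum≡ 20 24))
               (cong₂ _+_ scan≡ (sum≡ 22 56)) ⟩
        2 + (1 + (1 + m * 23) + (20 * m + 24 * D)) + ((52 * m + 26 * D) + (22 * m + 56 * D))
          ≡⟨ collect m D ⟩
        4 + (117 * m + 106 * D)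
          ≤⟨ +-mono-≤ (scale 4 (≤-trans 1≤m m≤minDegSum)) (+-monoˡ-≤ (106 * D) (*-monoʳ-≤ 117 m≤minDegSum)) ⟩
        4 * D + (117 * D + 106 * D)
          ≡⟨ cong (4 * D +_) (*-distribʳ-+ D 117 106) ⟨
        4 * D + 223 * D
          ≡⟨ *-distribʳ-+ D 4 223 ⟨
        227 * D ∎
        where
        open ≤-Reasoning
        sum≡ : ∀ a b → sum (map (λ e → a + b * minDeg e) (allFin m)) ≡ a * m + b * D
        sum≡ a b = trans (sum-affine a b minDeg (allFin m)) (cong (λ l → a * l + b * D) (length-allFin m))
        scan≡ : scanPotential 0 (allFin m) ≡ 52 * m + 26 * D
        scan≡ = trans (cong sum (map-cong (λ e → *-distribˡ-+ 26 2 (minDeg e)) (allFin m))) (sum≡ 52 26)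
        regroup : ∀ a b c d e f g → 2 + (1 + (1 + a) + (b + c)) + ((d + e) + (f + g)) ≡ 4 + (a + b + d + f + (c + e + g))
        regroup = solve-∀
        sum₃ : ∀ a b c d x → a * x + b * x + c * x + d * x ≡ (a + b + c + d) * x
        sum₃ a b c d x = sym (trans (*-distribʳ-+ x (a + b + c) d) (cong (_+ d * x)
          (trans (*-distribʳ-+ x (a + b) c) (cong (_+ c * x) (*-distribʳ-+ x a b)))))
        collect : ∀ m d → 2 + (1 + (1 + m * 23) + (20 * m + 24 * d)) + ((52 * m + 26 * d) + (22 * m + 56 * d))
          ≡ 4 + (117 * m + 106 * d)
        collect m d = trans (regroup (m * 23) (20 * m) (24 * d) (52 * m) (26 * d) (22 * m) (56 * d))
          (cong (4 +_) (cong₂ _+_ (trans (cong (λ x → x + 20 * m + 52 * m + 22 * m) (*-comm m 23)) (sum₃ 23 20 52 22 m))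
            (trans (sym (+-identityʳ _)) (sum₃ 24 26 56 0 d))))

    decomposition-correct : ∃ λ t → ∃ λ κ →
      Machine._⇓[_]_ decomposition G s (Machine.initial decomposition G s) t κ
      × Machine.OutputsTrussness decomposition G s κ × t ≤ 227 * D
    decomposition-correct = package (wp-halts {main} refl main-spec)
      where
      package : (∃ λ t → ∃ λ κ → Machine._⇓[_]_ decomposition G s (Machine.initial decomposition G s) t κ
          × ∃ λ σ → time σ ≡ t × Decomposed T₃ σ
          × (∀ e → toℕ e < s → Machine.output decomposition G s κ e ≡ just (mem σ SUPP (toℕ e)))) →
        ∃ λ t → ∃ λ κ → Machine._⇓[_]_ decomposition G s (Machine.initial decomposition G s) t κ
          × Machine.OutputsTrussness decomposition G s κ × t ≤ 227 * D
      package (t , κ , halts , σ , refl , (truss , t≤) , output≡) = t , κ , halts ,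
        (λ e → mem σ SUPP (toℕ e) , output≡ e (≤-trans (toℕ<n e) (m≤n+m m n)) , truss e) , ≤-trans t≤ T₃≤

    decomposition-words : Machine.words decomposition G s ≤ 227 * m
    decomposition-words = begin
      16 + 8 * (n + m)                   ≤⟨ +-mono-≤ (scale 16 1≤m) (*-monoʳ-≤ 8 (+-monoˡ-≤ m vertices≤2m)) ⟩
      16 * m + 8 * (m + m + m)           ≡⟨ cong (λ x → 16 * m + 8 * x) (thrice m) ⟩
      16 * m + 8 * (3 * m)               ≡⟨ cong (16 * m +_) (*-assoc 8 3 m) ⟨
      16 * m + 24 * m                    ≡⟨ *-distribʳ-+ m 16 24 ⟨
      -- Time and memory share one constant, so 40 is enlarged to 227.
      40 * m                             ≤⟨ *-monoˡ-≤ m (m≤m+n 40 187) ⟩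
      227 * m                            ∎
      where
      open ≤-Reasoning
      thrice : ∀ m → m + m + m ≡ 3 * m
      thrice = solve-∀

truss-decomposition : ∃ λ (P : Program) → ∃ λ (c : ℕ) →
  ∀ (G : Graph) → .{{_ : NonZero (Graph.m G)}} →
  ∃ λ (s : ℕ) → ∃ λ (t : ℕ) → ∃ λ (σ : Machine.Config P G s) →
  Machine._⇓[_]_ P G s (Machine.initial P G s) t σ
  × Machine.OutputsTrussness P G s σ
  × Machine.words P G s ℕ.≤ c ℕ.* Graph.m G
  × ℕ→ℚ t ℚ.≤ ℕ→ℚ c ℚ.* (ℕ→ℚ (Graph.m G) ℚ.* Graph.δ̄ G)
truss-decomposition = decomposition , 227 , λ G → instantiate G (positive (Graph.m G))
  where
  positive : ∀ j .{{_ : NonZero j}} → ∃ λ k → j ≡ suc k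
  positive (suc k) = k , refl
  Result : (G : Graph) .{{_ : NonZero (Graph.m G)}} → Set
  Result G = ∃ λ (s : ℕ) → ∃ λ (t : ℕ) → ∃ λ (σ : Machine.Config decomposition G s) →
    Machine._⇓[_]_ decomposition G s (Machine.initial decomposition G s) t σ
    × Machine.OutputsTrussness decomposition G s σ
    × Machine.words decomposition G s ℕ.≤ 227 ℕ.* Graph.m G
    × ℕ→ℚ t ℚ.≤ ℕ→ℚ 227 ℚ.* (ℕ→ℚ (Graph.m G) ℚ.* Graph.δ̄ G)
  instantiate : ∀ G .{{_ : NonZero (Graph.m G)}} → (∃ λ k → Graph.m G ≡ suc k) → Result G
  instantiate G (k , m≡) = package (decomposition-correct G k m≡)
    where
    open Graph G using (n; m)
    package : (∃ λ t → ∃ λ κ → Machine._⇓[_]_ decomposition G (n + m) (Machine.initial decomposition G (n + m)) t κ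
      × Machine.OutputsTrussness decomposition G (n + m) κ × t ≤ 227 * minDegSum G) → Result G
    package (t , κ , halts , correct , t≤) = n + m , t , κ , halts , correct , decomposition-words G k m≡ ,
      subst (ℕ→ℚ t ℚ.≤_) (trans (sym (ℕ→ℚ-* 227 (minDegSum G))) (cong (ℕ→ℚ 227 ℚ.*_) (sym (m*δ̄ G)))) (ℕ→ℚ-mono t≤)

-- Lists for counting half-edges and for paths

length-cartesianProduct : {A B : Set} (xs : List A) (ys : List B) → length (cartesianProduct xs ys) ≡ length xs * length ys
length-cartesianProduct []       ys = refl
length-cartesianProduct (x ∷ xs) ys = trans (length-++ (map (x ,_) ys))
  (cong₂ _+_ (length-map (x ,_) ys) (length-cartesianProduct xs ys))

unique-prefix : {A : Set} (xs : List A) {ys : List A} → Unique (xs ++ ys) → Unique xs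
unique-prefix []       _        = []
unique-prefix (x ∷ xs) (x∉ ∷ u) = All.tabulate (λ y∈ → All.lookup x∉ (∈-++⁺ˡ y∈)) ∷ unique-prefix xs u

unique-lookup : {A : Set} {xs : List A} → Unique xs → ∀ {i j} → lookup xs i ≡ lookup xs j → i ≡ j
unique-lookup (x∉ ∷ u) {zero}  {zero}  _  = refl
unique-lookup (x∉ ∷ u) {zero}  {suc j} eq = ⊥-elim (All.lookup x∉ (∈-lookup j) eq)
unique-lookup (x∉ ∷ u) {suc i} {zero}  eq = ⊥-elim (All.lookup x∉ (∈-lookup i) (sym eq))
unique-lookup (x∉ ∷ u) {suc i} {suc j} eq = cong suc (unique-lookup u eq)

lastOf : {A : Set} → A → List A → A
lastOf x []      = x
lastOf x (y ∷ l) = lastOf y l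

lastOf-++ : {A : Set} (x : A) (l : List A) {w : A} → lastOf x (l ++ [ w ]) ≡ w
lastOf-++ x []      = refl
lastOf-++ x (y ∷ l) = lastOf-++ y l

lookup-last : {A : Set} (x : A) (l : List A) → lookup (x ∷ l) (fromℕ (length l)) ≡ lastOf x l
lookup-last x []      = refl
lookup-last x (y ∷ l) = lookup-last y l

-- Forests

module Forests (G : Graph) where
  open Graph G
  open Triangles G

  endpoint : Fin m → Bool → Fin n
  endpoint f b = if b then src f else tgt f

  -- In a rooted forest this is the choice, for every edge, of its end away from the root; it is
  -- expressed by injectivity alone.
  record Orientation (L : Subset m) : Set where
    field
      end       : Fin m → Fin n
      incident  : ∀ {e} → e ∈ L → Incident (end e) e
      injective : ∀ {e f} → e ∈ L → f ∈ L → end e ≡ end f → e ≡ f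

  module _ (L : Subset m) where

    IsLeaf : Fin n → Fin m → Set
    IsLeaf v e = e ∈ L × Incident v e × (∀ f → f ∈ L → Incident v f → f ≡ e)

    isLeaf? : ∀ v e → Dec (IsLeaf v e)
    isLeaf? v e = (e ∈? L) ×-dec incident? v e ×-dec all? (λ f → (f ∈? L) →-dec (incident? v f →-dec (f ≟ᶠ e)))

    Steps : List (Fin n) → Set
    Steps (x ∷ y ∷ l) = Adj G L x y × Steps (y ∷ l)
    Steps _           = Unit

    steps-prefix : ∀ l {l′} → Steps (l ++ l′) → Steps l
    steps-prefix []          _       = _
    steps-prefix (x ∷ [])    _       = _
    steps-prefix (x ∷ y ∷ l) (a , s) = a , steps-prefix (y ∷ l) s

    steps-lookup : ∀ x l → Steps (x ∷ l) → (i : Fin (length l)) → Adj G L (lookup (x ∷ l) (inject₁ i)) (lookup l i)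
    steps-lookup x (y ∷ l) (a , s) zero    = a
    steps-lookup x (y ∷ l) (a , s) (suc i) = steps-lookup y l s i

    -- `w ≢ b` excludes going back along the first edge, so the closed path has at least three
    -- vertices.
    closed-path : ∀ a b l {w} → Unique (a ∷ b ∷ l) → Steps (a ∷ b ∷ l) → lastOf b l ≡ w → w ≢ b → Adj G L w a → Cycle G L
    closed-path a b []      u s last≡ w≢b adj = ⊥-elim (w≢b (sym last≡))
    closed-path a b (c ∷ l) u s last≡ w≢b adj = record
      { extra    = length l
      ; vertex   = lookup (a ∷ b ∷ c ∷ l)
      ; distinct = unique-lookup u
      ; step     = steps-lookup a (b ∷ c ∷ l) s
      ; close    = subst (λ w → Adj G L w a) (sym (trans (lookup-last a (b ∷ c ∷ l)) last≡)) adj }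

    -- Without leaves every path extends until it meets itself.
    walk : (∀ v e → ¬ IsLeaf v e) → ∀ fuel x y r → n < fuel + length (x ∷ y ∷ r) →
      Unique (x ∷ y ∷ r) → Steps (x ∷ y ∷ r) → Cycle G L
    -- Without fuel the path would have more than `n` distinct vertices.
    walk no-leaf zero x y r bound u _ = ⊥-elim (<⇒≱ bound (subst (length (x ∷ y ∷ r) ≤_) (length-allFin n)
      (length-injection _≡_ {ys = allFin n} u (λ {v} _ → v , ∈-allFin v , refl) (λ p q → trans p (sym q)))))
    walk no-leaf (suc fuel) x y r bound u s@((e , e∈ , e-xy) , _)
      with any? (λ f → (f ∈? L) ×-dec incident? x f ×-dec ¬? (f ≟ᶠ e))
    ... | no none = ⊥-elim (no-leaf x e (e∈ , joins-incident e-xy , λ f f∈ inc → case f ≟ᶠ e of λ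
      { (yes eq) → eq ; (no f≢e) → ⊥-elim (none (f , f∈ , inc , f≢e)) }))
    ... | yes (f , f∈ , inc , f≢e) with incident-joins inc
    ... | w , f-xw with decMember _≟ᶠ_ w r
    ...   | no w∉r = walk no-leaf fuel w x (y ∷ r) (subst (n <_) (sym (+-suc fuel _)) bound)
      (All.tabulate (λ { (here refl) w≡x → joins-≢ f-xw (sym w≡x)
                       ; (there (here refl)) w≡y → w≢y w≡y
                       ; (there (there z∈)) w≡z → w∉r (subst (_∈ˡ r) (sym w≡z) z∈) }) ∷ u)
      ((f , f∈ , joins-sym f-xw) , s)
      where
      w≢y : w ≢ y
      w≢y refl = f≢e (simple f-xw e-xy)
    -- The path has met itself: its part from `x` to `w` is closed by `f`. As `f` differs from `e`,
    -- simplicity gives `w ≢ y`.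
    ...   | yes w∈r with ∈-∃++ w∈r
    ...     | as , bs , refl = closed-path x y (as ++ [ w ])
      (unique-prefix (x ∷ y ∷ as ++ [ w ]) (subst Unique split u))
      (steps-prefix (x ∷ y ∷ as ++ [ w ]) (subst Steps split s))
      (lastOf-++ y as) (λ { refl → f≢e (simple f-xw e-xy) }) (f , f∈ , joins-sym f-xw)
      where
      split : x ∷ y ∷ (as ++ w ∷ bs) ≡ (x ∷ y ∷ as ++ [ w ]) ++ bs
      split = cong (λ l → x ∷ y ∷ l) (sym (++-assoc as [ w ] bs))

  cycle-mono : ∀ {L L′} → L ⊆ L′ → Cycle G L → Cycle G L′
  cycle-mono L⊆ C = record
    { extra = extra ; vertex = vertex ; distinct = distinct ; step = adj-mono L⊆ ∘ step ; close = adj-mono L⊆ close }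
    where open Cycle C

  -- A nonempty forest has a leaf, since otherwise `walk` finds a cycle. The edge at the leaf is
  -- assigned the leaf, which is no end of another edge of `L`, so the choice for the remaining
  -- edges stays injective.
  orient : ∀ fuel L → ∣ L ∣ < fuel → IsForest G L → Orientation L
  orient (suc fuel) L (s≤s bound) forest with any? (_∈? L)
  ... | no none = record { end = src ; incident = λ _ → inj₁ refl ; injective = λ e∈ → ⊥-elim (none (_ , e∈)) }
  ... | yes (e₀ , e₀∈) with any? (λ v → any? (isLeaf? L v))
  ... | no none = ⊥-elim (forest (walk L (λ v e leaf → none (v , e , leaf)) n (src e₀) (tgt e₀) []
    (m<m+n n z<s) (((λ eq → loopless e₀ eq) ∷ []) ∷ [] ∷ []) ((e₀ , e₀∈ , joins-self e₀) , _)))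
  ... | yes (v , e , e∈ , inc , only) = record { end = end′ ; incident = incident′ ; injective = injective′ }
    where
    keep? : ∀ f → Dec (f ∈ L × f ≢ e)
    keep? f = (f ∈? L) ×-dec ¬? (f ≟ᶠ e)
    L′ : Subset m
    L′ = subset keep?
    L′⊆L : L′ ⊆ L
    L′⊆L f∈ = proj₁ (∈-subset⁻ keep? f∈)
    smaller : Orientation L′
    smaller = orient fuel L′
      (≤-trans (p⊂q⇒∣p∣<∣q∣ (L′⊆L , e , e∈ , λ e∈L′ → proj₂ (∈-subset⁻ keep? e∈L′) refl)) bound)
      (forest ∘ cycle-mono L′⊆L)
    open Orientation smaller
    pick : ∀ f → Dec (f ≡ e) → Fin n
    pick f (yes _) = v
    pick f (no  _) = end f
    end′ : Fin m → Fin n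
    end′ f = pick f (f ≟ᶠ e)
    incident′ : ∀ {f} → f ∈ L → Incident (end′ f) f
    incident′ {f} f∈ with f ≟ᶠ e
    ... | yes refl = inc
    ... | no f≢e   = incident (∈-subset⁺ keep? (f∈ , f≢e))
    injective′ : ∀ {f g} → f ∈ L → g ∈ L → end′ f ≡ end′ g → f ≡ g
    injective′ {f} {g} f∈ g∈ eq with f ≟ᶠ e | g ≟ᶠ e
    ... | yes refl | yes refl = refl
    ... | yes refl | no g≢e = sym (only g g∈ (subst (λ x → Incident x g) (sym eq) (incident (∈-subset⁺ keep? (g∈ , g≢e)))))
    ... | no f≢e | yes refl = only f f∈ (subst (λ x → Incident x f) eq (incident (∈-subset⁺ keep? (f∈ , f≢e))))
    ... | no f≢e | no g≢e = injective (∈-subset⁺ keep? (f∈ , f≢e)) (∈-subset⁺ keep? (g∈ , g≢e)) eq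

  incident-endpoint : ∀ {v f} → Incident v f → ∃ λ b → endpoint f b ≡ v
  incident-endpoint (inj₁ eq) = true , eq
  incident-endpoint (inj₂ eq) = false , eq

  halfEdges : List (Fin m × Bool)
  halfEdges = cartesianProduct (allFin m) (true ∷ false ∷ [])

  ∈-halfEdges : ∀ f b → (f , b) ∈ˡ halfEdges
  ∈-halfEdges f b = ∈-cartesianProduct⁺ (∈-allFin f) (∈-bools b)
    where
    ∈-bools : ∀ b → b ∈ˡ (true ∷ false ∷ [])
    ∈-bools true  = here refl
    ∈-bools false = there (here refl)

  length-halfEdges : length halfEdges ≡ m * 2
  length-halfEdges = trans (length-cartesianProduct (allFin m) (true ∷ false ∷ [])) (cong (_* 2) (length-allFin m))

  -- Charge min(deg u, deg v) for e = uv in the forest F j to the half-edges (f , b) at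
  -- the endpoint chosen for e: each (j , f , b) is charged at most once.
  minDegSum≤ : ∀ {α} → ForestPartition G α → sum (map (λ e → deg (src e) ⊓ deg (tgt e)) (allFin m)) ≤ α * (m * 2)
  minDegSum≤ {α} (F , partition , forests) = begin
    sum (map (λ e → deg (src e) ⊓ deg (tgt e)) (allFin m))
      ≤⟨ sum-mono {xs = allFin m} (λ {e} _ → min≤ e (incident (part e) (∈part e))) ⟩
    sum (map (λ e → length (incidents (end (part e) e))) (allFin m))
      ≤⟨ sum-length-injection (λ e → incidents (end (part e) e)) Charged (allFin⁺ m) (λ e → incidents-unique _) charge charged-once ⟩
    length (cartesianProduct (allFin α) halfEdges)
      ≡⟨ length-cartesianProduct (allFin α) halfEdges ⟩
    length (allFin α) * length halfEdges
      ≡⟨ cong₂ _*_ (length-allFin α) length-halfEdges ⟩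
    α * (m * 2) ∎
    where
    open ≤-Reasoning
    part : Fin m → Fin α
    part e = proj₁ (partition e)
    ∈part : ∀ e → e ∈ F (part e)
    ∈part e = proj₁ (proj₂ (partition e))
    orientation : ∀ j → Orientation (F j)
    orientation j = orient (suc ∣ F j ∣) (F j) ≤-refl (forests j)
    open module O j = Orientation (orientation j)
    min≤ : ∀ e {v} → Incident v e → deg (src e) ⊓ deg (tgt e) ≤ deg v
    min≤ e (inj₁ refl) = m⊓n≤m _ _
    min≤ e (inj₂ refl) = m⊓n≤n _ _
    Charged : Fin m → Fin m → Fin α × Fin m × Bool → Set
    Charged e f (j , g , b) = part e ≡ j × f ≡ g × endpoint f b ≡ end j e
    charge : ∀ {e f} → e ∈ˡ allFin m → f ∈ˡ incidents (end (part e) e) →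
      ∃ λ y → y ∈ˡ cartesianProduct (allFin α) halfEdges × Charged e f y
    charge {e} {f} _ f∈ with incident-endpoint (∈-incidents⁻ f∈)
    ... | b , eq = (part e , f , b) , ∈-cartesianProduct⁺ (∈-allFin (part e)) (∈-halfEdges f b) , refl , refl , eq
    charged-once : ∀ {e f e′ f′ y} → Charged e f y → Charged e′ f′ y → e ≡ e′ × f ≡ f′
    charged-once {e} {f} {e′} {y = j , _ , b} (p , refl , q) (p′ , refl , q′) =
      injective j (subst (λ j → e ∈ F j) p (∈part e)) (subst (λ j → e′ ∈ F j) p′ (∈part e′)) (trans (sym q) q′) , refl

average-degeneracy≤arboricity : ∃ λ (c : ℕ) → ∀ (G : Graph) → .{{_ : NonZero (Graph.m G)}} →
  ∀ (α : ℕ) → IsArboricity G α →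
  ℕ→ℚ (Graph.m G) ℚ.* Graph.δ̄ G ℚ.≤ ℕ→ℚ c ℚ.* ℕ→ℚ (Graph.m G ℕ.* α)
-- The factor 2 counts the two half-edges of an edge.
average-degeneracy≤arboricity = 2 , λ G α (forests , _) →
  subst₂ ℚ._≤_ (sym (m*δ̄ G)) (sym (ℕ→ℚ-* 2 (Graph.m G * α)))
    (ℕ→ℚ-mono (≤-trans (Forests.minDegSum≤ G forests) (≤-reflexive (rearrange α (Graph.m G)))))
  where
  rearrange : ∀ α m → α * (m * 2) ≡ 2 * (m * α)
  rearrange = solve-∀

-- The arboricity is at most of order √m

square-sup : ∀ {n} (d : Fin n → ℕ) B → (∀ v → d v * d v ≤ B) → ∃ λ K → (∀ v → d v ≤ K) × K * K ≤ B
square-sup {zero}  d B le = 0 , (λ ()) , z≤n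
square-sup {suc n} d B le with square-sup (d ∘ suc) B (le ∘ suc)
... | K , d≤K , K²≤B with ≤-total (d zero) K
...   | inj₁ d₀≤K = K , (λ { zero → d₀≤K ; (suc v) → d≤K v }) , K²≤B
...   | inj₂ K≤d₀ = d zero , (λ { zero → ≤-refl ; (suc v) → ≤-trans (d≤K v) K≤d₀ }) , le zero

argmin : ∀ {n} (f : Fin (suc n) → ℕ) → ∃ λ i → ∀ j → f i ≤ f j
argmin {zero}  f = zero , λ { zero → ≤-refl }
argmin {suc n} f with argmin (f ∘ suc)
... | i , min with ≤-total (f zero) (f (suc i))
...   | inj₁ f₀≤ = zero , λ { zero → ≤-refl ; (suc j) → ≤-trans f₀≤ (min j) }
...   | inj₂ ≤f₀ = suc i , λ { zero → ≤f₀ ; (suc j) → min j }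

-- The positions are taken in the out-lists of two tails that are only propositionally equal;
-- generalising over both lists allows matching on that equality.
index-injective : {A : Set} {xs ys : List A} {x y : A} → xs ≡ ys → (p : x ∈ˡ xs) (q : y ∈ˡ ys) →
  toℕ (Any.index p) ≡ toℕ (Any.index q) → x ≡ y
index-injective {xs = xs} refl p q eq =
  trans (lookup-index p) (trans (cong (lookup xs) (toℕ-injective eq)) (sym (lookup-index q)))

-- Orient every edge towards its end of larger degree (ties are broken by the index).
-- The d out-neighbours of v then have degree at least deg v ≥ d, so d² ≤ 2m.  Numbering
-- the out-edges of each vertex partitions the edges into forests: the two edges at the
-- least vertex of a cycle are both out-edges, so their numbers differ.
module OutEdges (G : Graph) where
  open Graph G
  open Triangles G
  open Forests G using (endpoint; incident-endpoint; halfEdges; ∈-halfEdges; length-halfEdges)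

  -- The lexicographic order on degree and index as a single number: the index is below `n`, so it
  -- acts as the last digit.
  key : Fin n → ℕ
  key v = deg v * n + toℕ v

  key-< : ∀ {u v} → deg u < deg v → key u < key v
  key-< {u} {v} lt = begin-strict
    deg u * n + toℕ u  <⟨ +-monoʳ-< (deg u * n) (toℕ<n u) ⟩
    deg u * n + n      ≡⟨ +-comm (deg u * n) n ⟩
    suc (deg u) * n    ≤⟨ *-monoˡ-≤ n lt ⟩
    deg v * n          ≤⟨ m≤m+n _ _ ⟩
    key v              ∎
    where open ≤-Reasoning

  key-≤ : ∀ {u v} → key u ≤ key v → deg u ≤ deg v
  key-≤ le = ≮⇒≥ λ lt → <⇒≱ (key-< lt) le

  key-injective : ∀ {u v} → key u ≡ key v → u ≡ v
  key-injective {u} {v} eq = toℕ-injective (+-cancelˡ-≡ (deg u * n) _ _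
    (trans eq (cong (λ d → d * n + toℕ v) (≤-antisym (key-≤ (≤-reflexive (sym eq))) (key-≤ (≤-reflexive eq))))))

  ends : (e : Fin m) → ∃ λ u → ∃ λ v → Joins e u v × key u ≤ key v
  ends e with ≤-total (key (src e)) (key (tgt e))
  ... | inj₁ le = src e , tgt e , joins-self e , le
  ... | inj₂ le = tgt e , src e , joins-sym (joins-self e) , le

  tail hd : Fin m → Fin n
  tail e = proj₁ (ends e)
  hd e   = proj₁ (proj₂ (ends e))

  joins-ends : ∀ e → Joins e (tail e) (hd e)
  joins-ends e = proj₁ (proj₂ (proj₂ (ends e)))

  tail-least : ∀ {e u v} → Joins e u v → key u ≤ key v → tail e ≡ u
  tail-least {e} e-uv le with joins-same (joins-ends e) e-uv
  ... | inj₁ (tail≡u , _) = tail≡u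
  ... | inj₂ (tail≡v , hd≡u) = trans tail≡v (sym (key-injective (≤-antisym le
    (subst₂ (λ a b → key a ≤ key b) tail≡v hd≡u (proj₂ (proj₂ (proj₂ (ends e))))))))

  out : Fin n → List (Fin m)
  out v = filter (λ e → tail e ≟ᶠ v) (allFin m)

  ∈-out⁺ : ∀ e → e ∈ˡ out (tail e)
  ∈-out⁺ e = ∈-filter⁺ (λ f → tail f ≟ᶠ tail e) (∈-allFin e) refl

  ∈-out⁻ : ∀ {v e} → e ∈ˡ out v → tail e ≡ v
  ∈-out⁻ {v} e∈ = proj₂ (∈-filter⁻ (λ f → tail f ≟ᶠ v) {xs = allFin m} e∈)

  out-unique : ∀ v → Unique (out v)
  out-unique v = filter⁺ (λ e → tail e ≟ᶠ v) (allFin⁺ m)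

  outdeg : Fin n → ℕ
  outdeg v = length (out v)

  outdeg≤deg : ∀ v → outdeg v ≤ deg v
  outdeg≤deg v = length-injection _≡_ {ys = incidents v} (out-unique v)
    (λ {e} e∈ → e , ∈-incidents⁺ (subst (λ x → Incident x e) (∈-out⁻ e∈) (joins-incident (joins-ends e))) , refl)
    (λ p q → trans p (sym q))

  -- Different out-edges of `v` have different heads because the graph is simple, so the half-edges
  -- at these heads are all distinct.
  outdeg² : ∀ v → outdeg v * outdeg v ≤ m * 2
  outdeg² v = begin
    outdeg v * outdeg v                                    ≡⟨ sum-const (outdeg v) (out v) ⟨
    sum (map (const (outdeg v)) (out v))                   ≤⟨ sum-mono {xs = out v} outdeg≤hd ⟩
    sum (map (λ e → length (incidents (hd e))) (out v))    ≤⟨ sum-length-injection (incidents ∘ hd) Charged (out-unique v) (λ e → incidents-unique (hd e)) charge charged-once ⟩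
    length halfEdges                                       ≡⟨ length-halfEdges ⟩
    m * 2                                                  ∎
    where
    open ≤-Reasoning
    outdeg≤hd : ∀ {e} → e ∈ˡ out v → outdeg v ≤ deg (hd e)
    outdeg≤hd {e} e∈ = ≤-trans (outdeg≤deg v)
      (subst (λ x → deg x ≤ deg (hd e)) (∈-out⁻ e∈) (key-≤ (proj₂ (proj₂ (proj₂ (ends e))))))
    Charged : Fin m → Fin m → Fin m × Bool → Set
    Charged e f (g , b) = tail e ≡ v × f ≡ g × endpoint f b ≡ hd e
    charge : ∀ {e f} → e ∈ˡ out v → f ∈ˡ incidents (hd e) → ∃ λ y → y ∈ˡ halfEdges × Charged e f y
    charge {e} {f} e∈ f∈ with incident-endpoint (∈-incidents⁻ f∈)
    ... | b , eq = (f , b) , ∈-halfEdges f b , ∈-out⁻ e∈ , refl , eq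
    charged-once : ∀ {e f e′ f′ y} → Charged e f y → Charged e′ f′ y → e ≡ e′ × f ≡ f′
    charged-once {e} {f} {e′} (t , refl , h) (t′ , refl , h′) = simple
      (subst₂ (Joins e) t (sym h) (joins-ends e)) (subst₂ (Joins e′) t′ (sym h′) (joins-ends e′)) , refl

  module _ (K : ℕ) (outdeg≤K : ∀ v → outdeg v ≤ K) where

    colour : Fin m → Fin K
    colour e = inject≤ (Any.index (∈-out⁺ e)) (outdeg≤K (tail e))

    colour-injective : ∀ {e f} → tail e ≡ tail f → colour e ≡ colour f → e ≡ f
    colour-injective {e} {f} tails eq = index-injective (cong out tails) (∈-out⁺ e) (∈-out⁺ f)
      (trans (sym (toℕ-inject≤ _ (outdeg≤K (tail e)))) (trans (cong toℕ eq) (toℕ-inject≤ _ (outdeg≤K (tail f)))))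

    class : Fin K → Subset m
    class j = subset (λ e → colour e ≟ᶠ j)

    class-colour : ∀ {j e} → e ∈ class j → colour e ≡ j
    class-colour {j} = ∈-subset⁻ (λ e → colour e ≟ᶠ j)

    -- The closing edge serves index zero and the last index, which `topView` splits off; the steps
    -- serve all others. Since a cycle has at least three vertices, the two neighbouring indices
    -- differ in each case.
    cycle-neighbours : ∀ {L} (C : Cycle G L) → let open Cycle C in ∀ i → ∃ λ a → ∃ λ b → a ≢ b ×
      Adj G L (vertex i) (vertex a) × Adj G L (vertex i) (vertex b)
    cycle-neighbours C zero = suc zero , fromℕ _ , (λ ()) , step zero , adj-sym close
      where open Cycle C
    cycle-neighbours C (suc i) with topView i
    ... | ‵fromℕ = inject₁ i , zero , (λ ()) , adj-sym (step i) , close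
      where open Cycle C
    ... | ‵inj₁ {i = j} _ = inject₁ (inject₁ j) , suc (suc j) , distinct-ends , adj-sym (step (inject₁ j)) , step (suc j)
      where
      open Cycle C
      distinct-ends : inject₁ (inject₁ j) ≢ suc (suc j)
      distinct-ends eq = <⇒≢ (m<n+m (toℕ j) {2} z<s)
        (trans (sym (trans (toℕ-inject₁ (inject₁ j)) (toℕ-inject₁ j))) (cong toℕ eq))

    class-forest : ∀ j → IsForest G (class j)
    class-forest j C with argmin (key ∘ Cycle.vertex C)
    ... | i , least with cycle-neighbours C i
    ... | a , b , a≢b , (e , e∈ , e-ia) , (f , f∈ , f-ib) = a≢b (distinct (joins-other e-ia
      (subst (λ g → Joins g (vertex i) (vertex b)) (sym e≡f) f-ib)))
      where
      open Cycle C
      e≡f : e ≡ f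
      e≡f = colour-injective (trans (tail-least e-ia (least a)) (sym (tail-least f-ib (least b))))
        (trans (class-colour e∈) (sym (class-colour f∈)))

    colouring : ForestPartition G K
    colouring = class
      , (λ e → colour e , ∈-subset⁺ (λ f → colour f ≟ᶠ colour e) refl , class-colour)
      , class-forest

  -- `square-sup` yields the largest outdegree `K`. As `K` is itself an outdegree or 0, its square
  -- obeys the same bound and no square root has to be taken.
  arboricity² : ∀ {α} → IsArboricity G α → α * α ≤ m * 2
  arboricity² (_ , least) with square-sup outdeg (m * 2) outdeg²
  ... | K , outdeg≤K , K² = ≤-trans (*-mono-≤ α≤K α≤K) K²
    where
    α≤K = least K (colouring K outdeg≤K)

arboricity≤√m : ∃ λ (c : ℕ) → ∀ (G : Graph) (α : ℕ) → IsArboricity G α →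
  (Graph.m G ℕ.* α) ℕ.^ 2 ℕ.≤ c ℕ.^ 2 ℕ.* Graph.m G ℕ.^ 3
arboricity≤√m = 2 , λ G α arb → bound (Graph.m G) α (OutEdges.arboricity² G arb)
  where
  bound : ∀ m α → α * α ≤ m * 2 → (m * α) ^ 2 ≤ 2 ^ 2 * m ^ 3
  bound m α le = begin
    (m * α) ^ 2             ≡⟨ square m α ⟩
    m * m * (α * α)         ≤⟨ *-monoʳ-≤ (m * m) le ⟩
    -- The constant is a natural number whose square must be at least 2; `c = 2` gives 4, hence the
    -- doubling.
    m * m * (m * 2)         ≤⟨ m≤m+n _ (m * m * (m * 2)) ⟩
    m * m * (m * 2) + m * m * (m * 2) ≡⟨ cube m ⟩
    2 ^ 2 * m ^ 3           ∎
    where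
    open ≤-Reasoning
    square : ∀ m α → m * α * (m * α * 1) ≡ m * m * (α * α)
    square = solve-∀
    cube : ∀ m → m * m * (m * 2) + m * m * (m * 2) ≡ 4 * (m * (m * (m * 1)))
    cube = solve-∀

theorem1p2 : (∃ λ (P : Program) → ∃ λ (c : ℕ) →
    ∀ (G : Graph) → .{{_ : NonZero (Graph.m G)}} →
    ∃ λ (s : ℕ) → ∃ λ (t : ℕ) → ∃ λ (σ : Machine.Config P G s) →
    Machine._⇓[_]_ P G s (Machine.initial P G s) t σ
    × Machine.OutputsTrussness P G s σ
    × Machine.words P G s ℕ.≤ c ℕ.* Graph.m G
    × ℕ→ℚ t ℚ.≤ ℕ→ℚ c ℚ.* (ℕ→ℚ (Graph.m G) ℚ.* Graph.δ̄ G))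
    × (∃ λ (c : ℕ) → ∀ (G : Graph) → .{{_ : NonZero (Graph.m G)}} →
    ∀ (α : ℕ) → IsArboricity G α →
    ℕ→ℚ (Graph.m G) ℚ.* Graph.δ̄ G ℚ.≤ ℕ→ℚ c ℚ.* ℕ→ℚ (Graph.m G ℕ.* α))
    -- m α ≤ c m^(3/2), with both sides squared
    × (∃ λ (c : ℕ) → ∀ (G : Graph) (α : ℕ) → IsArboricity G α →
    (Graph.m G ℕ.* α) ℕ.^ 2 ℕ.≤ c ℕ.^ 2 ℕ.* Graph.m G ℕ.^ 3)
theorem1p2 = truss-decomposition , average-degeneracy≤arboricity , arboricity≤√m
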